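{- Given PIBQFs $q_1,q_2$, the following recursive procedure terminates and its output is $\mathrm{Int}^{RS}(q_1,q_2)$. (1) Compute the continued fraction expansions of the first roots $q_{1,f}$ and $q_{2,f}$ and translate them (by the rule in the context) into the river sequences $r_1=(x_1,\dots,x_m)$ of $q_1$ and $r_2=(y_1,\dots,y_n)$ of $q_2$, with $L=0$ and $R=1$. Let $i_{1,0},i_{1,1}\subseteq\mathbb Z/m$ be the sets of indices $i$ with $x_i=0$, respectively $x_i=1$, and let $i_{2,0},i_{2,1}\subseteq\mathbb Z/n$ be the sets of indices $j$ with $y_j=0$, respectively $y_j=1$. (2) Initialize $S$ to be the empty word, $T_1=i_{1,0}+1$, $T_2=i_{2,1}+1$, $k=1$, and a global counter $I=0$; call Step 3 with $(S,T_1,T_2,k)$. (3) Given $(S,T_1,T_2,k)$: if $T_1$ or $T_2$ is empty, return to the previous layer $k-1$. (4) Increment $I$ by $|i_{1,1}\cap T_1|\cdot|i_{2,0}\cap T_2|$. (5) Set $S'=S0$, $T_1'=(i_{1,0}\cap T_1)+1$, $T_2'=(i_{2,0}\cap T_2)+1$, and call Step 3 with input $(S',T_1',T_2',k+1)$. (6) Set $S'=S1$, $T_1'=(i_{1,1}\cap T_1)+1$, $T_2'=(i_{2,1}\cap T_2)+1$, and call Step 3 with input $(S',T_1',T_2',k+1)$. (7) If $k=1$, output $I$ and stop; otherwise return to the previous layer $k-1$.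
   Context: Forms. Write $[A,B,C]$ for the integral form $Ax^2+Bxy+Cy^2$, of discriminant $D=B^2-4AC$. A PIBQF is such a form with $\gcd(A,B,C)=1$ and $D>0$ not a perfect square; its first root is $q_f=\frac{ -B+\sqrt D}{2A}$. $\mathrm{PSL}(2,\mathbb Z)$ acts on forms by $(\gamma\circ q)(x,y)=q(ax+by,cx+dy)$ for $\gamma=\begin{pmatrix}a&b\\c&d\end{pmatrix}$. Topograph. Let $G$ be the infinite $3$-regular tree drawn in the oriented plane. For an oriented edge $e$ pointing to a vertex $V$, let $\bar e$ be its reversal and let $\mathrm{left}(e)$ be the edge obtained by travelling along $e$ to $V$ and taking the left branch, oriented away from $V$. With $S=\begin{pmatrix}0&1\\-1&0\end{pmatrix}$ and $T=\begin{pmatrix}1&1\\0&1\end{pmatrix}$, the topograph of $q$ is $G$ together with the unique assignment $e\mapsto f(e)$ of forms to oriented edges such that $f(e_0)=q$ for a chosen base oriented edge $e_0$, $f(\bar e)=S\circ f(e)$, $f(\mathrm{left}(e))=T\circ f(e)$. If $f(e)=[A,B,C]$ then $A$ is the number in the region to the left of $e$ and $C$ the number in the region to its right. River. For a PIBQF, the river is the set of edges whose form $[A,B,C]$ satisfies $AC<0$; it is a bi-infinite path separating regions with positive numbers from those with negative numbers, and it flows in the direction which has the positive regions on its left. Following the flow and recording at each vertex whether the river turns left ($L$) or right ($R$) gives a bi-infinite periodic sequence; one least period, up to cyclic shift, is the river sequence. Continued fraction rule. Let $q_f=[a_0,a_1,\dots,a_s,\overline{a_{s+1},\dots,a_{s+p}}]$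 where $s$ is the smallest integer such that the expansion is periodic after index $s$ and $p$ is the smallest even integer that is a period. Then the river sequence of $q$ is the sequence consisting of $s+1 \bmod 2$ repeated $a_{s+1}$ times, then $s+2\bmod 2$ repeated $a_{s+2}$ times, ..., then $s+p \bmod 2$ repeated $a_{s+p}$ times, with $1=R$, $0=L$. $\mathrm{Int}^{RS}$. Let $T_i,R_i$ be the topograph and river of $q_i$ (the topographs $T_1, T_2$ here are not to be confused with the index sets in the algorithm). A superimposition is an isomorphism $\varphi$ from the tree of the second topograph to that of the first preserving the planar cyclic orientation at every vertex. The rivers meet and cross if $R_1$ and $\varphi(R_2)$ share a finite nonempty path and $\varphi(R_2)$ joins this path from one side of $R_1$ and leaves it on the other side. $\mathrm{Int}^{RS}(q_1,q_2)$ is the number of superimpositions, modulo translations of each river by its period (i.e. $\varphi\equiv\tau_1^a\varphi\tau_2^b$ with $\tau_i$ the automorphism of the $i$-th topograph translating its river by one least period), for which the rivers meet and cross, the second river (followed along its flow) joins $R_1$ from the right-hand side of $R_1$ (with respect to the flow of $R_1$), and the two rivers flow in the same direction along their shared path. Notation. For a set $I$ of indices of a cyclic sequence of length $n$, $I+k=\{i+k \bmod n: i\in I\}$. $S0$, $S1$ denote the word $S$ with the letter $0$, respectively $1$, appended. -}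

module Defs where

open import Data.Bool.Base using (Bool; true; false; not; if_then_else_)
open import Data.Bool.Properties using (not-involutive)
open import Data.Fin.Base using (Fin; toℕ)
open import Data.Fin.Properties using (any?; nonZeroIndex)
import Data.Fin.Properties as Fin
open import Data.Fin.Subset using (Subset; _∩_; ∣_∣; Empty; Nonempty)
open import Data.Fin.Subset.Properties using (_∈?_)
open import Data.Integer.Base as ℤ using (ℤ; +_; -[1+_]; 0ℤ; 1ℤ; -1ℤ)
open import Data.Integer.GCD using (gcd)
open import Data.Integer.Properties using (neg-involutive)
open import Data.Integer.Tactic.RingSolver using (solve-∀)
open import Data.List.Base
  using (List; []; _∷_; _∷ʳ_; length; lookup; replicate; concatMap; applyUpTo)
open import Data.Nat.Base as ℕ using (ℕ; zero; suc)
open import Data.Nat.Divisibility using (_∣_)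
open import Data.Nat.DivMod using (_%_; _mod_)
open import Data.Nat.GeneralisedArithmetic using (fold)
open import Data.Product.Base using (_×_; _,_; ∃; ∃-syntax)
open import Data.Rational.Base as ℚ using (ℚ; 0ℚ; 1ℚ)
open import Data.Sum.Base using (_⊎_)
open import Data.Vec.Base using (tabulate)
open import Function.Bundles using (_↔_; module Inverse)
open import Relation.Binary.Definitions using (DecidableEquality)
open import Relation.Binary.PropositionalEquality
  using (_≡_; _≢_; refl; sym; trans; cong; module ≡-Reasoning)
open import Relation.Nullary.Decidable using (does; yes; no; _×-dec_)
open import Relation.Nullary.Negation using (¬_)

Least : (ℕ → Set) → ℕ → Set
Least P n = P n × (∀ m → P m → n ℕ.≤ m)

-- The letters: L stands for 0 and R for 1.

data Turn : Set where
  L R : Turn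

_≟ᵗ_ : DecidableEquality Turn
L ≟ᵗ L = yes refl
L ≟ᵗ R = no λ ()
R ≟ᵗ L = no λ ()
R ≟ᵗ R = yes refl

parity : ℕ → Turn
parity i with i % 2
... | zero  = L
... | suc _ = R

-- [ A , B , C ] is A x² + B x y + C y².
record Form : Set where
  constructor [_,_,_]
  field
    A B C : ℤ

open Form public

disc : Form → ℤ
disc [ a , b , c ] = b ℤ.* b ℤ.- + 4 ℤ.* a ℤ.* c

record PIBQF (q : Form) : Set where
  field
    coprime   : gcd (gcd (A q) (B q)) (C q) ≡ 1ℤ
    positive  : 0ℤ ℤ.< disc q
    nonsquare : ¬ (∃[ n ] n ℤ.* n ≡ disc q)

-- Representatives in SL(2,ℤ) of elements of PSL(2,ℤ); ± γ act equally.
record SL₂ℤ : Set where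
  field
    a b c d : ℤ
    det     : a ℤ.* d ℤ.- b ℤ.* c ≡ 1ℤ

-- The coefficients of q (a x + b y , c x + d y).
infixr 9 _∘ᶠ_
_∘ᶠ_ : SL₂ℤ → Form → Form
γ ∘ᶠ [ A , B , C ] =
  [ A * (a * a) + B * (a * c) + C * (c * c)
  , + 2 * A * (a * b) + B * (a * d + b * c) + + 2 * C * (c * d)
  , A * (b * b) + B * (b * d) + C * (d * d) ]
  where
  open SL₂ℤ γ
  open import Data.Integer.Base using (_+_; _*_)

S T : SL₂ℤ
S = record { a = 0ℤ ; b = 1ℤ ; c = -1ℤ ; d = 0ℤ ; det = refl }
T = record { a = 1ℤ ; b = 1ℤ ; c = 0ℤ ; d = 1ℤ ; det = refl }

-- u +√ v is u + v √D in the real quadratic field ℚ(√D), for D > 0 not a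
-- square; the order below is that of ℝ.
record ℚ√ (D : ℤ) : Set where
  constructor _+√_
  field
    rat irr : ℚ

fromℤ : ℤ → ℚ
fromℤ i = i ℚ./ 1

module _ {D : ℤ} where

  ι : ℤ → ℚ√ D
  ι n = fromℤ n +√ 0ℚ

  √D : ℚ√ D
  √D = 0ℚ +√ 1ℚ

  infixl 6 _⊕_ _⊖_
  infixl 7 _⊛_

  _⊕_ _⊖_ _⊛_ : ℚ√ D → ℚ√ D → ℚ√ D
  (u +√ v) ⊕ (u′ +√ v′) = (u ℚ.+ u′) +√ (v ℚ.+ v′)
  (u +√ v) ⊖ (u′ +√ v′) = (u ℚ.- u′) +√ (v ℚ.- v′)
  (u +√ v) ⊛ (u′ +√ v′) =
    (u ℚ.* u′ ℚ.+ fromℤ D ℚ.* (v ℚ.* v′)) +√ (u ℚ.* v′ ℚ.+ v ℚ.* u′)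

  -- 0 ≤ u + v √D, by the signs of u and v; when these differ, u² is
  -- compared with v² D.
  data NonNegative : ℚ√ D → Set where
    both : ∀ {u v} → 0ℚ ℚ.≤ u → 0ℚ ℚ.≤ v → NonNegative (u +√ v)
    ratDominates : ∀ {u v} → 0ℚ ℚ.≤ u → v ℚ.≤ 0ℚ →
      v ℚ.* v ℚ.* fromℤ D ℚ.≤ u ℚ.* u → NonNegative (u +√ v)
    irrDominates : ∀ {u v} → u ℚ.≤ 0ℚ → 0ℚ ℚ.≤ v →
      u ℚ.* u ℚ.≤ v ℚ.* v ℚ.* fromℤ D → NonNegative (u +√ v)

  infix 4 _≤√_ _<√_
  _≤√_ _<√_ : ℚ√ D → ℚ√ D → Set
  x ≤√ y = NonNegative (y ⊖ x)
  x <√ y = x ≤√ y × x ≢ y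

-- α = (- B + √D) / 2A.  The denominator is cleared; for a PIBQF, A ≠ 0
-- because D is not a square, so this determines α.
IsFirstRoot : (q : Form) → ℚ√ (disc q) → Set
IsFirstRoot q α = ι (+ 2 ℤ.* A q) ⊛ α ≡ ι (ℤ.- B q) ⊕ √D

-- α = [a 0 , a 1 , a 2 , …] for an irrational α, so that the expansion
-- never stops.
record IsContinuedFraction {D : ℤ} (α : ℚ√ D) (a : ℕ → ℤ) : Set where
  field
    quotient : ℕ → ℚ√ D
    start    : quotient 0 ≡ α
    floor≤   : ∀ i → ι (a i) ≤√ quotient i
    <floor+1 : ∀ i → quotient i <√ ι (a i ℤ.+ 1ℤ)
    step     : ∀ i → (quotient i ⊖ ι (a i)) ⊛ quotient (suc i) ≡ ι 1ℤ

IsPeriodFrom : {X : Set} → (ℕ → X) → ℕ → ℕ → Set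
IsPeriodFrom a t p = 0 ℕ.< p × (∀ i → t ℕ.≤ i → a (i ℕ.+ p) ≡ a i)

-- With α = [a_0 , … , a_s , overline (a_{s+1} , … , a_{s+p})] and
-- t = s + 1 (so t = 0, s = -1 for a purely periodic expansion), r is
-- (t mod 2) repeated a_t times, …, (t + p - 1 mod 2) repeated a_{t+p-1}
-- times.  The a_i involved are positive.
record IsComputedRiverSequence (q : Form) (r : List Turn) : Set where
  field
    α            : ℚ√ (disc q)
    firstRoot    : IsFirstRoot q α
    a            : ℕ → ℤ
    expansion    : IsContinuedFraction α a
    t p          : ℕ
    leastStart   : Least (λ t′ → ∃[ p′ ] IsPeriodFrom a t′ p′) t
    leastPeriod  : Least (λ p′ → 2 ∣ p′ × IsPeriodFrom a t p′) p
    sequence     : r ≡ concatMap (λ i → replicate ℤ.∣ a i ∣ (parity i))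
                                 (applyUpTo (t ℕ.+_) p)

-- The indices of a cyclic sequence of length n, elements of ℤ/n, are taken
-- in Fin n, starting from 0.
indices : Turn → (r : List Turn) → Subset (length r)
indices x r = tabulate λ i → does (lookup r i ≟ᵗ x)

-- {i + k mod n : i ∈ I}
infixl 6 _+ˢ_
_+ˢ_ : ∀ {n} → Subset n → ℕ → Subset n
_+ˢ_ {n} I k =
  tabulate λ j → does (any? λ i → (i ∈? I) ×-dec (shift i Fin.≟ j))
  where
  shift : Fin n → Fin n
  shift i = _mod_ (toℕ i ℕ.+ k) n {{nonZeroIndex i}}

-- How a call ends, with the value of the global counter at that time.
data Outcome : Set where
  returnTo : (layer : ℕ) (counter : ℕ) → Outcome
  output   : ℕ → Outcome

-- At the end of a call in the outermost layer, output the counter.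
finish : (k I : ℕ) → Outcome
finish 1 I = output I
finish k I = returnTo (ℕ.pred k) I

module Procedure (r₁ r₂ : List Turn) where

  i₁₀ i₁₁ : Subset (length r₁)
  i₁₀ = indices L r₁
  i₁₁ = indices R r₁

  i₂₀ i₂₁ : Subset (length r₂)
  i₂₀ = indices L r₂
  i₂₁ = indices R r₂

  -- Call S T₁ T₂ k I o : the recursive step called with (S , T₁ , T₂ , k),
  -- while the global counter is I, terminates with outcome o.
  data Call (S : List Turn) (T₁ : Subset (length r₁)) (T₂ : Subset (length r₂))
            (k I : ℕ) : Outcome → Set where
    stop : Empty T₁ ⊎ Empty T₂ → Call S T₁ T₂ k I (returnTo (ℕ.pred k) I)
    recurse : ∀ {I′ I″} → Nonempty T₁ → Nonempty T₂ →
      Call (S ∷ʳ L) ((i₁₀ ∩ T₁) +ˢ 1) ((i₂₀ ∩ T₂) +ˢ 1) (suc k)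
        (I ℕ.+ ∣ i₁₁ ∩ T₁ ∣ ℕ.* ∣ i₂₀ ∩ T₂ ∣) (returnTo k I′) →
      Call (S ∷ʳ R) ((i₁₁ ∩ T₁) +ˢ 1) ((i₂₁ ∩ T₂) +ˢ 1) (suc k)
        I′ (returnTo k I″) →
      Call S T₁ T₂ k I (finish k I″)

  Outputs : ℕ → Set
  Outputs I = Call [] (i₁₀ +ˢ 1) (i₂₁ +ˢ 1) 1 0 (output I)

-- The whole procedure, run on (q₁ , q₂), terminates with output I.  Every
-- step is deterministic.
record ProcedureOutputs (q₁ q₂ : Form) (I : ℕ) : Set where
  field
    r₁ r₂     : List Turn
    sequence₁ : IsComputedRiverSequence q₁ r₁
    sequence₂ : IsComputedRiverSequence q₂ r₂
    run       : Procedure.Outputs r₁ r₂ I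

-- Cut an edge of the tree in its middle; what remains is two rooted binary
-- trees.  A vertex is given by the tree (near or far) containing it and by
-- the turns taken to reach it from the root, last turn first.
record Vertex : Set where
  constructor _∶_
  field
    far?  : Bool
    turns : List Turn

-- The three branches at a vertex: back to the parent (for a root: across
-- the cut edge), or the left or right branch for somebody coming from there.
data Branch : Set where
  back : Branch
  ahead : Turn → Branch

-- An oriented edge is given by its initial vertex and the branch there.
record OrientedEdge : Set where
  constructor _,_
  field
    source : Vertex
    branch : Branch

bar : OrientedEdge → OrientedEdge
bar ((s ∶ w)       , ahead x) = (s ∶ (x ∷ w)) , back
bar ((s ∶ (x ∷ w)) , back)    = (s ∶ w) , ahead x
bar ((s ∶ [])      , back)    = (not s ∶ []) , back

-- The next edge counterclockwise, respectively clockwise, among those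
-- leaving the same vertex.
ccw cw : OrientedEdge → OrientedEdge
ccw (v , back)    = v , ahead R
ccw (v , ahead R) = v , ahead L
ccw (v , ahead L) = v , back
cw e = ccw (ccw e)

-- Travel along e and take the left or right branch.
left right : OrientedEdge → OrientedEdge
left  e = cw (bar e)
right e = ccw (bar e)

follow : Turn → OrientedEdge → OrientedEdge
follow L = left
follow R = right

-- Isomorphisms of the tree that preserve the planar cyclic orientation.
record PlanarIso : Set where
  field
    bijection : OrientedEdge ↔ OrientedEdge
  open Inverse bijection public using (to; from)
  field
    to-bar : ∀ e → to (bar e) ≡ bar (to e)
    to-ccw : ∀ e → to (ccw e) ≡ ccw (to e)

power : PlanarIso → ℤ → OrientedEdge → OrientedEdge
power τ (+ n)      e = fold e (PlanarIso.to τ) n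
power τ (-[1+ n ]) e = fold e (PlanarIso.from τ) (suc n)

record Topograph (q : Form) : Set where
  field
    base      : OrientedEdge
    form      : OrientedEdge → Form
    form-base : form base ≡ q
    form-bar  : ∀ e → form (bar e) ≡ S ∘ᶠ form e
    form-left : ∀ e → form (left e) ≡ T ∘ᶠ form e

module _ {q : Form} (𝕋 : Topograph q) where
  open Topograph 𝕋

  OnRiver : OrientedEdge → Set
  OnRiver e = A (form e) ℤ.* C (form e) ℤ.< 0ℤ

  -- e lies on the river and is oriented as the river flows.
  Downstream : OrientedEdge → Set
  Downstream e = OnRiver e × 0ℤ ℤ.< A (form e)

  -- The river as a bi-infinite path followed along its flow, with its
  -- bi-infinite sequence of turns.  It is unique up to the choice of edge 0.
  record River : Set where
    field
      edge       : ℤ → OrientedEdge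
      turn       : ℤ → Turn
      downstream : ∀ i → Downstream (edge i)
      covers     : ∀ e → Downstream e → ∃[ i ] edge i ≡ e
      next       : ∀ i → edge (i ℤ.+ 1ℤ) ≡ follow (turn i) (edge i)

IsPeriod : (ℤ → Turn) → ℕ → Set
IsPeriod x n = 0 ℕ.< n × (∀ i → x (i ℤ.+ + n) ≡ x i)

-- The orientation-preserving automorphism of the tree that translates the
-- river by one least period; it is determined by its value on one edge.
record RiverTranslation {q : Form} {𝕋 : Topograph q} (ρ : River 𝕋) : Set where
  open River ρ
  field
    τ           : PlanarIso
    period      : ℕ
    leastPeriod : Least (IsPeriod turn) period
    translates  : ∀ i → PlanarIso.to τ (edge i) ≡ edge (i ℤ.+ + period)

-- d leaves the middle vertex of the path e , e′, on its right-hand side,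
-- respectively its left-hand side.
OnRightSide OnLeftSide : (e e′ d : OrientedEdge) → Set
OnRightSide e e′ d = e′ ≡ left e × d ≡ right e
OnLeftSide  e e′ d = e′ ≡ right e × d ≡ left e

module _ {q₁ q₂ : Form} {𝕋₁ : Topograph q₁} {𝕋₂ : Topograph q₂}
         (ρ₁ : River 𝕋₁) (ρ₂ : River 𝕋₂) where

  open River ρ₁ renaming (edge to edge₁) using ()
  open River ρ₂ renaming (edge to edge₂) using ()

  -- The shared path consists of the edges i, …, i + ℓ of the first river,
  -- which are the images of the edges j, …, j + ℓ of the second one, both
  -- rivers flowing in the same direction.  The second river joins from the
  -- right-hand side of the first and leaves on the left-hand side.
  record MeetAndCrossRS (φ : PlanarIso) : Set where
    open PlanarIso φ
    field
      i j    : ℤ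
      ℓ      : ℕ
      shared : ∀ t → t ℕ.≤ ℓ → to (edge₂ (j ℤ.+ + t)) ≡ edge₁ (i ℤ.+ + t)
      joins  : OnRightSide (edge₁ (i ℤ.- 1ℤ)) (edge₁ i)
                 (bar (to (edge₂ (j ℤ.- 1ℤ))))
      leaves : OnLeftSide (edge₁ (i ℤ.+ + ℓ)) (edge₁ (i ℤ.+ + ℓ ℤ.+ 1ℤ))
                 (to (edge₂ (j ℤ.+ + ℓ ℤ.+ 1ℤ)))

  EqualModTranslations : RiverTranslation ρ₁ → RiverTranslation ρ₂ →
    PlanarIso → PlanarIso → Set
  EqualModTranslations θ₁ θ₂ φ ψ = ∃[ a ] ∃[ b ] ∀ e →
    to φ e ≡ power (τ θ₁) a (to ψ (power (τ θ₂) b e))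
    where
    open PlanarIso using (to)
    open RiverTranslation using (τ)

-- There are exactly n elements satisfying P, modulo ∼.
record CountModulo {X : Set} (P : X → Set) (_∼_ : X → X → Set) (n : ℕ) : Set where
  field
    representative : Fin n → X
    satisfies      : ∀ k → P (representative k)
    distinct       : ∀ k l → representative k ∼ representative l → k ≡ l
    exhaustive     : ∀ x → P x → ∃[ k ] x ∼ representative k

-- n is the intersection number.  The rivers (up to the choice of edge 0)
-- and the translations are unique, so their existence is all that is asked.
record IntRS {q₁ q₂ : Form} (𝕋₁ : Topograph q₁) (𝕋₂ : Topograph q₂) (n : ℕ) : Set where
  field
    ρ₁    : River 𝕋₁
    ρ₂    : River 𝕋₂
    θ₁    : RiverTranslation ρ₁
    θ₂    : RiverTranslation ρ₂
    count : CountModulo (MeetAndCrossRS ρ₁ ρ₂)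
                        (EqualModTranslations ρ₁ ρ₂ θ₁ θ₂) n

module _ (q : Form) where

  -- The form on the edge leading to a vertex from its parent.
  incoming : Vertex → Form
  incoming (s ∶ [])      = if s then S ∘ᶠ q else q
  incoming (s ∶ (L ∷ w)) = T ∘ᶠ incoming (s ∶ w)
  incoming (s ∶ (R ∷ w)) = T ∘ᶠ S ∘ᶠ T ∘ᶠ incoming (s ∶ w)

  formAt : OrientedEdge → Form
  formAt (v , back)    = S ∘ᶠ incoming v
  formAt (v , ahead L) = T ∘ᶠ incoming v
  formAt (v , ahead R) = T ∘ᶠ S ∘ᶠ T ∘ᶠ incoming v

private
  form-≡ : ∀ {f g} → A f ≡ A g → B f ≡ B g → C f ≡ C g → f ≡ g
  form-≡ refl refl refl = refl

  S-action : ∀ a b c → S ∘ᶠ [ a , b , c ] ≡ [ c , ℤ.- b , a ]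
  S-action a b c = form-≡ (eqA a b c) (eqB a b c) (eqC a b c)
    where
    open import Data.Integer.Base using (_+_; _*_; -_)
    eqA : ∀ a b c → a * (+ 0 * + 0) + b * (+ 0 * -[1+ 0 ]) + c * (-[1+ 0 ] * -[1+ 0 ]) ≡ c
    eqA = solve-∀
    eqB : ∀ a b c → + 2 * a * (+ 0 * + 1) + b * (+ 0 * + 0 + + 1 * -[1+ 0 ])
                      + + 2 * c * (-[1+ 0 ] * + 0) ≡ - b
    eqB = solve-∀
    eqC : ∀ a b c → a * (+ 1 * + 1) + b * (+ 1 * + 0) + c * (+ 0 * + 0) ≡ a
    eqC = solve-∀

  T-action : ∀ a b c →
    T ∘ᶠ [ a , b , c ] ≡ [ a , b ℤ.+ + 2 ℤ.* a , a ℤ.+ b ℤ.+ c ]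
  T-action a b c = form-≡ (eqA a b c) (eqB a b c) (eqC a b c)
    where
    open import Data.Integer.Base using (_+_; _*_)
    eqA : ∀ a b c → a * (+ 1 * + 1) + b * (+ 1 * + 0) + c * (+ 0 * + 0) ≡ a
    eqA = solve-∀
    eqB : ∀ a b c → + 2 * a * (+ 1 * + 1) + b * (+ 1 * + 1 + + 1 * + 0)
                      + + 2 * c * (+ 0 * + 1) ≡ b + + 2 * a
    eqB = solve-∀
    eqC : ∀ a b c → a * (+ 1 * + 1) + b * (+ 1 * + 1) + c * (+ 1 * + 1) ≡ a + b + c
    eqC = solve-∀

  S²≡1 : ∀ f → S ∘ᶠ S ∘ᶠ f ≡ f
  S²≡1 [ a , b , c ] =
    trans (cong (S ∘ᶠ_) (S-action a b c))
      (trans (S-action c (ℤ.- b) a) (form-≡ refl (neg-involutive b) refl))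

  [TS]²T≡S : ∀ f → T ∘ᶠ S ∘ᶠ T ∘ᶠ S ∘ᶠ T ∘ᶠ f ≡ S ∘ᶠ f
  [TS]²T≡S [ a , b , c ] = begin
    T ∘ᶠ S ∘ᶠ T ∘ᶠ S ∘ᶠ T ∘ᶠ [ a , b , c ]
      ≡⟨ cong (λ f → T ∘ᶠ S ∘ᶠ T ∘ᶠ S ∘ᶠ f) (T-action a b c) ⟩
    T ∘ᶠ S ∘ᶠ T ∘ᶠ S ∘ᶠ [ a , b′ , c′ ]
      ≡⟨ cong (λ f → T ∘ᶠ S ∘ᶠ T ∘ᶠ f) (S-action a b′ c′) ⟩
    T ∘ᶠ S ∘ᶠ T ∘ᶠ [ c′ , - b′ , a ]
      ≡⟨ cong (λ f → T ∘ᶠ S ∘ᶠ f) (T-action c′ (- b′) a) ⟩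
    T ∘ᶠ S ∘ᶠ [ c′ , - b′ + + 2 * c′ , c′ + - b′ + a ]
      ≡⟨ cong (T ∘ᶠ_) (S-action c′ (- b′ + + 2 * c′) (c′ + - b′ + a)) ⟩
    T ∘ᶠ [ c′ + - b′ + a , - (- b′ + + 2 * c′) , c′ ]
      ≡⟨ T-action (c′ + - b′ + a) (- (- b′ + + 2 * c′)) c′ ⟩
    _ ≡⟨ form-≡ (eqA a b c) (eqB a b c) (eqC a b c) ⟩
    [ c , - b , a ]
      ≡⟨ S-action a b c ⟨
    S ∘ᶠ [ a , b , c ] ∎
    where
    open import Data.Integer.Base using (_+_; _*_; -_)
    open ≡-Reasoning
    b′ = b + + 2 * a
    c′ = a + b + c
    eqA : ∀ a b c → a + b + c + - (b + + 2 * a) + a ≡ c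
    eqA = solve-∀
    eqB : ∀ a b c → - (- (b + + 2 * a) + + 2 * (a + b + c))
                      + + 2 * (a + b + c + - (b + + 2 * a) + a) ≡ - b
    eqB = solve-∀
    eqC : ∀ a b c → a + b + c + - (b + + 2 * a) + a
                      + - (- (b + + 2 * a) + + 2 * (a + b + c)) + (a + b + c) ≡ a
    eqC = solve-∀

bar-involutive : ∀ e → bar (bar e) ≡ e
bar-involutive ((s ∶ w)       , ahead x) = refl
bar-involutive ((s ∶ (x ∷ w)) , back)    = refl
bar-involutive ((s ∶ [])      , back)    =
  cong (λ s′ → (s′ ∶ []) , back) (not-involutive s)

formAt-bar : ∀ q e → formAt q (bar e) ≡ S ∘ᶠ formAt q e
formAt-bar q ((s ∶ w) , ahead L)         = refl
formAt-bar q ((s ∶ w) , ahead R)         = refl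
formAt-bar q ((s ∶ (L ∷ w)) , back)      = sym (S²≡1 (formAt q ((s ∶ w) , ahead L)))
formAt-bar q ((s ∶ (R ∷ w)) , back)      = sym (S²≡1 (formAt q ((s ∶ w) , ahead R)))
formAt-bar q ((false ∶ []) , back)       = refl
formAt-bar q ((true ∶ []) , back)        = sym (S²≡1 (S ∘ᶠ q))

formAt-cw : ∀ q e → formAt q (cw e) ≡ T ∘ᶠ S ∘ᶠ formAt q e
formAt-cw q (v , back)    = cong (T ∘ᶠ_) (sym (S²≡1 (incoming q v)))
formAt-cw q (v , ahead L) = refl
formAt-cw q (v , ahead R) = sym ([TS]²T≡S (incoming q v))

topograph : ∀ q → Topograph q
topograph q = record
  { base      = (true ∶ []) , back
  ; form      = formAt q
  ; form-base = S²≡1 q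
  ; form-bar  = formAt-bar q
  ; form-left = λ e → trans (formAt-cw q (bar e))
      (cong (T ∘ᶠ_) (trans (sym (formAt-bar q (bar e)))
                           (cong (formAt q) (bar-involutive e))))
  }

module Submission where

-- A planar automorphism of the tree is determined by the image of one edge, so
-- a superimposition with the required crossing is determined by the edges i and
-- j at which the rivers meet; since paths in a tree that have parted do not meet
-- again, it determines i and j, and modulo translations they are indices of the
-- river sequences.  The letters before i and j are L and R, and the sequences
-- read from there first differ by R and L.  The procedure counts such pairs by
-- the common word read so far; it terminates since two periodic sequences that
-- agree for a common period agree forever, also backwards.
--
-- The steps of the continued fraction algorithm, z ↦ 1 / (z - ⌊z⌋), act on
-- forms of discriminant D; they make |B| decrease until the roots satisfy
-- z > 1 and z′ < 0.  From then on each of them is a run of equal turns of the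
-- river, and the finiteness of the number of such forms makes both periodic.

open import Defs
open import Data.Bool.Base using (true; false)
open import Data.Fin.Base as Fin using (Fin; zero; suc; toℕ; fromℕ<; splitAt; _↑ˡ_; _↑ʳ_; remQuot; combine)
open import Data.Fin.Properties using (any?; nonZeroIndex)
import Data.Fin.Properties as Fin
open import Data.Fin.Subset using (Subset; _∩_; ∣_∣; _∈_; Empty; Nonempty; inside; outside)
open import Data.Fin.Subset.Properties using (_∈?_; nonempty?; x∈p∩q⁺; x∈p∩q⁻)
open import Data.Integer.Base as ℤ using (ℤ; +_; -[1+_]; +[1+_]; 0ℤ; 1ℤ)
import Data.Integer.DivMod as ℤ
import Data.Integer.Properties as ℤ
open import Data.Integer.Tactic.RingSolver using (solve-∀)
open import Data.List.Base using (List; []; _∷_; _++_; _∷ʳ_; _ʳ++_; map; concat; concatMap; applyUpTo; replicate; length; lookup)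
import Data.List.Properties as List
open import Data.List.Reverse using (reverseView; []; _∶_∶ʳ_)
open import Data.Nat.Base as ℕ using (ℕ; zero; suc; z≤n; s≤s)
open import Data.Nat.Divisibility using (_∣_; divides; _∣?_; m∣m*n; ∣n⇒∣m*n)
open import Data.Nat.DivMod using (_%_; _/_; _mod_; m≡m%n+[m/n]*n; m%n<n; m<n⇒m%n≡m; m%n%n≡m%n; [m+kn]%n≡m%n; %-distribˡ-+; %-remove-+ʳ)
import Data.Nat.DivMod as ℕ
open import Data.Nat.GeneralisedArithmetic using (fold)
import Data.Nat.Properties as ℕ
open import Data.Nat.Tactic.RingSolver using () renaming (solve-∀ to solveℕ-∀)
open import Data.Product.Base using (_×_; _,_; ∃-syntax; proj₁; proj₂; map₂)
open import Data.Rational.Base as ℚ using (ℚ; 0ℚ; 1ℚ)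
import Data.Rational.Properties as ℚ
open import Data.Rational.Solver using (module +-*-Solver)
open import Data.Rational.Unnormalised.Base as ℚᵘ using (mkℚᵘ; *≡*; *≤*)
import Data.Rational.Unnormalised.Properties as ℚᵘ
open import Data.Sum.Base using (_⊎_; inj₁; inj₂; [_,_]′)
open import Data.Vec.Base using ([]; _∷_; here; there)
open import Data.Vec.Properties using (lookup∘tabulate; []=⇒lookup; lookup⇒[]=)
open import Function.Base using (_∘_; id)
open import Function.Bundles using (mk↔ₛ′; module Inverse)
open import Relation.Binary.Definitions using (DecidableEquality; tri<; tri≈; tri>)
open import Relation.Binary.PropositionalEquality hiding ([_])
open import Relation.Nullary.Decidable using (Dec; does; yes; no; map′; _×-dec_; _→-dec_; dec-true)
open import Relation.Nullary.Negation using (¬_; contradiction)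
open import Relation.Unary using (Decidable)

-- The tree and its automorphisms

-- Three obstacles shape the proof. The reduction has to decide the signs of roots by integer
-- arithmetic: with s the integral part of √D, an integer B lies below √D when B ≤ s and above it
-- when s + 1 ≤ B, because D is not a square.
--
-- The map z ↦ 1 / z comes from a substitution of determinant -1, which reflects the plane. So the
-- forms of the continued fraction algorithm lie on the topograph alternately as they are and as
-- their `reciprocal`, and this is why the parity of an index names the turn.
--
-- Finally, superimpositions are counted modulo the least period of a river, whereas the rule
-- produces the least even period of the partial quotients. The run-length code must be shown to
-- turn one into the other, also upstream, where the algorithm says nothing.

ccw³ : ∀ e → ccw (ccw (ccw e)) ≡ e
ccw³ (v , back)    = refl
ccw³ (v , ahead L) = refl
ccw³ (v , ahead R) = refl

ccw≢ : ∀ e → ccw e ≢ e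
ccw≢ (v , back)    ()
ccw≢ (v , ahead L) ()
ccw≢ (v , ahead R) ()

bar-injective : ∀ {e e′} → bar e ≡ bar e′ → e ≡ e′
bar-injective {e} {e′} eq =
  trans (sym (bar-involutive e)) (trans (cong bar eq) (bar-involutive e′))

ccw-injective : ∀ {e e′} → ccw e ≡ ccw e′ → e ≡ e′
ccw-injective {e} {e′} eq =
  trans (sym (ccw³ e)) (trans (cong cw eq) (ccw³ e′))

left≢right : ∀ e → left e ≢ right e
left≢right e eq = ccw≢ (bar e) (ccw-injective eq)

follow-injective : ∀ x {e e′} → follow x e ≡ follow x e′ → e ≡ e′
follow-injective L eq = bar-injective (ccw-injective (ccw-injective eq))
follow-injective R eq = bar-injective (ccw-injective eq)

origin : OrientedEdge
origin = (true ∶ []) , back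

module _ (P : OrientedEdge → Set)
         (P-bar : ∀ e → P e → P (bar e)) (P-ccw : ∀ e → P e → P (ccw e)) where

  fromOrigin : P origin → ∀ e → P e
  fromOrigin p (v , b) = at b
    where
    at-back : ∀ v → P (v , back)
    at-ahead : ∀ v x → P (v , ahead x)
    at-back (true ∶ [])       = p
    at-back (false ∶ [])      = P-bar origin p
    at-back (s ∶ (x ∷ w))     = P-bar ((s ∶ w) , ahead x) (at-ahead (s ∶ w) x)
    at-ahead v R = P-ccw (v , back) (at-back v)
    at-ahead v L = P-ccw (v , ahead R) (P-ccw (v , back) (at-back v))
    at : ∀ b → P (v , b)
    at back      = at-back v
    at (ahead x) = at-ahead v x

module _ (P : OrientedEdge → Set)
         (P-bar : ∀ e → P e → P (bar e)) (P-ccw : ∀ e → P e → P (ccw e)) where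

  -- `bar` and `ccw` have finite order, so their inverses are powers of them. Hence `P` travels from
  -- `e₀` back to `origin`, and from there to every edge.
  connected : ∀ {e₀} → P e₀ → ∀ e → P e
  connected {e₀} p = fromOrigin P P-bar P-ccw
    (fromOrigin (λ e → P e → P origin)
      (λ e f p′ → f (subst P (bar-involutive e) (P-bar _ p′)))
      (λ e f p′ → f (subst P (ccw³ e) (P-ccw _ (P-ccw _ p′))))
      (λ p′ → p′) e₀ p)

-- The free product of ℤ/2 and ℤ/3 generated by `bar` and `ccw` acts simply transitively on the
-- oriented edges; these maps commute with it, so one value determines each. Invertibility is left
-- out, so that `mv` can be built by recursion and inverted afterwards.
record Equivariant (f : OrientedEdge → OrientedEdge) : Set where
  field
    on-bar : ∀ e → f (bar e) ≡ bar (f e)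
    on-ccw : ∀ e → f (ccw e) ≡ ccw (f e)

  on-cw : ∀ e → f (cw e) ≡ cw (f e)
  on-cw e = trans (on-ccw (ccw e)) (cong ccw (on-ccw e))

  on-follow : ∀ x e → f (follow x e) ≡ follow x (f e)
  on-follow L e = trans (on-cw (bar e)) (cong cw (on-bar e))
  on-follow R e = trans (on-ccw (bar e)) (cong ccw (on-bar e))

open Equivariant

equivariant-∘ : ∀ {f g} → Equivariant f → Equivariant g → Equivariant (λ e → f (g e))
equivariant-∘ {f} F G .on-bar e = trans (cong f (on-bar G e)) (on-bar F _)
equivariant-∘ {f} F G .on-ccw e = trans (cong f (on-ccw G e)) (on-ccw F _)

equivariant-id : Equivariant (λ e → e)
equivariant-id .on-bar e = refl
equivariant-id .on-ccw e = refl

agree : ∀ {f g} → Equivariant f → Equivariant g →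
  ∀ {e₀} → f e₀ ≡ g e₀ → ∀ e → f e ≡ g e
agree {f} {g} F G = connected (λ e → f e ≡ g e)
  (λ e eq → trans (on-bar F e) (trans (cong bar eq) (sym (on-bar G e))))
  (λ e eq → trans (on-ccw F e) (trans (cong ccw eq) (sym (on-ccw G e))))

-- The equivariant map with origin ↦ e₀.
module _ (e₀ : OrientedEdge) where

  mv-back : Vertex → OrientedEdge
  mv-ahead : Turn → Vertex → OrientedEdge
  mv-back (s ∶ (x ∷ w))    = bar (mv-ahead x (s ∶ w))
  mv-back (true ∶ [])      = e₀
  mv-back (false ∶ [])     = bar e₀
  mv-ahead L v = cw (mv-back v)
  mv-ahead R v = ccw (mv-back v)

  mv : OrientedEdge → OrientedEdge
  mv (v , back)    = mv-back v
  mv (v , ahead x) = mv-ahead x v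

  mv-equivariant : Equivariant mv
  mv-equivariant .on-bar ((s ∶ w)       , ahead x) = refl
  mv-equivariant .on-bar ((s ∶ (x ∷ w)) , back)    = sym (bar-involutive _)
  mv-equivariant .on-bar ((true ∶ [])   , back)    = refl
  mv-equivariant .on-bar ((false ∶ [])  , back)    = sym (bar-involutive _)
  mv-equivariant .on-ccw (v , back)    = refl
  mv-equivariant .on-ccw (v , ahead R) = refl
  mv-equivariant .on-ccw (v , ahead L) = sym (ccw³ _)

-- `mv e′` becomes the inverse of `mv e`. If `mv e′` takes `e` to `origin`, composing with
-- `mv (bar origin)` takes `e` to `bar origin` and therefore `bar e` to `origin`; for `ccw e` the
-- same is done with `cw origin`.
backToOrigin : ∀ e → ∃[ e′ ] mv e′ e ≡ origin
backToOrigin = connected (λ e → ∃[ e′ ] mv e′ e ≡ origin)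
  (λ e (e′ , eq) → mv (bar origin) e′ ,
    trans (on-bar (mv-equivariant (mv (bar origin) e′)) e) (cong bar (carry (bar origin) e e′ eq)))
  (λ e (e′ , eq) → mv (cw origin) e′ ,
    trans (on-ccw (mv-equivariant (mv (cw origin) e′)) e) (cong ccw (carry (cw origin) e e′ eq)))
  {origin} (origin , refl)
  where
  carry : ∀ o e e′ → mv e′ e ≡ origin → mv (mv o e′) e ≡ o
  carry o e e′ eq = trans
    (agree (mv-equivariant (mv o e′))
      (equivariant-∘ (mv-equivariant o) (mv-equivariant e′)) {origin} refl e)
    (cong (mv o) eq)

private
  unmv : OrientedEdge → OrientedEdge
  unmv e = proj₁ (backToOrigin e)

  unmv-mv : ∀ e e′ → mv (unmv e) (mv e e′) ≡ e′
  unmv-mv e = agree (equivariant-∘ (mv-equivariant (unmv e)) (mv-equivariant e)) equivariant-id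
    {origin} (proj₂ (backToOrigin e))

  mv-unmv : ∀ e e′ → mv e (mv (unmv e) e′) ≡ e′
  -- As in a group, a left inverse that has a left inverse itself is two-sided.
  mv-unmv e e′ = trans (sym (unmv-mv (unmv e) (mv e (mv (unmv e) e′))))
    (trans (cong (mv (unmv (unmv e))) (unmv-mv e (mv (unmv e) e′))) (unmv-mv (unmv e) e′))

moving : OrientedEdge → OrientedEdge → PlanarIso
moving e e′ = record
  { bijection = mk↔ₛ′ (λ d → mv e′ (mv (unmv e) d)) (λ d → mv e (mv (unmv e′) d))
      (λ d → trans (cong (mv e′) (unmv-mv e (mv (unmv e′) d))) (mv-unmv e′ d))
      (λ d → trans (cong (mv e) (unmv-mv e′ (mv (unmv e) d))) (mv-unmv e d))
  ; to-bar = on-bar E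
  ; to-ccw = on-ccw E
  }
  where
  E : Equivariant (λ d → mv e′ (mv (unmv e) d))
  E = equivariant-∘ (mv-equivariant e′) (mv-equivariant (unmv e))

moving-moves : ∀ e e′ → PlanarIso.to (moving e e′) e ≡ e′
moving-moves e e′ = cong (mv e′) (proj₂ (backToOrigin e))

module _ (φ : PlanarIso) where
  open PlanarIso φ

  to-equivariant : Equivariant to
  to-equivariant .on-bar = to-bar
  to-equivariant .on-ccw = to-ccw

  to-follow : ∀ x e → to (follow x e) ≡ follow x (to e)
  to-follow = on-follow to-equivariant

-- Walks that never turn back

walk : OrientedEdge → List Turn → OrientedEdge
walk e []      = e
walk e (x ∷ w) = walk (follow x e) w

walk-++ : ∀ e w w′ → walk e (w ++ w′) ≡ walk (walk e w) w′
walk-++ e []      w′ = refl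
walk-++ e (x ∷ w) w′ = walk-++ (follow x e) w w′

walk-equivariant : ∀ {f} → Equivariant f → ∀ e w → f (walk e w) ≡ walk (f e) w
walk-equivariant F e []      = refl
walk-equivariant F e (x ∷ w) =
  trans (walk-equivariant F (follow x e) w) (cong (λ d → walk d w) (on-follow F x e))

private
  follow-incoming : ∀ x v → follow x (bar (v , back)) ≡ (v , ahead x)
  follow-incoming L v = cong cw (bar-involutive (v , back))
  follow-incoming R v = cong ccw (bar-involutive (v , back))

  walk-incoming : ∀ s u w → walk (bar ((s ∶ u) , back)) w ≡ bar ((s ∶ (w ʳ++ u)) , back)
  walk-incoming s u []      = refl
  walk-incoming s u (x ∷ w) =
    trans (cong (λ d → walk d w) (follow-incoming x (s ∶ u))) (walk-incoming s (x ∷ u) w)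

-- There are no cycles because a vertex is encoded by the turns that lead to it: once `e` has been
-- moved to `bar origin`, the walk ends on the edge into the vertex whose list is the word reversed.
walk-injective : ∀ e w w′ → walk e w ≡ walk e w′ → w ≡ w′
walk-injective e w w′ eq = List.reverse-injective (cong turnsOf (bar-injective
  {(true ∶ (w ʳ++ [])) , back} {(true ∶ (w′ ʳ++ [])) , back}
  (trans (sym (walk-incoming true [] w)) (trans eq′ (walk-incoming true [] w′)))))
  where
  φ = moving e (bar origin)
  eq′ : walk (bar origin) w ≡ walk (bar origin) w′
  eq′ = begin
    walk (bar origin) w            ≡⟨ cong (λ d → walk d w) (moving-moves e _) ⟨
    walk (PlanarIso.to φ e) w      ≡⟨ walk-equivariant (to-equivariant φ) e w ⟨
    PlanarIso.to φ (walk e w)      ≡⟨ cong (PlanarIso.to φ) eq ⟩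
    PlanarIso.to φ (walk e w′)     ≡⟨ walk-equivariant (to-equivariant φ) e w′ ⟩
    walk (PlanarIso.to φ e) w′     ≡⟨ cong (λ d → walk d w′) (moving-moves e _) ⟩
    walk (bar origin) w′           ∎
    where open ≡-Reasoning
  turnsOf : OrientedEdge → List Turn
  turnsOf e = Vertex.turns (OrientedEdge.source e)

-- Turning indefinite forms

form-≡ : ∀ {f g} → A f ≡ A g → B f ≡ B g → C f ≡ C g → f ≡ g
form-≡ refl refl refl = refl

module _ where
  open import Data.Integer.Base using (_+_; _*_; -_; _-_; _<_; _≤_)

  Pos : ℤ → Set
  Pos x = 0ℤ < x

  pos+ : ∀ {x y} → Pos x → Pos y → Pos (x + y)
  pos+ = ℤ.+-mono-<

  pos+≥ : ∀ {x y} → Pos x → 0ℤ ≤ y → Pos (x + y)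
  pos+≥ = ℤ.+-mono-<-≤

  pos* : ∀ {x y} → Pos x → Pos y → Pos (x * y)
  pos* {+[1+ m ]} {+[1+ n ]} p q = ℤ.positive⁻¹ _
  pos* {+ 0} (ℤ.+<+ ())
  pos* {+[1+ m ]} {+ 0} _ (ℤ.+<+ ())

  0≤x² : ∀ x → 0ℤ ≤ x * x
  0≤x² (+ 0)    = ℤ.≤-refl
  0≤x² +[1+ n ] = ℤ.<⇒≤ (ℤ.positive⁻¹ _)
  0≤x² -[1+ n ] = ℤ.<⇒≤ (ℤ.positive⁻¹ _)

  pos⇒¬neg : ∀ {x} → Pos x → ¬ Pos (- x)
  pos⇒¬neg {+[1+ n ]} _ ()
  pos⇒¬neg {+ 0} (ℤ.+<+ ())

  sign : ∀ x → x ≢ 0ℤ → Pos x ⊎ Pos (- x)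
  sign (+ 0)    x≢0 = contradiction refl x≢0
  sign +[1+ n ] x≢0 = inj₁ (ℤ.positive⁻¹ _)
  sign -[1+ n ] x≢0 = inj₂ (ℤ.positive⁻¹ _)

  pos-cancel : ∀ x y → Pos x → Pos (x * y) → Pos y
  pos-cancel +[1+ n ] y _ p = ℤ.*-cancelˡ-<-nonNeg +[1+ n ] (subst (_< +[1+ n ] * y) (sym (ℤ.*-zeroʳ +[1+ n ])) p)
  pos-cancel (+ 0) y (ℤ.+<+ ())

  neg-*-neg : ∀ x y → - x * - y ≡ x * y
  neg-*-neg = solve-∀

  pos-*-euclidean : ∀ a x y → Pos (a * x) → Pos (a * y) → Pos (x * y)
  pos-*-euclidean (+ 0) x y (ℤ.+<+ ())
  pos-*-euclidean a@(+[1+ n ]) x y p q =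
    pos* (pos-cancel a x (ℤ.positive⁻¹ _) p) (pos-cancel a y (ℤ.positive⁻¹ _) q)
  pos-*-euclidean a@(-[1+ n ]) x y p q = subst Pos (neg-*-neg x y) (pos*
    (pos-cancel (- a) (- x) (ℤ.positive⁻¹ _) (subst Pos (sym (neg-*-neg a x)) p))
    (pos-cancel (- a) (- y) (ℤ.positive⁻¹ _) (subst Pos (sym (neg-*-neg a y)) q)))

  neg-distribʳ : ∀ a x → a * - x ≡ - (a * x)
  neg-distribʳ = solve-∀

  -- The value of the form at (1 , 1): the number in the region ahead of the edge, between its two
  -- branches.
  total : Form → ℤ
  total f = A f + B f + C f

  flipS turnL turnR : Form → Form
  flipS f = [ C f , - B f , A f ]
  turnL f = [ A f , B f + + 2 * A f , total f ]
  turnR f = [ total f , B f + + 2 * C f , C f ]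

  S-action : ∀ f → S ∘ᶠ f ≡ flipS f
  S-action [ a , b , c ] = form-≡ (eqA a b c) (eqB a b c) (eqC a b c)
    where
    eqA : ∀ a b c → a * (+ 0 * + 0) + b * (+ 0 * -[1+ 0 ]) + c * (-[1+ 0 ] * -[1+ 0 ]) ≡ c
    eqA = solve-∀
    eqB : ∀ a b c → + 2 * a * (+ 0 * + 1) + b * (+ 0 * + 0 + + 1 * -[1+ 0 ])
                      + + 2 * c * (-[1+ 0 ] * + 0) ≡ - b
    eqB = solve-∀
    eqC : ∀ a b c → a * (+ 1 * + 1) + b * (+ 1 * + 0) + c * (+ 0 * + 0) ≡ a
    eqC = solve-∀

  T-action : ∀ f → T ∘ᶠ f ≡ turnL f
  T-action [ a , b , c ] = form-≡ (eqA a b c) (eqB a b c) (eqC a b c)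
    where
    eqA : ∀ a b c → a * (+ 1 * + 1) + b * (+ 1 * + 0) + c * (+ 0 * + 0) ≡ a
    eqA = solve-∀
    eqB : ∀ a b c → + 2 * a * (+ 1 * + 1) + b * (+ 1 * + 1 + + 1 * + 0)
                      + + 2 * c * (+ 0 * + 1) ≡ b + + 2 * a
    eqB = solve-∀
    eqC : ∀ a b c → a * (+ 1 * + 1) + b * (+ 1 * + 1) + c * (+ 1 * + 1) ≡ a + b + c
    eqC = solve-∀

  turnR-via-L : ∀ f → turnL (flipS (turnL f)) ≡ turnR f
  turnR-via-L [ a , b , c ] = form-≡ refl (eqB a b c) (eqC a b c)
    where
    eqB : ∀ a b c → - (b + + 2 * a) + + 2 * (a + b + c) ≡ b + + 2 * c
    eqB = solve-∀
    eqC : ∀ a b c → a + b + c + - (b + + 2 * a) + a ≡ c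
    eqC = solve-∀

  disc-flipS : ∀ f → disc (flipS f) ≡ disc f
  disc-flipS [ a , b , c ] = eq a b c
    where
    eq : ∀ a b c → - b * - b - + 4 * c * a ≡ b * b - + 4 * a * c
    eq = solve-∀

  disc-turnL : ∀ f → disc (turnL f) ≡ disc f
  disc-turnL [ a , b , c ] = eq a b c
    where
    eq : ∀ a b c → (b + + 2 * a) * (b + + 2 * a) - + 4 * a * (a + b + c) ≡ b * b - + 4 * a * c
    eq = solve-∀

  turned : Turn → Form → Form
  turned L = turnL
  turned R = turnR

  disc-turned : ∀ x f → disc (turned x f) ≡ disc f
  disc-turned L f = disc-turnL f
  disc-turned R f = trans (cong disc (sym (turnR-via-L f)))
    (trans (disc-turnL (flipS (turnL f))) (trans (disc-flipS (turnL f)) (disc-turnL f)))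

  NotSquare : ℤ → Set
  NotSquare D = ¬ (∃[ n ] n * n ≡ D)

  module _ {f : Form} (ns : NotSquare (disc f)) where

    A≢0 : A f ≢ 0ℤ
    A≢0 a≡0 = ns (B f , trans (eq (B f) (C f)) (cong (λ a → B f * B f - + 4 * a * C f) (sym a≡0)))
      where
      eq : ∀ b c → b * b ≡ b * b - + 4 * + 0 * c
      eq = solve-∀

    C≢0 : C f ≢ 0ℤ
    C≢0 c≡0 = ns (B f , trans (eq (B f) (A f)) (cong (λ c → B f * B f - + 4 * A f * c) (sym c≡0)))
      where
      eq : ∀ b a → b * b ≡ b * b - + 4 * a * + 0
      eq = solve-∀

  total≢0 : ∀ f → NotSquare (disc f) → total f ≢ 0ℤ
  total≢0 f ns = C≢0 {turnL f} (subst NotSquare (sym (disc-turnL f)) ns)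

  -- The condition A C < 0, put as a positive product so that sums and products of `Pos` apply to
  -- it.
  Splits : Form → Set
  Splits f = Pos (A f * - C f)

  -- The hypothesis of Conway's climbing lemma. The sign of B says that the edge points away from
  -- the river; both turns preserve the condition, so a walk that has left the river never returns
  -- to it.
  record SameSigns (f : Form) : Set where
    field
      AB : Pos (A f * B f)
      AC : Pos (A f * C f)
      BC : Pos (B f * C f)

  sameSigns-turnL : ∀ f → SameSigns f → SameSigns (turnL f)
  sameSigns-turnL [ a , b , c ] u = record
    { AB = subst Pos (eq₁ a b c) (pos+≥ AB (two (0≤x² a)))
    ; AC = subst Pos (eq₂ a b c) (pos+≥ (pos+ AB AC) (0≤x² a))
    ; BC = subst Pos (eq₃ a b c)
        (pos+≥ (pos+≥ (pos+ (pos+ (pos+ AB AB) (pos+ AC AC)) (pos+ AB BC)) (two (0≤x² a))) (0≤x² b))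
    }
    where
    open SameSigns u
    two : ∀ {x} → 0ℤ ≤ x → 0ℤ ≤ x + x
    two p = ℤ.+-mono-≤ p p
    eq₁ : ∀ a b c → a * b + (a * a + a * a) ≡ a * (b + + 2 * a)
    eq₁ = solve-∀
    eq₂ : ∀ a b c → a * b + a * c + a * a ≡ a * (a + b + c)
    eq₂ = solve-∀
    eq₃ : ∀ a b c → (a * b + a * b + (a * c + a * c)) + (a * b + b * c) + (a * a + a * a) + b * b
                    ≡ (b + + 2 * a) * (a + b + c)
    eq₃ = solve-∀

  -- The form f (y , x), which belongs to the reflected topograph; it reduces statements on right
  -- turns to those on left turns.
  mirror : Form → Form
  mirror f = [ C f , B f , A f ]

  sameSigns-mirror : ∀ f → SameSigns f → SameSigns (mirror f)
  sameSigns-mirror [ a , b , c ] u = record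
    { AB = subst Pos (ℤ.*-comm b c) BC
    ; AC = subst Pos (ℤ.*-comm a c) AC
    ; BC = subst Pos (ℤ.*-comm a b) AB
    }
    where open SameSigns u

  turnR-mirror : ∀ f → mirror (turnL (mirror f)) ≡ turnR f
  turnR-mirror [ a , b , c ] = form-≡ (eq a b c) refl refl
    where
    eq : ∀ a b c → c + b + a ≡ a + b + c
    eq = solve-∀

  sameSigns-turnR : ∀ f → SameSigns f → SameSigns (turnR f)
  sameSigns-turnR f u = subst SameSigns (turnR-mirror f)
    (sameSigns-mirror (turnL (mirror f)) (sameSigns-turnL (mirror f) (sameSigns-mirror f u)))

  sameSigns-turned : ∀ x f → SameSigns f → SameSigns (turned x f)
  sameSigns-turned L = sameSigns-turnL
  sameSigns-turned R = sameSigns-turnR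

  sameSigns⇒¬river : ∀ {f} → SameSigns f → ¬ Splits f
  sameSigns⇒¬river {f} u r =
    pos⇒¬neg (SameSigns.AC u) (subst Pos (neg-distribʳ (A f) (C f)) r)

  -- Off the river the two turned forms have constant sign: the form [ A , B , C ]
  -- with A C < 0 has both A and A + B + C of one sign, or both C and A + B + C.
  leaveL : ∀ f → Splits f → Pos (A f * total f) → SameSigns (turnL f)
  leaveL f r p = record
    { AB = subst Pos (eq₁ (A f) (B f) (C f)) (pos+≥ (pos+ p r) (0≤x² (A f)))
    ; AC = p
    ; BC = subst Pos (eq₂ (A f) (B f) (C f))
        (pos+≥ (pos+ p (pos-*-euclidean (A f) (total f) (- C f) p r)) (0≤x² (total f)))
    }
    where
    eq₁ : ∀ a b c → a * (a + b + c) + a * - c + a * a ≡ a * (b + + 2 * a)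
    eq₁ = solve-∀
    eq₂ : ∀ a b c → a * (a + b + c) + (a + b + c) * - c + (a + b + c) * (a + b + c)
                    ≡ (b + + 2 * a) * (a + b + c)
    eq₂ = solve-∀

  leaveR : ∀ f → Splits f → Pos (A f * - total f) → SameSigns (turnR f)
  leaveR f r p = subst SameSigns (turnR-mirror f)
    (sameSigns-mirror (turnL (mirror f)) (leaveL (mirror f) r′ p′))
    where
    r′ : Splits (mirror f)
    r′ = subst Pos (eq (A f) (C f)) r
      where
      eq : ∀ a c → a * - c ≡ c * - a
      eq = solve-∀
    p′ : Pos (C f * total (mirror f))
    p′ = subst Pos (eq (A f) (B f) (C f)) (pos-*-euclidean (A f) (- C f) (- total f) r p)
      where
      eq : ∀ a b c → - c * - (a + b + c) ≡ c * (c + b + a)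
      eq = solve-∀

  -- The region ahead has the sign of one of the two sides, and the river continues between it and
  -- the other side: if it agrees with the left side, the river turns right. The function is total
  -- so that `slowStep` can be iterated.
  riverTurn : Form → Turn
  riverTurn f with 0ℤ ℤ.<? A f * total f
  ... | yes _ = R
  ... | no  _ = L

  riverTurn-R : ∀ f → Pos (A f * total f) → riverTurn f ≡ R
  riverTurn-R f p with 0ℤ ℤ.<? A f * total f
  ... | yes _ = refl
  ... | no ¬p = contradiction p ¬p

  riverTurn-L : ∀ f → Pos (A f * - total f) → riverTurn f ≡ L
  riverTurn-L f p with 0ℤ ℤ.<? A f * total f
  ... | yes q = contradiction (subst Pos (neg-distribʳ (A f) (total f)) p) (pos⇒¬neg q)
  ... | no  _ = refl

  opposite : Turn → Turn
  opposite L = R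
  opposite R = L

  data RiverTurn (f : Form) : Turn → Set where
    toR : Pos (A f * total f) → RiverTurn f R
    toL : Pos (A f * - total f) → RiverTurn f L

  riverTurn-correct : ∀ f → NotSquare (disc f) → Splits f → RiverTurn f (riverTurn f)
  riverTurn-correct f ns r with 0ℤ ℤ.<? A f * total f
  ... | yes p = toR p
  ... | no ¬p with sign (A f) (A≢0 {f} ns) | sign (total f) (total≢0 f ns)
  ...   | inj₁ a | inj₁ t = contradiction (pos* a t) ¬p
  ...   | inj₁ a | inj₂ t = toL (pos* a t)
  ...   | inj₂ a | inj₁ t = toL (subst Pos (eq (A f) (total f)) (pos* a t))
    where
    eq : ∀ a t → - a * t ≡ a * - t
    eq = solve-∀
  ...   | inj₂ a | inj₂ t = contradiction (subst Pos (neg-*-neg (A f) (total f)) (pos* a t)) ¬p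

  module _ (f : Form) (ns : NotSquare (disc f)) (r : Splits f) where

    river-turned : Splits (turned (riverTurn f) f)
    river-turned with riverTurn f | riverTurn-correct f ns r
    ... | _ | toR p = pos-*-euclidean (A f) (total f) (- C f) p r
    ... | _ | toL p = p

    leave : SameSigns (turned (opposite (riverTurn f)) f)
    leave with riverTurn f | riverTurn-correct f ns r
    ... | _ | toR p = leaveL f r p
    ... | _ | toL p = leaveR f r p

    posA-turned : Pos (A f) → Pos (A (turned (riverTurn f) f))
    posA-turned a with riverTurn f | riverTurn-correct f ns r
    ... | _ | toR p = pos-cancel (A f) (total f) a p
    ... | _ | toL p = a

    negA-turned : Pos (- A f) → Pos (- A (turned (riverTurn f) f))
    negA-turned a with riverTurn f | riverTurn-correct f ns r
    ... | _ | toR p = pos-cancel (- A f) (- total f) a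
      (subst Pos (sym (neg-*-neg (A f) (total f))) p)
    ... | _ | toL p = a

    riverTurn-unique : ∀ x → Splits (turned x f) → riverTurn f ≡ x
    riverTurn-unique x s with riverTurn f | leave
    riverTurn-unique L s | L | _ = refl
    riverTurn-unique R s | R | _ = refl
    riverTurn-unique R s | L | u = contradiction s (sameSigns⇒¬river u)
    riverTurn-unique L s | R | u = contradiction s (sameSigns⇒¬river u)

  river-flipS : ∀ f → Splits f → Splits (flipS f)
  river-flipS f = subst Pos (eq (A f) (C f))
    where
    eq : ∀ a c → a * - c ≡ c * - a
    eq = solve-∀

-- The river

walk-∷ʳ : ∀ e w x → walk e (w ∷ʳ x) ≡ follow x (walk e w)
walk-∷ʳ e w x = walk-++ e w (x ∷ [])

-- Every edge or its reversal lies ahead of `e₀` or ahead of `bar e₀`. All four cases are carried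
-- along since the induction is over `bar` and `ccw`, which reverse edges.
data Reached (e₀ : OrientedEdge) (e : OrientedEdge) : Set where
  ahead⁺  : ∀ w → walk e₀ w ≡ e → Reached e₀ e
  ahead⁻  : ∀ w → walk e₀ w ≡ bar e → Reached e₀ e
  behind⁺ : ∀ w → walk (bar e₀) w ≡ e → Reached e₀ e
  behind⁻ : ∀ w → walk (bar e₀) w ≡ bar e → Reached e₀ e

private
  -- Counterclockwise around the vertex where `d` arrives come `bar d`, `right d`, `left d`. So
  -- rotating the end of a walk either gives the reversal of its last edge but one or replaces a
  -- final R by L.
  ccw-follow : ∀ x d → ∃[ d′ ] (ccw (follow x d) ≡ d′ × (d′ ≡ bar d ⊎ d′ ≡ left d))
  ccw-follow L d = _ , refl , inj₁ (ccw³ (bar d))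
  ccw-follow R d = _ , refl , inj₂ refl

  ccw-walk : ∀ d w x →
    (∃[ w′ ] walk d w′ ≡ bar (ccw (walk d (w ∷ʳ x)))) ⊎ (∃[ w′ ] walk d w′ ≡ ccw (walk d (w ∷ʳ x)))
  ccw-walk d w x rewrite walk-∷ʳ d w x with ccw-follow x (walk d w)
  ... | _ , eq , inj₁ eq′ = inj₁ (w , sym (trans (cong bar (trans eq eq′)) (bar-involutive _)))
  ... | _ , eq , inj₂ eq′ = inj₂ (w ∷ʳ L , trans (walk-∷ʳ d w L) (sym (trans eq eq′)))

  ccw-of-bar : ∀ d w e → walk d w ≡ bar e → walk d (w ∷ʳ R) ≡ ccw e
  ccw-of-bar d w e eq = trans (walk-∷ʳ d w R)
    (trans (cong right eq) (cong ccw (bar-involutive e)))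

reached : ∀ e₀ e → Reached e₀ e
reached e₀ = connected (Reached e₀) on-bar′ on-ccw′ {e₀} (ahead⁺ [] refl)
  where
  on-bar′ : ∀ e → Reached e₀ e → Reached e₀ (bar e)
  on-bar′ e (ahead⁺ w eq)  = ahead⁻ w (trans eq (sym (bar-involutive e)))
  on-bar′ e (ahead⁻ w eq)  = ahead⁺ w eq
  on-bar′ e (behind⁺ w eq) = behind⁻ w (trans eq (sym (bar-involutive e)))
  on-bar′ e (behind⁻ w eq) = behind⁺ w eq

  on-ccw′ : ∀ e → Reached e₀ e → Reached e₀ (ccw e)
  on-ccw′ e (ahead⁻ w eq)  = ahead⁺ (w ∷ʳ R) (ccw-of-bar e₀ w e eq)
  on-ccw′ e (behind⁻ w eq) = behind⁺ (w ∷ʳ R) (ccw-of-bar (bar e₀) w e eq)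
  on-ccw′ e (ahead⁺ w eq) with reverseView w
  ... | [] = behind⁺ (R ∷ []) (cong ccw (trans (bar-involutive e₀) eq))
  ... | w′ ∶ _ ∶ʳ x with ccw-walk e₀ w′ x
  ...   | inj₁ (v , eq′) = ahead⁻ v (trans eq′ (cong (λ d → bar (ccw d)) eq))
  ...   | inj₂ (v , eq′) = ahead⁺ v (trans eq′ (cong ccw eq))
  on-ccw′ e (behind⁺ w eq) with reverseView w
  ... | [] = ahead⁺ (R ∷ []) (cong ccw eq)
  ... | w′ ∶ _ ∶ʳ x with ccw-walk (bar e₀) w′ x
  ...   | inj₁ (v , eq′) = behind⁻ v (trans eq′ (cong (λ d → bar (ccw d)) eq))
  ...   | inj₂ (v , eq′) = behind⁺ v (trans eq′ (cong ccw eq))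

iterate : {X : Set} → (X → X) → ℕ → X → X
iterate f n x = fold x f n

iterate-suc : {X : Set} (f : X → X) → ∀ n x → iterate f n (f x) ≡ f (iterate f n x)
iterate-suc f zero    x = refl
iterate-suc f (suc n) x = cong f (iterate-suc f n x)

module _ {q : Form} (𝕋 : Topograph q) where
  open Topograph 𝕋

  form-barred : ∀ e → form (bar e) ≡ flipS (form e)
  form-barred e = trans (form-bar e) (S-action (form e))

  form-followed : ∀ x e → form (follow x e) ≡ turned x (form e)
  form-followed L e = trans (form-left e) (T-action (form e))
  form-followed R e = begin
    form (ccw (bar e))             ≡⟨ cong form (cong ccw (ccw³ (bar e))) ⟨
    form (cw (cw (bar e)))         ≡⟨ cong (λ d → form (cw d)) (bar-involutive (left e)) ⟨
    form (left (bar (left e)))     ≡⟨ form-followed L (bar (left e)) ⟩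
    turnL (form (bar (left e)))    ≡⟨ cong turnL (form-barred (left e)) ⟩
    turnL (flipS (form (left e)))  ≡⟨ cong (λ f → turnL (flipS f)) (form-followed L e) ⟩
    turnL (flipS (turnL (form e))) ≡⟨ turnR-via-L (form e) ⟩
    turnR (form e)                 ∎
    where open ≡-Reasoning

  form-disc : ∀ e → disc (form e) ≡ disc q
  form-disc = connected (λ e → disc (form e) ≡ disc q)
    on-bar′ (λ e eq → trans (disc-ccw e) eq)
    {base} (cong disc form-base)
    where
    on-bar′ : ∀ e → disc (form e) ≡ disc q → disc (form (bar e)) ≡ disc q
    on-bar′ e eq = trans (cong disc (form-barred e)) (trans (disc-flipS (form e)) eq)
    disc-ccw : ∀ e → disc (form (ccw e)) ≡ disc (form e)
    disc-ccw e = begin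
      disc (form (ccw e))               ≡⟨ cong (λ d → disc (form (ccw d))) (bar-involutive e) ⟨
      disc (form (follow R (bar e)))    ≡⟨ cong disc (form-followed R (bar e)) ⟩
      disc (turnR (form (bar e)))       ≡⟨ disc-turned R (form (bar e)) ⟩
      disc (form (bar e))               ≡⟨ cong disc (form-barred e) ⟩
      disc (flipS (form e))             ≡⟨ disc-flipS (form e) ⟩
      disc (form e)                     ∎
      where open ≡-Reasoning

  module RiverFrom (ns : NotSquare (disc q)) where

    OnR : OrientedEdge → Set
    OnR e = Splits (form e)

    ns-at : ∀ e → NotSquare (disc (form e))
    ns-at e = subst NotSquare (sym (form-disc e)) ns

    turnAt : OrientedEdge → Turn
    turnAt e = riverTurn (form e)

    nextEdge : OrientedEdge → OrientedEdge
    nextEdge e = follow (turnAt e) e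

    onR-next : ∀ {e} → OnR e → OnR (nextEdge e)
    onR-next {e} r = subst Splits (sym (form-followed (turnAt e) e))
      (river-turned (form e) (ns-at e) r)

    onR-bar : ∀ {e} → OnR e → OnR (bar e)
    onR-bar {e} r = subst Splits (sym (form-barred e)) (river-flipS (form e) r)

    turnAt-unique : ∀ e x → OnR e → OnR (follow x e) → turnAt e ≡ x
    turnAt-unique e x r s = riverTurn-unique (form e) (ns-at e) r x
      (subst Splits (form-followed x e) s)

    -- One of the branches after `bar (nextEdge e)` is `bar e`, which is on the river, and the river
    -- has a single branch there. Thus `nextEdge` applied to reversed edges also produces the
    -- upstream half.
    next-bar-next : ∀ {e} → OnR e → nextEdge (bar (nextEdge e)) ≡ bar e
    next-bar-next {e} r = trans (cong (λ x → follow x (bar (nextEdge e))) turn≡) (returns (turnAt e))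
      where
      returns : ∀ x → follow (opposite x) (bar (follow x e)) ≡ bar e
      returns L = trans (cong ccw (bar-involutive (left e))) (ccw³ (bar e))
      returns R = trans (cong cw (bar-involutive (right e))) (ccw³ (bar e))
      turn≡ : turnAt (bar (nextEdge e)) ≡ opposite (turnAt e)
      turn≡ = turnAt-unique (bar (nextEdge e)) (opposite (turnAt e)) (onR-bar (onR-next r))
        (subst OnR (sym (returns (turnAt e))) (onR-bar r))

    sameSigns-walk : ∀ e w → SameSigns (form e) → SameSigns (form (walk e w))
    sameSigns-walk e []      u = u
    sameSigns-walk e (x ∷ w) u = sameSigns-walk (follow x e) w
      (subst SameSigns (sym (form-followed x e)) (sameSigns-turned x (form e) u))

    -- Away from the river, all values have one sign.
    walk-onR : ∀ e w → OnR e → OnR (walk e w) → ∃[ n ] walk e w ≡ iterate nextEdge n e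
    walk-onR e []      r s = 0 , refl
    walk-onR e (x ∷ w) r s with x ≟ᵗ turnAt e
    ... | yes refl =
      let n , eq = walk-onR (nextEdge e) w (onR-next r) s
      in suc n , trans eq (iterate-suc nextEdge n e)
    ... | no x≢t =
      contradiction s (sameSigns⇒¬river (sameSigns-walk (follow x e) w
        (subst SameSigns (sym (form-followed x e)) away)))
      where
      opposite-≢ : ∀ x t → x ≢ t → opposite t ≡ x
      opposite-≢ L L p = contradiction refl p
      opposite-≢ L R p = refl
      opposite-≢ R L p = refl
      opposite-≢ R R p = contradiction refl p
      away : SameSigns (turned x (form e))
      away = subst (λ y → SameSigns (turned y (form e)))
        (opposite-≢ x (turnAt e) x≢t) (leave (form e) (ns-at e) r)

    Down : OrientedEdge → Set
    Down e = OnR e × Pos (A (form e))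

    down-next : ∀ {e} → Down e → Down (nextEdge e)
    down-next {e} (r , a) = onR-next r ,
      subst (λ f → Pos (A f)) (sym (form-followed (turnAt e) e))
        (posA-turned (form e) (ns-at e) r a)

    Up : OrientedEdge → Set
    Up e = OnR e × Pos (ℤ.- A (form e))

    down-bar : ∀ {e} → Down e → Up (bar e)
    down-bar {e} (r , a) = onR-bar r , subst (λ f → Pos (ℤ.- A f)) (sym (form-barred e))
      (pos-cancel (A (form e)) (ℤ.- C (form e)) a r)

    up-bar : ∀ {e} → Up e → Down (bar e)
    up-bar {e} (r , a) = onR-bar r , subst (λ f → Pos (A f)) (sym (form-barred e))
      (pos-cancel (ℤ.- A (form e)) (C (form e)) a (subst Pos (eq (A (form e)) (C (form e))) r))
      where
      open import Data.Integer.Base using (_*_; -_)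
      eq : ∀ a c → a * - c ≡ - a * c
      eq = solve-∀

    up-next : ∀ {e} → Up e → Up (nextEdge e)
    up-next {e} (r , a) = onR-next r ,
      subst (λ f → Pos (ℤ.- A f)) (sym (form-followed (turnAt e) e))
        (negA-turned (form e) (ns-at e) r a)

    down⇒¬up : ∀ {e} → Down e → ¬ Up e
    down⇒¬up (_ , a) (_ , a′) = pos⇒¬neg a a′

    module _ (e₀ : OrientedEdge) (d₀ : Down e₀) where

      iterate-down : ∀ n → Down (iterate nextEdge n e₀)
      iterate-down zero    = d₀
      iterate-down (suc n) = down-next (iterate-down n)

      iterate-up : ∀ n → Up (iterate nextEdge n (bar e₀))
      iterate-up zero    = down-bar d₀
      iterate-up (suc n) = up-next (iterate-up n)

      riverEdge : ℤ → OrientedEdge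
      riverEdge (+ n)    = iterate nextEdge n e₀
      riverEdge -[1+ n ] = bar (iterate nextEdge (suc n) (bar e₀))

      riverEdge-down : ∀ i → Down (riverEdge i)
      riverEdge-down (+ n)    = iterate-down n
      riverEdge-down -[1+ n ] = up-bar (iterate-up (suc n))

      riverEdge-next : ∀ i → riverEdge (i ℤ.+ 1ℤ) ≡ nextEdge (riverEdge i)
      riverEdge-next (+ n) = cong (λ m → iterate nextEdge m e₀) (ℕ.+-comm n 1)
      riverEdge-next -[1+ zero ] = begin
        e₀                                ≡⟨ bar-involutive e₀ ⟨
        bar (bar e₀)                      ≡⟨ next-bar-next (proj₁ (iterate-up 0)) ⟨
        nextEdge (bar (nextEdge (bar e₀))) ∎
        where open ≡-Reasoning
      riverEdge-next -[1+ suc n ] = sym (next-bar-next (proj₁ (iterate-up (suc n))))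

      riverEdge-previous : ∀ i → riverEdge i ≡ bar (nextEdge (bar (riverEdge (i ℤ.+ 1ℤ))))
      riverEdge-previous i = bar-injective (sym (trans (bar-involutive _)
        (trans (cong (λ e → nextEdge (bar e)) (riverEdge-next i))
               (next-bar-next (proj₁ (riverEdge-down i))))))

      riverEdge-behind : ∀ n → ∃[ i ] riverEdge i ≡ bar (iterate nextEdge n (bar e₀))
      riverEdge-behind zero    = + 0 , sym (bar-involutive e₀)
      riverEdge-behind (suc n) = -[1+ n ] , refl

      riverEdge-covers : ∀ e → Down e → ∃[ i ] riverEdge i ≡ e
      riverEdge-covers e d with reached e₀ e
      ... | ahead⁺ w eq =
        let n , eq′ = walk-onR e₀ w (proj₁ d₀) (subst OnR (sym eq) (proj₁ d))
        in + n , trans (sym eq′) eq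
      -- `nextEdge` keeps the sign of the value on the left, so a walk along the flow never arrives
      -- at an edge against the flow; `behind⁺` fails likewise.
      ... | ahead⁻ w eq =
        let n , eq′ = walk-onR e₀ w (proj₁ d₀) (subst OnR (sym eq) (proj₁ (down-bar d)))
        in contradiction (subst Up (trans (sym eq) eq′) (down-bar d)) (down⇒¬up (iterate-down n))
      ... | behind⁺ w eq =
        let n , eq′ = walk-onR (bar e₀) w (proj₁ (down-bar d₀)) (subst OnR (sym eq) (proj₁ d))
        in contradiction (iterate-up n) (down⇒¬up (subst Down (trans (sym eq) eq′) d))
      ... | behind⁻ w eq =
        let n , eq′ = walk-onR (bar e₀) w (proj₁ (down-bar d₀)) (subst OnR (sym eq) (proj₁ (down-bar d)))
            i , eqᵢ = riverEdge-behind n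
        in i , trans eqᵢ (trans (cong bar (trans (sym eq′) eq)) (bar-involutive e))

      river : River 𝕋
      river = record
        { edge       = riverEdge
        ; turn       = λ i → turnAt (riverEdge i)
        ; downstream = λ i → downstream (riverEdge-down i)
        ; covers     = λ e d → riverEdge-covers e (fromDownstream d)
        ; next       = riverEdge-next
        }
        where
        downstream : ∀ {e} → Down e → Downstream 𝕋 e
        downstream {e} (r , a) = ℤ.neg-cancel-< (subst Pos (neg-distribʳ (A (form e)) (C (form e))) r) , a
        fromDownstream : ∀ {e} → Downstream 𝕋 e → Down e
        fromDownstream {e} (r , a) =
          subst Pos (sym (neg-distribʳ (A (form e)) (C (form e)))) (ℤ.neg-mono-< r) , a

-- Gauss reduction

module _ where
  open import Data.Integer.Base using (_+_; _*_; -_; _-_; _<_; _≤_)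

  difference≥0 : ∀ {x y} → x ≤ y → 0ℤ ≤ y - x
  difference≥0 = ℤ.i≤j⇒0≤j-i

  0≤+ : ∀ {x y} → 0ℤ ≤ x → 0ℤ ≤ y → 0ℤ ≤ x + y
  0≤+ = ℤ.+-mono-≤

  0≤* : ∀ {x y} → 0ℤ ≤ x → 0ℤ ≤ y → 0ℤ ≤ x * y
  0≤* {+ m} {+ n} p q = subst (0ℤ ≤_) (ℤ.pos-* m n) (ℤ.+≤+ ℕ.z≤n)

  0≤⇒¬pos- : ∀ {x} → 0ℤ ≤ x → ¬ Pos (- x)
  0≤⇒¬pos- {+ zero} p (ℤ.+<+ ())
  0≤⇒¬pos- {+ suc n} p ()

  linear : ∀ {z} x y → 0ℤ ≤ z → z ≡ y - x → x ≤ y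
  linear x y p refl = ℤ.0≤i-j⇒j≤i p

  -- The form f (x + a y , y), whose first root is z - a.
  translate : ℤ → Form → Form
  translate a f = [ A f , B f + + 2 * a * A f , A f * (a * a) + B f * a + C f ]

  -- The form - f (y , x). The minus sign keeps the sign of √D, so that the first root z becomes the
  -- first root 1 / z.
  reciprocal : Form → Form
  reciprocal f = [ - C f , - B f , - A f ]

  disc-translate : ∀ a f → disc (translate a f) ≡ disc f
  disc-translate a f = eq a (A f) (B f) (C f)
    where
    eq : ∀ x a b c → (b + + 2 * x * a) * (b + + 2 * x * a) - + 4 * a * (a * (x * x) + b * x + c)
                     ≡ b * b - + 4 * a * c
    eq = solve-∀

  disc-reciprocal : ∀ f → disc (reciprocal f) ≡ disc f
  disc-reciprocal f = eq (A f) (B f) (C f)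
    where
    eq : ∀ a b c → - b * - b - + 4 * - c * - a ≡ b * b - + 4 * a * c
    eq = solve-∀

  translate-0 : ∀ f → translate 0ℤ f ≡ f
  translate-0 f = form-≡ refl (eqB (A f) (B f)) (eqC (A f) (B f) (C f))
    where
    eqB : ∀ a b → b + + 2 * + 0 * a ≡ b
    eqB = solve-∀
    eqC : ∀ a b c → a * (+ 0 * + 0) + b * + 0 + c ≡ c
    eqC = solve-∀

  translate-suc : ∀ a f → translate (a + 1ℤ) f ≡ turnL (translate a f)
  translate-suc a f = form-≡ refl (eqB a (A f) (B f)) (eqC a (A f) (B f) (C f))
    where
    eqB : ∀ x a b → b + + 2 * (x + + 1) * a ≡ b + + 2 * x * a + + 2 * a
    eqB = solve-∀
    eqC : ∀ x a b c → a * ((x + + 1) * (x + + 1)) + b * (x + + 1) + c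
                      ≡ a + (b + + 2 * x * a) + (a * (x * x) + b * x + c)
    eqC = solve-∀

  translate-1 : ∀ f → translate 1ℤ f ≡ turnL f
  translate-1 f = trans (translate-suc 0ℤ f) (cong turnL (translate-0 f))

  floorSqrt : ∀ n → ∃[ s ] (s ℕ.* s ℕ.≤ n × n ℕ.< suc s ℕ.* suc s)
  floorSqrt zero = 0 , ℕ.z≤n , ℕ.s≤s ℕ.z≤n
  floorSqrt (suc n) with floorSqrt n
  ... | s , lo , hi with suc s ℕ.* suc s ℕ.≤? suc n
  ...   | yes p = suc s , p , ℕ.≤-trans (ℕ.s≤s hi) (ℕ.*-mono-< (ℕ.n<1+n (suc s)) (ℕ.n<1+n (suc s)))
  ...   | no ¬p = s , ℕ.m≤n⇒m≤1+n lo , ℕ.≰⇒> ¬p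

  module Reduction (D : ℤ) (ns : NotSquare D) (s : ℤ)
                   (s≥0 : 0ℤ ≤ s) (s²≤D : s * s ≤ D) (D<s⁺² : 1ℤ + D ≤ (1ℤ + s) * (1ℤ + s)) where

    s⁺ : ℤ
    s⁺ = 1ℤ + s

    ≰⇒s⁺≤ : ∀ {b} → ¬ b ≤ s → s⁺ ≤ b
    ≰⇒s⁺≤ b≰s = ℤ.i<j⇒suc[i]≤j (ℤ.≰⇒> b≰s)

    s⁺≤⇒≰ : ∀ {b} → s⁺ ≤ b → ¬ b ≤ s
    s⁺≤⇒≰ p q = ℤ.<⇒≱ (ℤ.suc[i]≤j⇒i<j p) q

    Disc : Form → Set
    Disc f = disc f ≡ D

    private
      ns′ : ∀ f → Disc f → NotSquare (disc f)
      ns′ f refl = ns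

      A≢0′ : ∀ {f} → Disc f → A f ≢ 0ℤ
      A≢0′ {f} d = A≢0 {f} (ns′ f d)

      C≢0′ : ∀ {f} → Disc f → C f ≢ 0ℤ
      C≢0′ {f} d = C≢0 {f} (ns′ f d)

    -- Here B² = D + 4 A C > D ≥ s². The multiple 4 A C enters as a sum of four positive terms.
    ¬inside : ∀ {f} → Disc f → Pos (A f * C f) → - s ≤ B f → ¬ B f ≤ s
    ¬inside {f} refl ac p q = 0≤⇒¬pos- (0≤+ (0≤* (difference≥0 q) (difference≥0 p)) (difference≥0 s²≤D))
      (subst Pos (eq (A f) (B f) (C f) s) (pos+ (pos+ ac ac) (pos+ ac ac)))
      where
      eq : ∀ a b c s → a * c + a * c + (a * c + a * c)
           ≡ - ((s - b) * (b - - s) + (b * b - + 4 * a * c - s * s))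
      eq = solve-∀

    outer : ∀ {f} → Disc f → Pos (A f * C f) → B f ≤ - s⁺ ⊎ s⁺ ≤ B f
    outer {f} d ac with B f ℤ.≤? s
    ... | no ¬p = inj₂ (≰⇒s⁺≤ ¬p)
    ... | yes p with - s ℤ.≤? B f
    ...   | yes q = contradiction p (¬inside {f} d ac q)
    ...   | no ¬q = inj₁ (linear (B f) (- s⁺) (difference≥0 (ℤ.i<j⇒suc[i]≤j (ℤ.≰⇒> ¬q))) (eq (B f) s))
      where
      eq : ∀ b s → - s - (+ 1 + b) ≡ - (+ 1 + s) - b
      eq = solve-∀

    -- Here B² = D + 4 A C < D < (s + 1)². The bound on the other side follows in `lower` by
    -- `flipS`, which negates B.
    ¬below : ∀ {f} → Disc f → Splits f → ¬ s⁺ ≤ B f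
    ¬below {f} refl ac p = 0≤⇒¬pos-
      (0≤+ (0≤* (difference≥0 p) (0≤+ (difference≥0 p) (0≤+ s⁺≥0 s⁺≥0))) (difference≥0 D<s⁺²))
      (subst Pos (eq (A f) (B f) (C f) s) (pos+ (pos+ (pos+ ac ac) (pos+ ac ac)) (ℤ.positive⁻¹ 1ℤ)))
      where
      s⁺≥0 : 0ℤ ≤ s⁺
      s⁺≥0 = 0≤+ {1ℤ} {s} (ℤ.+≤+ ℕ.z≤n) s≥0
      eq : ∀ a b c s → a * - c + a * - c + (a * - c + a * - c) + + 1
           ≡ - ((b - (+ 1 + s)) * (b - (+ 1 + s) + ((+ 1 + s) + (+ 1 + s)))
                + ((+ 1 + s) * (+ 1 + s) - (+ 1 + (b * b - + 4 * a * c))))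
      eq = solve-∀

    upper : ∀ {f} → Disc f → Splits f → B f ≤ s
    upper {f} d ac with B f ℤ.≤? s
    ... | yes p = p
    ... | no ¬p = contradiction (≰⇒s⁺≤ ¬p) (¬below {f} d ac)

    lower : ∀ {f} → Disc f → Splits f → - s ≤ B f
    lower {f} d ac = linear (- s) (B f)
      (difference≥0 (upper {flipS f} (trans (disc-flipS f) d) (river-flipS f ac))) (eq (B f) s)
      where
      eq : ∀ b s → s - - b ≡ b - - s
      eq = solve-∀

    splits : ∀ {f} → Disc f → - s ≤ B f → B f ≤ s → Pos (A f) → Pos (- C f)
    splits {f} d p q a with sign (C f) (C≢0′ {f} d)
    ... | inj₁ c = contradiction q (¬inside {f} d (pos* a c) p)
    ... | inj₂ c = c

    -- The signs of the first root, in terms of the integral part s of √D.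
    data PosRoot (f : Form) : Set where
      A>0 : Pos (A f) → B f ≤ s → PosRoot f
      A<0 : Pos (- A f) → s⁺ ≤ B f → PosRoot f

    data NegRoot (f : Form) : Set where
      A>0 : Pos (A f) → s⁺ ≤ B f → NegRoot f
      A<0 : Pos (- A f) → B f ≤ s → NegRoot f

    rootSign : ∀ {f} → Disc f → PosRoot f ⊎ NegRoot f
    rootSign {f} d with sign (A f) (A≢0′ {f} d) | B f ℤ.≤? s
    ... | inj₁ a | yes p = inj₁ (A>0 a p)
    ... | inj₁ a | no ¬p = inj₂ (A>0 a (≰⇒s⁺≤ ¬p))
    ... | inj₂ a | yes p = inj₂ (A<0 a p)
    ... | inj₂ a | no ¬p = inj₁ (A<0 a (≰⇒s⁺≤ ¬p))

    -- For A > 0 the root is (√D - B) / 2A, and replacing √D by its floor s leaves the integral part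
    -- unchanged. For A < 0 it is (B - √D) / 2|A|, where the ceiling s + 1 of √D takes that place.
    -- The value at A = 0 is a default.
    floor′ : ℤ → ℤ → ℤ
    floor′ (+ zero) b = 0ℤ
    floor′ +[1+ k ] b = (s - b) ℤ./ℕ (2 ℕ.* suc k)
    floor′ -[1+ k ] b = (b - s⁺) ℤ./ℕ (2 ℕ.* suc k)

    floor : Form → ℤ
    floor f = floor′ (A f) (B f)

    private
      module _ (A₊ : ℤ) (x : ℤ) (n : ℕ) .{{_ : ℕ.NonZero n}} (n≡ : + n ≡ + 2 * A₊) where
        q = x ℤ./ℕ n
        r = + (x ℤ.%ℕ n)

        r≥0 : 0ℤ ≤ r
        r≥0 = ℤ.+≤+ ℕ.z≤n

        r<n : 0ℤ ≤ + 2 * A₊ - (1ℤ + r)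
        r<n = difference≥0 (subst (1ℤ + r ≤_) n≡ (ℤ.+≤+ (ℤ.n%ℕd<d x n)))

        r≡ : r ≡ x - q * (+ 2 * A₊)
        r≡ = trans (eq r (q * (+ 2 * A₊))) (cong (_- q * (+ 2 * A₊))
          (sym (trans (ℤ.a≡a%ℕn+[a/ℕn]*n x n) (cong (λ y → r + q * y) n≡))))
          where
          eq : ∀ r y → r ≡ r + y - y
          eq = solve-∀

    floor-PosRoot : ∀ f → Disc f → PosRoot (translate (floor f) f)
    floor-PosRoot [ + zero , b , c ] d = contradiction refl (A≢0′ {[ 0ℤ , b , c ]} d)
    floor-PosRoot [ +[1+ k ] , b , c ] d = A>0 (ℤ.positive⁻¹ +[1+ k ])
      (linear _ s (r≥0 +[1+ k ] x n n≡) (trans (r≡ +[1+ k ] x n n≡) (eq s b (q +[1+ k ] x n n≡) +[1+ k ])))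
      where
      n = 2 ℕ.* suc k
      n≡ = ℤ.pos-* 2 (suc k)
      x = s - b
      eq : ∀ s b q a → s - b - q * (+ 2 * a) ≡ s - (b + + 2 * q * a)
      eq = solve-∀
    floor-PosRoot [ -[1+ k ] , b , c ] d = A<0 (ℤ.positive⁻¹ +[1+ k ])
      (linear s⁺ _ (r≥0 +[1+ k ] x n n≡) (trans (r≡ +[1+ k ] x n n≡) (eq s b (q +[1+ k ] x n n≡) +[1+ k ])))
      where
      n = 2 ℕ.* suc k
      n≡ = ℤ.pos-* 2 (suc k)
      x = b - s⁺
      eq : ∀ s b q a → b - (+ 1 + s) - q * (+ 2 * a) ≡ b + + 2 * q * - a - (+ 1 + s)
      eq = solve-∀

    floor-NegRoot : ∀ f → Disc f → NegRoot (translate (floor f + 1ℤ) f)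
    floor-NegRoot [ + zero , b , c ] d = contradiction refl (A≢0′ {[ 0ℤ , b , c ]} d)
    floor-NegRoot [ +[1+ k ] , b , c ] d = A>0 (ℤ.positive⁻¹ +[1+ k ])
      (linear s⁺ _ (r<n +[1+ k ] x n n≡) (trans (cong (λ y → + 2 * +[1+ k ] - (1ℤ + y)) (r≡ +[1+ k ] x n n≡))
        (eq s b (q +[1+ k ] x n n≡) +[1+ k ])))
      where
      n = 2 ℕ.* suc k
      n≡ = ℤ.pos-* 2 (suc k)
      x = s - b
      eq : ∀ s b q a → + 2 * a - (+ 1 + (s - b - q * (+ 2 * a))) ≡ b + + 2 * (q + + 1) * a - (+ 1 + s)
      eq = solve-∀
    floor-NegRoot [ -[1+ k ] , b , c ] d = A<0 (ℤ.positive⁻¹ +[1+ k ])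
      (linear _ s (r<n +[1+ k ] x n n≡) (trans (cong (λ y → + 2 * +[1+ k ] - (1ℤ + y)) (r≡ +[1+ k ] x n n≡))
        (eq s b (q +[1+ k ] x n n≡) +[1+ k ])))
      where
      n = 2 ℕ.* suc k
      n≡ = ℤ.pos-* 2 (suc k)
      x = b - s⁺
      eq : ∀ s b q a → + 2 * a - (+ 1 + (b - (+ 1 + s) - q * (+ 2 * a))) ≡ s - (b + + 2 * (q + + 1) * - a)
      eq = solve-∀

    -- The first root exceeds 1, and the second one is negative, respectively positive.
    record Reduced (f : Form) : Set where
      field
        A-pos     : Pos (A f)
        C-neg     : Pos (- C f)
        total-neg : Pos (- total f)

    record Unreduced (f : Form) : Set where
      field
        AC>0 : Pos (A f * C f)
        root>1 : PosRoot (turnL f)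

    reduced⇒splits : ∀ {f} → Reduced f → Splits f
    reduced⇒splits r = pos* (Reduced.A-pos r) (Reduced.C-neg r)

    posRoot-splits : ∀ {f} → Disc f → PosRoot f → Splits f → Pos (A f) × Pos (- C f)
    posRoot-splits {f} d (A>0 a _) r = a , pos-cancel (A f) (- C f) a r
    posRoot-splits {f} d (A<0 _ p) r = contradiction p (¬below {f} d r)

    splits-or-same : ∀ {f} → Disc f → Splits f ⊎ Pos (A f * C f)
    splits-or-same {f} d with sign (A f) (A≢0′ {f} d) | sign (C f) (C≢0′ {f} d)
    ... | inj₁ a | inj₁ c = inj₂ (pos* a c)
    ... | inj₁ a | inj₂ c = inj₁ (pos* a c)
    ... | inj₂ a | inj₁ c = inj₁ (subst Pos (eq (A f) (C f)) (pos* a c))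
      where
      eq : ∀ a c → - a * c ≡ a * - c
      eq = solve-∀
    ... | inj₂ a | inj₂ c = inj₂ (subst Pos (neg-*-neg (A f) (C f)) (pos* a c))

    module _ (f : Form) (d : Disc f) (p : PosRoot f) (n : NegRoot (turnL f)) where

      -- The hypotheses `p` and `n` say that the first root lies between 0 and 1, and `Splits` makes
      -- the second one negative; so the inverses of the roots lie above 1 and below 0.
      reciprocal-reduced : Splits f → Reduced (reciprocal f)
      reciprocal-reduced r = record
        { A-pos     = c
        ; C-neg     = subst Pos (sym (ℤ.neg-involutive (A f))) a
        ; total-neg = subst Pos (eq (A f) (B f) (C f)) (total>0 n)
        }
        where
        a = proj₁ (posRoot-splits d p r)
        c = proj₂ (posRoot-splits d p r)
        eq : ∀ a b c → a + b + c ≡ - (- c + - b + - a)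
        eq = solve-∀
        total>0 : NegRoot (turnL f) → Pos (total f)
        total>0 (A<0 a′ _) = contradiction a′ (pos⇒¬neg a)
        total>0 (A>0 _ q) = [ (λ t → t) ,
          (λ t → contradiction q (¬below {turnL f} (trans (disc-turnL f) d) (pos* a t))) ]′
          (sign (total f) (C≢0′ {turnL f} (trans (disc-turnL f) d)))

      private
        d′ : Disc (turnL (reciprocal f))
        d′ = trans (disc-turnL (reciprocal f)) (trans (disc-reciprocal f) d)

        -- If z and 1/z were both less than 1, then (|B| - s)(|B| + s + 1) ≤ 4AC = B² - D.
        crossed : ∀ a b c → disc [ a , b , c ] ≡ D → s⁺ ≤ b →
          b + + 2 * a ≤ s → s⁺ ≤ - b + + 2 * - c → 0ℤ ≤ - (1ℤ)
        crossed a b c refl p u v = subst (0ℤ ≤_) (eq a b c s)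
          (0≤+ (0≤+ (0≤+ (0≤* u₁ v₁) (0≤+ (0≤* u₁ w₂) (0≤* w₁ v₁))) (difference≥0 s²≤D)) (difference≥0 p))
          where
          u₁ = difference≥0 u
          v₁ = difference≥0 v
          b-s⁺ = difference≥0 p
          w₁ : 0ℤ ≤ b - s
          w₁ = subst (0ℤ ≤_) (e b s) (0≤+ b-s⁺ (ℤ.+≤+ {0} {1} ℕ.z≤n))
            where
            e : ∀ b s → b - (+ 1 + s) + + 1 ≡ b - s
            e = solve-∀
          w₂ : 0ℤ ≤ b + (1ℤ + s)
          w₂ = subst (0ℤ ≤_) (e b s) (0≤+ b-s⁺ (0≤+ (0≤+ {1ℤ} {s} (ℤ.+≤+ ℕ.z≤n) s≥0) (0≤+ {1ℤ} {s} (ℤ.+≤+ ℕ.z≤n) s≥0)))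
            where
            e : ∀ b s → b - (+ 1 + s) + ((+ 1 + s) + (+ 1 + s)) ≡ b + (+ 1 + s)
            e = solve-∀
          eq : ∀ a b c s → (s - (b + + 2 * a)) * (- b + + 2 * - c - (+ 1 + s))
                 + ((s - (b + + 2 * a)) * (b + (+ 1 + s)) + (b - s) * (- b + + 2 * - c - (+ 1 + s)))
                 + (b * b - + 4 * a * c - s * s) + (b - (+ 1 + s)) ≡ - (+ 1)
          eq = solve-∀

      reciprocal-unreduced : Pos (A f * C f) → Unreduced (reciprocal f)
      reciprocal-unreduced ac = record
        { AC>0   = subst Pos (eq (A f) (C f)) ac
        ; root>1 = root>1
        }
        where
        eq : ∀ a c → a * c ≡ - c * - a
        eq = solve-∀
        e₁ : ∀ b s → - (+ 1 + s) - b ≡ - b - (+ 1 + s)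
        e₁ = solve-∀
        e₂ : ∀ a b → b + + 2 * a ≡ - - b + + 2 * - - a
        e₂ = solve-∀
        ¬root<1 : PosRoot f → NegRoot (turnL f) → ¬ NegRoot (turnL (reciprocal f))
        ¬root<1 (A>0 a _) (A<0 a′ _) _ = pos⇒¬neg a a′
        ¬root<1 (A<0 a _) (A>0 a′ _) _ = pos⇒¬neg a′ a
        ¬root<1 (A>0 a _) (A>0 _ _) (A>0 c _) = pos⇒¬neg (pos-cancel (A f) (C f) a ac) c
        ¬root<1 (A<0 a _) (A<0 _ _) (A<0 c _) =
          pos⇒¬neg (pos-cancel (- A f) (- C f) a (subst Pos (sym (neg-*-neg (A f) (C f))) ac)) c
        ¬root<1 (A<0 _ u) (A<0 _ w) (A>0 _ v) =
          contradiction (crossed (A f) (B f) (C f) d u w v) λ ()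
        -- By `outer`, B ≤ - s - 1, so `crossed` is applied to the reciprocal form, whose middle
        -- coefficient - B is the large one.
        ¬root<1 (A>0 _ u) (A>0 _ w) (A<0 _ v) =
          [ (λ t → contradiction (crossed (- C f) (- B f) (- A f) (trans (disc-reciprocal f) d)
              (linear s⁺ (- B f) (difference≥0 t) (e₁ (B f) s)) v (subst (s⁺ ≤_) (e₂ (A f) (B f)) w)) λ ())
          , (λ t → s⁺≤⇒≰ t u) ]′ (outer {f} d ac)
        root>1 : PosRoot (turnL (reciprocal f))
        root>1 = [ (λ p′ → p′) , (λ n′ → contradiction n′ (¬root<1 p n)) ]′
          (rootSign {turnL (reciprocal f)} d′)

    gaussStep : Form → Form
    gaussStep f = reciprocal (translate (floor f) f)

    disc-gaussStep : ∀ {f} → Disc f → Disc (gaussStep f)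
    disc-gaussStep {f} d = trans (disc-reciprocal (translate (floor f) f)) (trans (disc-translate (floor f) f) d)

    module _ (f : Form) (d : Disc f) where

      private
        a = floor f
        f′ = translate a f

        d′ : Disc f′
        d′ = trans (disc-translate a f) d

        n : NegRoot (turnL f′)
        n = subst NegRoot (translate-suc a f) (floor-NegRoot f d)

        monotone : ∀ {x y z} → 0ℤ ≤ z → x ≤ y → 0ℤ ≤ z * y - z * x
        monotone {x} {y} {z} p q = subst (0ℤ ≤_) (eq x y z) (0≤* p (difference≥0 q))
          where
          eq : ∀ x y z → z * (y - x) ≡ z * y - z * x
          eq = solve-∀

      -- The middle coefficient of translate x f moves in the direction of the sign of A.
      B-monotone : ∀ {x y} → Pos (A f) → x ≤ y → B (translate x f) ≤ B (translate y f)
      B-monotone {x} {y} p q = linear _ _ (0≤+ m m) (eq (A f) (B f) x y)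
        where
        m = monotone (ℤ.<⇒≤ p) q
        eq : ∀ a b x y → a * y - a * x + (a * y - a * x) ≡ b + + 2 * y * a - (b + + 2 * x * a)
        eq = solve-∀

      B-antitone : ∀ {x y} → Pos (- A f) → x ≤ y → B (translate y f) ≤ B (translate x f)
      B-antitone {x} {y} p q = linear _ _ (0≤+ m m) (eq (A f) (B f) x y)
        where
        m = monotone (ℤ.<⇒≤ p) q
        eq : ∀ a b x y → - a * y - - a * x + (- a * y - - a * x) ≡ b + + 2 * x * a - (b + + 2 * y * a)
        eq = solve-∀

      1≤floor : PosRoot (turnL f) → 1ℤ ≤ a
      1≤floor p with 1ℤ ℤ.≤? a
      ... | yes q = q
      ... | no ¬q = contradiction (floor-NegRoot f d) (¬neg (subst PosRoot (sym (translate-1 f)) p))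
        where
        a+1≤1 : a + 1ℤ ≤ 1ℤ
        a+1≤1 = subst (_≤ 1ℤ) (ℤ.+-comm 1ℤ a) (ℤ.i<j⇒suc[i]≤j (ℤ.≰⇒> ¬q))
        ¬neg : PosRoot (translate 1ℤ f) → ¬ NegRoot (translate (a + 1ℤ) f)
        ¬neg (A>0 b _) (A<0 b′ _) = pos⇒¬neg b b′
        ¬neg (A<0 b _) (A>0 b′ _) = pos⇒¬neg b′ b
        ¬neg (A>0 b u) (A>0 _ v)  = s⁺≤⇒≰ v (ℤ.≤-trans (B-monotone b a+1≤1) u)
        ¬neg (A<0 b u) (A<0 _ v)  = s⁺≤⇒≰ u (ℤ.≤-trans (B-antitone b a+1≤1) v)

      reduced⇒posRoot : Reduced f → PosRoot (turnL f)
      reduced⇒posRoot r = A>0 A-pos (upper {turnL f} (trans (disc-turnL f) d) (pos* A-pos total-neg))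
        where open Reduced r

      module _ (r : Reduced f) where
        open Reduced r

        1≤floor-reduced : 1ℤ ≤ a
        1≤floor-reduced = 1≤floor (reduced⇒posRoot r)

        -- Such an x lies between the two roots, where the form is negative. In integers: B + 2xA
        -- grows with x from at least - s to at most s, and within these bounds A and C cannot have
        -- equal signs.
        translate-splits : ∀ {x} → 0ℤ ≤ x → x ≤ a → Pos (- C (translate x f))
        translate-splits {x} p q = splits {translate x f} (trans (disc-translate x f) d)
          (ℤ.≤-trans (lower {f} d (reduced⇒splits r))
            (subst (λ g → B g ≤ B (translate x f)) (translate-0 f) (B-monotone A-pos p)))
          (ℤ.≤-trans (B-monotone A-pos q) B≤s) A-pos
          where
          B≤s : B f′ ≤ s
          B≤s with floor-PosRoot f d
          ... | A>0 _ u = u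
          ... | A<0 b _ = contradiction b (pos⇒¬neg A-pos)

        gaussStep-reduced : Reduced (gaussStep f)
        gaussStep-reduced = reciprocal-reduced f′ d′ (floor-PosRoot f d) n
          (pos* A-pos (translate-splits (ℤ.≤-trans (ℤ.+≤+ ℕ.z≤n) 1≤floor-reduced) ℤ.≤-refl))

      -- For an unreduced form |B| measures the progress of the reduction.
      gaussStep-dichotomy : Reduced (gaussStep f)
        ⊎ Unreduced (gaussStep f) × (Unreduced f → ℤ.∣ B (gaussStep f) ∣ ℕ.< ℤ.∣ B f ∣)
      gaussStep-dichotomy =
        [ (λ r → inj₁ (reciprocal-reduced f′ d′ (floor-PosRoot f d) n r))
        , (λ ac → inj₂ (reciprocal-unreduced f′ d′ (floor-PosRoot f d) n ac , smaller ac)) ]′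
        (splits-or-same {f′} d′)
        where
        abs-< : ∀ {x y} → 0ℤ ≤ x → x < y → ℤ.∣ x ∣ ℕ.< ℤ.∣ y ∣
        abs-< {+ m} {+ n} _ (ℤ.+<+ p) = p
        s⁺≥0 : 0ℤ ≤ s⁺
        s⁺≥0 = 0≤+ {1ℤ} {s} (ℤ.+≤+ ℕ.z≤n) s≥0
        increase : ∀ {x} → Pos x → B f < B f + + 2 * 1ℤ * x
        increase {x} p = subst₂ _<_ (ℤ.+-identityʳ (B f)) (cong (λ y → B f + y) (eq x))
          (ℤ.+-monoʳ-< (B f) (pos+ p p))
          where
          eq : ∀ x → x + x ≡ + 2 * + 1 * x
          eq = solve-∀
        decrease : ∀ {x} → Pos (- x) → B f + + 2 * 1ℤ * x < B f
        decrease {x} p = subst₂ _<_ (eq (B f) x) (ℤ.+-identityʳ (B f))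
          (ℤ.+-monoʳ-< (B f) (ℤ.neg-mono-< (pos+ p p)))
          where
          eq : ∀ b x → b + - (- x + - x) ≡ b + + 2 * + 1 * x
          eq = solve-∀
        -- The floor is at least 1, so the translation moves B by at least 2|A| towards 0; since A C
        -- > 0 afterwards, B stays beyond s on its own side of 0.
        smaller′ : Pos (A f * C f′) → PosRoot (turnL f) → 1ℤ ≤ a → PosRoot f′ → ℤ.∣ - B f′ ∣ ℕ.< ℤ.∣ B f ∣
        smaller′ _ (A>0 b _) _ (A<0 b′ _) = contradiction b′ (pos⇒¬neg b)
        smaller′ _ (A<0 b _) _ (A>0 b′ _) = contradiction b (pos⇒¬neg b′)
        smaller′ _ (A<0 b _) 1≤a (A<0 _ v) = subst (ℕ._< ℤ.∣ B f ∣) (sym (ℤ.∣-i∣≡∣i∣ (B f′)))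
          (abs-< (ℤ.≤-trans s⁺≥0 v) (ℤ.≤-<-trans (B-antitone b 1≤a) (decrease b)))
        smaller′ ac (A>0 b _) 1≤a (A>0 _ v) =
          [ (λ t → subst (ℤ.∣ - B f′ ∣ ℕ.<_) (ℤ.∣-i∣≡∣i∣ (B f))
              (abs-< (ℤ.≤-trans s⁺≥0 (subst (_≤ - B f′) (ℤ.neg-involutive s⁺) (ℤ.neg-mono-≤ t)))
                (ℤ.neg-mono-< (ℤ.<-≤-trans (increase b) (B-monotone b 1≤a)))))
          , (λ t → contradiction v (s⁺≤⇒≰ t)) ]′ (outer {f′} d′ ac)
        smaller : Pos (A f * C f′) → Unreduced f → ℤ.∣ - B f′ ∣ ℕ.< ℤ.∣ B f ∣
        smaller ac u = smaller′ ac (Unreduced.root>1 u) (1≤floor (Unreduced.root>1 u)) (floor-PosRoot f d)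

    reduces-within : ∀ n f → Disc f → Unreduced f → ℤ.∣ B f ∣ ℕ.≤ n →
      ∃[ k ] Reduced (iterate gaussStep k f)

    private
      reduces-after : ∀ n f → Disc f → Unreduced f → ℤ.∣ B f ∣ ℕ.≤ n →
        Unreduced (gaussStep f) → ℤ.∣ B (gaussStep f) ∣ ℕ.< ℤ.∣ B f ∣ →
        ∃[ k ] Reduced (iterate gaussStep k f)
      reduces-after zero    f d u b _ q = contradiction (ℕ.<-≤-trans q b) ℕ.n≮0
      reduces-after (suc n) f d u b u′ q =
        let k , r = reduces-within n (gaussStep f) (disc-gaussStep {f} d) u′
                      (ℕ.s≤s⁻¹ (ℕ.<-≤-trans q b))
        in suc k , subst Reduced (iterate-suc gaussStep k f) r

    reduces-within n f d u b =
      [ (λ r → 1 , r) , (λ (u′ , smaller) → reduces-after n f d u b u′ (smaller u)) ]′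
      (gaussStep-dichotomy f d)

    -- An arbitrary form may be neither reduced nor unreduced; the measure |B| applies after a first
    -- step, which brings the root above 1.
    reduces : ∀ f → Disc f → ∃[ k ] Reduced (iterate gaussStep k f)
    reduces f d = [ (λ r → 1 , r) , (λ (u , _) → later u) ]′ (gaussStep-dichotomy f d)
      where
      later : Unreduced (gaussStep f) → ∃[ k ] Reduced (iterate gaussStep k f)
      later u =
        let k , r = reduces-within _ (gaussStep f) (disc-gaussStep {f} d) u ℕ.≤-refl
        in suc k , subst Reduced (iterate-suc gaussStep k f) r

    disc-iterate : ∀ f → Disc f → ∀ k → Disc (iterate gaussStep k f)
    disc-iterate f d zero    = d
    disc-iterate f d (suc k) = disc-gaussStep {iterate gaussStep k f} (disc-iterate f d k)

    stays-reduced : ∀ f → Disc f → Reduced f → ∀ k → Reduced (iterate gaussStep k f)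
    stays-reduced f d r zero    = r
    stays-reduced f d r (suc k) =
      gaussStep-reduced (iterate gaussStep k f) (disc-iterate f d k) (stays-reduced f d r k)

-- The continued fraction of the first root

private
  toℚᵘ-fromℤ : ∀ i → ℚ.toℚᵘ (fromℤ i) ℚᵘ.≃ mkℚᵘ i 0
  toℚᵘ-fromℤ i = ℚ.toℚᵘ-fromℚᵘ (mkℚᵘ i 0)

fromℤ-+ : ∀ i j → fromℤ (i ℤ.+ j) ≡ fromℤ i ℚ.+ fromℤ j
fromℤ-+ i j = ℚ.toℚᵘ-injective (begin
  ℚ.toℚᵘ (fromℤ (i ℤ.+ j))                   ≈⟨ toℚᵘ-fromℤ (i ℤ.+ j) ⟩
  mkℚᵘ (i ℤ.+ j) 0                           ≈⟨ *≡* (eq i j) ⟩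
  mkℚᵘ i 0 ℚᵘ.+ mkℚᵘ j 0                     ≈⟨ ℚᵘ.+-cong (toℚᵘ-fromℤ i) (toℚᵘ-fromℤ j) ⟨
  ℚ.toℚᵘ (fromℤ i) ℚᵘ.+ ℚ.toℚᵘ (fromℤ j)     ≈⟨ ℚ.toℚᵘ-homo-+ (fromℤ i) (fromℤ j) ⟨
  ℚ.toℚᵘ (fromℤ i ℚ.+ fromℤ j)               ∎)
  where
  open import Relation.Binary.Reasoning.Setoid ℚᵘ.≃-setoid
  eq : ∀ i j → (i ℤ.+ j) ℤ.* + 1 ≡ (i ℤ.* + 1 ℤ.+ j ℤ.* + 1) ℤ.* + 1
  eq = solve-∀

fromℤ-* : ∀ i j → fromℤ (i ℤ.* j) ≡ fromℤ i ℚ.* fromℤ j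
fromℤ-* i j = ℚ.toℚᵘ-injective (begin
  ℚ.toℚᵘ (fromℤ (i ℤ.* j))                   ≈⟨ toℚᵘ-fromℤ (i ℤ.* j) ⟩
  mkℚᵘ i 0 ℚᵘ.* mkℚᵘ j 0                     ≈⟨ ℚᵘ.*-cong (toℚᵘ-fromℤ i) (toℚᵘ-fromℤ j) ⟨
  ℚ.toℚᵘ (fromℤ i) ℚᵘ.* ℚ.toℚᵘ (fromℤ j)     ≈⟨ ℚ.toℚᵘ-homo-* (fromℤ i) (fromℤ j) ⟨
  ℚ.toℚᵘ (fromℤ i ℚ.* fromℤ j)               ∎)
  where open import Relation.Binary.Reasoning.Setoid ℚᵘ.≃-setoid

fromℤ-neg : ∀ i → fromℤ (ℤ.- i) ≡ ℚ.- fromℤ i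
fromℤ-neg i = ℚ.toℚᵘ-injective (begin
  ℚ.toℚᵘ (fromℤ (ℤ.- i))       ≈⟨ toℚᵘ-fromℤ (ℤ.- i) ⟩
  ℚᵘ.- mkℚᵘ i 0                ≈⟨ ℚᵘ.-‿cong (toℚᵘ-fromℤ i) ⟨
  ℚᵘ.- ℚ.toℚᵘ (fromℤ i)        ≈⟨ ℚ.toℚᵘ-homo‿- (fromℤ i) ⟨
  ℚ.toℚᵘ (ℚ.- fromℤ i)         ∎)
  where open import Relation.Binary.Reasoning.Setoid ℚᵘ.≃-setoid

fromℤ-mono : ∀ {i j} → i ℤ.≤ j → fromℤ i ℚ.≤ fromℤ j
fromℤ-mono {i} {j} p = ℚ.toℚᵘ-cancel-≤ (begin
  ℚ.toℚᵘ (fromℤ i)   ≃⟨ toℚᵘ-fromℤ i ⟩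
  mkℚᵘ i 0           ≤⟨ *≤* (subst₂ ℤ._≤_ (sym (ℤ.*-identityʳ i)) (sym (ℤ.*-identityʳ j)) p) ⟩
  mkℚᵘ j 0           ≃⟨ toℚᵘ-fromℤ j ⟨
  ℚ.toℚᵘ (fromℤ j)   ∎)
  where open ℚᵘ.≤-Reasoning

-- 1 / i, and 0 for i = 0.
recip : ℤ → ℚ
recip (+ zero) = 0ℚ
recip +[1+ n ] = 1ℤ ℚ./ suc n
recip -[1+ n ] = ℚ.- (1ℤ ℚ./ suc n)

negℚ-involutive : ∀ x → ℚ.- (ℚ.- x) ≡ x
negℚ-involutive = +-*-Solver.solve 1 (λ x → :- (:- x) := x) refl
  where open +-*-Solver

recip-neg : ∀ i → recip (ℤ.- i) ≡ ℚ.- recip i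
recip-neg (+ zero) = refl
recip-neg +[1+ n ] = refl
recip-neg -[1+ n ] = sym (negℚ-involutive (1ℤ ℚ./ suc n))

private
  recip-inverse⁺ : ∀ n → fromℤ +[1+ n ] ℚ.* recip +[1+ n ] ≡ 1ℚ
  recip-inverse⁺ n = ℚ.toℚᵘ-injective (begin
    ℚ.toℚᵘ (fromℤ +[1+ n ] ℚ.* (1ℤ ℚ./ suc n))            ≈⟨ ℚ.toℚᵘ-homo-* (fromℤ +[1+ n ]) (1ℤ ℚ./ suc n) ⟩
    ℚ.toℚᵘ (fromℤ +[1+ n ]) ℚᵘ.* ℚ.toℚᵘ (1ℤ ℚ./ suc n)    ≈⟨ ℚᵘ.*-cong (toℚᵘ-fromℤ +[1+ n ]) (ℚ.toℚᵘ-fromℚᵘ (mkℚᵘ 1ℤ n)) ⟩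
    mkℚᵘ +[1+ n ] 0 ℚᵘ.* mkℚᵘ 1ℤ n                        ≈⟨ *≡* (cong +[1+_] (eq n)) ⟩
    mkℚᵘ 1ℤ 0                                             ∎)
    where
    open import Relation.Binary.Reasoning.Setoid ℚᵘ.≃-setoid
    eq : ∀ n → n ℕ.* 1 ℕ.* 1 ≡ n ℕ.+ 0 ℕ.* suc n ℕ.+ 0 ℕ.* suc (n ℕ.+ 0 ℕ.* suc n)
    eq = solveℕ-∀

  neg*neg : ∀ x y → ℚ.- x ℚ.* ℚ.- y ≡ x ℚ.* y
  neg*neg = +-*-Solver.solve 2 (λ x y → :- x :* :- y := x :* y) refl
    where open +-*-Solver

recip-inverse : ∀ i → i ≢ 0ℤ → fromℤ i ℚ.* recip i ≡ 1ℚ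
recip-inverse (+ zero) i≢0 = contradiction refl i≢0
recip-inverse +[1+ n ] _   = recip-inverse⁺ n
recip-inverse -[1+ n ] _   = trans (cong (ℚ._* recip -[1+ n ]) (fromℤ-neg +[1+ n ]))
  (trans (neg*neg (fromℤ +[1+ n ]) (1ℤ ℚ./ suc n)) (recip-inverse⁺ n))

recip-nonneg : ∀ i → Pos i → 0ℚ ℚ.≤ recip i
recip-nonneg (+ zero) (ℤ.+<+ ())
recip-nonneg +[1+ n ] _ = ℚ.nonNegative⁻¹ (1ℤ ℚ./ suc n) {{ℚ.normalize-nonNeg 1 (suc n)}}

-- D is a parameter, separate from `disc f`, so that the roots of all forms met by the algorithm lie
-- in one and the same field.
root : (D : ℤ) → Form → ℚ√ D
root D f = (fromℤ (ℤ.- B f) ℚ.* recip (+ 2 ℤ.* A f)) +√ recip (+ 2 ℤ.* A f)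

-- The first root and the order of ℚ(√D)

module _ where
  open import Data.Rational.Base using (_+_; _*_; -_; _-_; _≤_)
  open +-*-Solver using (solve; _:+_; _:*_; :-_; _:-_; _:=_; con)

  0≤-* : ∀ {x y} → 0ℚ ≤ x → 0ℚ ≤ y → 0ℚ ≤ x * y
  0≤-* {x} {y} p q = ℚ.nonNegative⁻¹ (x * y)
    {{ℚ.nonNeg*nonNeg⇒nonNeg x {{ℚ.nonNegative p}} y {{ℚ.nonNegative q}}}}

  0≤-neg : ∀ {x} → x ≤ 0ℚ → 0ℚ ≤ - x
  0≤-neg = ℚ.neg-antimono-≤

  *-mono-square : ∀ w {x y} → x ≤ y → x * (w * w) ≤ y * (w * w)
  *-mono-square w p = ℚ.*-monoʳ-≤-nonNeg (w * w) {{square}} p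
    where
    square : ℚ.NonNegative (w * w)
    square with ℚ.≤-total 0ℚ w
    ... | inj₁ q = ℚ.nonNegative (0≤-* q q)
    ... | inj₂ q = ℚ.nonNegative (subst (0ℚ ≤_) (neg*neg w w) (0≤-* (0≤-neg q) (0≤-neg q)))

  module _ (D s : ℤ) (s²≤D : s ℤ.* s ℤ.≤ D) (D<s⁺² : 1ℤ ℤ.+ D ℤ.≤ (1ℤ ℤ.+ s) ℤ.* (1ℤ ℤ.+ s))
           (s≥0 : 0ℤ ℤ.≤ s) where

    private
      s⁺ = 1ℤ ℤ.+ s

      square-eq : ∀ b w → fromℤ (ℤ.- b) * w * (fromℤ (ℤ.- b) * w) ≡ fromℤ (b ℤ.* b) * (w * w)
      square-eq b w = trans (cong (λ x → x * w * (x * w)) (fromℤ-neg b))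
        (trans (eq (fromℤ b) w) (cong (_* (w * w)) (sym (fromℤ-* b b))))
        where
        eq : ∀ b w → - b * w * (- b * w) ≡ b * b * (w * w)
        eq = solve 2 (λ b w → :- b :* w :* (:- b :* w) := b :* b :* (w :* w)) refl

      D-square : ∀ w → w * w * fromℤ D ≡ fromℤ D * (w * w)
      D-square w = ℚ.*-comm (w * w) (fromℤ D)

      squares : ∀ {x y} → 0ℤ ℤ.≤ x → x ℤ.≤ y → x ℤ.* x ℤ.≤ y ℤ.* y
      squares {+ m} {+ n} _ (ℤ.+≤+ p) = subst₂ ℤ._≤_ (ℤ.pos-* m m) (ℤ.pos-* n n) (ℤ.+≤+ (ℕ.*-mono-≤ p p))

      s⁺≥0 : 0ℤ ℤ.≤ s⁺
      s⁺≥0 = ℤ.≤-trans s≥0 (ℤ.i≤j+i s 1ℤ)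

    -- For b > 0 the terms of w (√D - b) have opposite signs and are compared by b² ≤ s² ≤ D. The
    -- lemma serves with w = 1 / 2A or its negative, whichever is positive.
    nonNegative-upper : ∀ b w → 0ℚ ≤ w → b ℤ.≤ s → NonNegative {D} ((fromℤ (ℤ.- b) * w) +√ w)
    nonNegative-upper b w w≥0 b≤s with ℤ.≤-total b 0ℤ
    ... | inj₁ b≤0 = both (0≤-* (fromℤ-mono (ℤ.neg-mono-≤ b≤0)) w≥0) w≥0
    ... | inj₂ b≥0 = irrDominates
      (subst (_≤ 0ℚ) (trans (eq (fromℤ b) w) (cong (_* w) (sym (fromℤ-neg b))))
        (ℚ.neg-antimono-≤ (0≤-* (fromℤ-mono b≥0) w≥0))) w≥0
      (subst₂ _≤_ (sym (square-eq b w)) (sym (D-square w))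
        (*-mono-square w (fromℤ-mono (ℤ.≤-trans (squares b≥0 b≤s) s²≤D))))
      where
      eq : ∀ x w → - (x * w) ≡ - x * w
      eq = solve 2 (λ x w → :- (x :* w) := :- x :* w) refl

    nonNegative-lower : ∀ b w → w ≤ 0ℚ → s⁺ ℤ.≤ b → NonNegative {D} ((fromℤ (ℤ.- b) * w) +√ w)
    nonNegative-lower b w w≤0 s⁺≤b = ratDominates
      (subst (0ℚ ≤_) (trans (eq (fromℤ b) w) (cong (_* w) (sym (fromℤ-neg b))))
        (0≤-* (fromℤ-mono (ℤ.≤-trans s⁺≥0 s⁺≤b)) (0≤-neg w≤0))) w≤0
      (subst₂ _≤_ (sym (D-square w)) (sym (square-eq b w)) (*-mono-square w (fromℤ-mono D≤b²)))
      where
      D≤b² : D ℤ.≤ b ℤ.* b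
      D≤b² = ℤ.≤-trans (ℤ.i≤j+i D 1ℤ) (ℤ.≤-trans D<s⁺² (squares s⁺≥0 s⁺≤b))
      eq : ∀ x w → x * - w ≡ - x * w
      eq = solve 2 (λ x w → x :* :- w := :- x :* w) refl

  2A≢0 : ∀ {a} → a ≢ 0ℤ → + 2 ℤ.* a ≢ 0ℤ
  2A≢0 {a} a≢0 eq = [ (λ ()) , a≢0 ]′ (ℤ.i*j≡0⇒i≡0∨j≡0 (+ 2) eq)

  2A-inverse : ∀ {a} → a ≢ 0ℤ → fromℤ (+ 2 ℤ.* a) * recip (+ 2 ℤ.* a) ≡ 1ℚ
  2A-inverse {a} a≢0 = recip-inverse (+ 2 ℤ.* a) (2A≢0 {a} a≢0)

  root-isFirstRoot : ∀ q → A q ≢ 0ℤ → IsFirstRoot q (root (disc q) q)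
  root-isFirstRoot q a≢0 = cong₂ _+√_
    (trans (eq₁ (fromℤ (+ 2 ℤ.* A q)) (fromℤ (ℤ.- B q)) w (fromℤ (disc q)))
      (trans (cong (fromℤ (ℤ.- B q) *_) (2A-inverse a≢0)) (eq₃ (fromℤ (ℤ.- B q)))))
    (trans (eq₂ (fromℤ (+ 2 ℤ.* A q)) (fromℤ (ℤ.- B q)) w)
      (trans (2A-inverse a≢0) (sym (ℚ.+-identityˡ 1ℚ))))
    where
    w = recip (+ 2 ℤ.* A q)
    eq₁ : ∀ a b w d → a * (b * w) + d * (0ℚ * w) ≡ b * (a * w)
    eq₁ = solve 4 (λ a b w d → a :* (b :* w) :+ d :* (con 0ℚ :* w) := b :* (a :* w)) refl
    eq₂ : ∀ a b w → a * w + 0ℚ * (b * w) ≡ a * w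
    eq₂ = solve 3 (λ a b w → a :* w :+ con 0ℚ :* (b :* w) := a :* w) refl
    eq₃ : ∀ b → b * 1ℚ ≡ b + 0ℚ
    eq₃ = solve 1 (λ b → b :* con 1ℚ := b :+ con 0ℚ) refl

  private
    translated : ∀ a f → A f ≢ 0ℤ → fromℤ (ℤ.- B (translate a f)) * recip (+ 2 ℤ.* A f)
                 ≡ fromℤ (ℤ.- B f) * recip (+ 2 ℤ.* A f) - fromℤ a
    translated a f a≢0 = begin
      fromℤ (ℤ.- B (translate a f)) * w                     ≡⟨ cong (λ i → fromℤ i * w) (eq a (A f) (B f)) ⟩
      fromℤ (ℤ.- B f ℤ.+ ℤ.- (a ℤ.* (+ 2 ℤ.* A f))) * w      ≡⟨ cong (_* w) (fromℤ-+ (ℤ.- B f) _) ⟩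
      (fromℤ (ℤ.- B f) + fromℤ (ℤ.- (a ℤ.* (+ 2 ℤ.* A f)))) * w
        ≡⟨ cong (λ x → (fromℤ (ℤ.- B f) + x) * w) (trans (fromℤ-neg (a ℤ.* (+ 2 ℤ.* A f))) (cong -_ (fromℤ-* a (+ 2 ℤ.* A f)))) ⟩
      (fromℤ (ℤ.- B f) + - (fromℤ a * 2A)) * w               ≡⟨ eq₂ (fromℤ (ℤ.- B f)) (fromℤ a) 2A w ⟩
      fromℤ (ℤ.- B f) * w - fromℤ a * (2A * w)              ≡⟨ cong (λ x → fromℤ (ℤ.- B f) * w - fromℤ a * x) (2A-inverse a≢0) ⟩
      fromℤ (ℤ.- B f) * w - fromℤ a * 1ℚ                    ≡⟨ cong (λ x → fromℤ (ℤ.- B f) * w - x) (ℚ.*-identityʳ (fromℤ a)) ⟩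
      fromℤ (ℤ.- B f) * w - fromℤ a                         ∎
      where
      open ≡-Reasoning
      w = recip (+ 2 ℤ.* A f)
      2A = fromℤ (+ 2 ℤ.* A f)
      eq : ∀ x a b → ℤ.- (b ℤ.+ + 2 ℤ.* x ℤ.* a) ≡ ℤ.- b ℤ.+ ℤ.- (x ℤ.* (+ 2 ℤ.* a))
      eq = solve-∀
      eq₂ : ∀ b x y w → (b + - (x * y)) * w ≡ b * w - x * (y * w)
      eq₂ = solve 4 (λ b x y w → (b :+ :- (x :* y)) :* w := b :* w :- x :* (y :* w)) refl

  root-⊖ : ∀ D a f → A f ≢ 0ℤ → root D f ⊖ ι a ≡ root D (translate a f)
  root-⊖ D a f a≢0 = cong₂ _+√_ (sym (translated a f a≢0)) (ℚ.+-identityʳ (recip (+ 2 ℤ.* A f)))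

  ⊖-root : ∀ D a f → A f ≢ 0ℤ → ι a ⊖ root D f
    ≡ (fromℤ (ℤ.- B (translate a f)) * - recip (+ 2 ℤ.* A f)) +√ (- recip (+ 2 ℤ.* A f))
  ⊖-root D a f a≢0 = cong₂ _+√_
    (trans (eq (fromℤ a) (fromℤ (ℤ.- B f) * w)) (trans (cong -_ (sym (translated a f a≢0)))
      (ℚ.neg-distribʳ-* (fromℤ (ℤ.- B (translate a f))) w)))
    (ℚ.+-identityˡ (- w))
    where
    w = recip (+ 2 ℤ.* A f)
    eq : ∀ x y → x - y ≡ - (y - x)
    eq = solve 2 (λ x y → x :- y := :- (y :- x)) refl

  -- This is (- B + √D) (B + √D) = D - B² = (2A) (- 2C), divided by the right-hand side.
  root-⊛-reciprocal : ∀ D f → disc f ≡ D → A f ≢ 0ℤ → C f ≢ 0ℤ → root D f ⊛ root D (reciprocal f) ≡ ι 1ℤ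
  root-⊛-reciprocal _ f refl a≢0 c≢0 = cong₂ _+√_
    (begin
      fromℤ (ℤ.- B f) * w * (fromℤ (ℤ.- (ℤ.- B f)) * w′) + fromℤ (disc f) * (w * w′)
        ≡⟨ eq₁ (fromℤ (ℤ.- B f)) w (fromℤ (ℤ.- (ℤ.- B f))) w′ (fromℤ (disc f)) ⟩
      (fromℤ (ℤ.- B f) * fromℤ (ℤ.- (ℤ.- B f)) + fromℤ (disc f)) * (w * w′)
        ≡⟨ cong (_* (w * w′)) (trans (cong (_+ fromℤ (disc f)) (sym (fromℤ-* (ℤ.- B f) (ℤ.- (ℤ.- B f)))))
             (sym (fromℤ-+ (ℤ.- B f ℤ.* ℤ.- (ℤ.- B f)) (disc f)))) ⟩
      fromℤ (ℤ.- B f ℤ.* ℤ.- (ℤ.- B f) ℤ.+ disc f) * (w * w′)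
        ≡⟨ cong (λ i → fromℤ i * (w * w′)) (eq₂ (A f) (B f) (C f)) ⟩
      fromℤ ((+ 2 ℤ.* A f) ℤ.* (+ 2 ℤ.* ℤ.- C f)) * (w * w′)
        ≡⟨ cong (_* (w * w′)) (fromℤ-* (+ 2 ℤ.* A f) (+ 2 ℤ.* ℤ.- C f)) ⟩
      fromℤ (+ 2 ℤ.* A f) * fromℤ (+ 2 ℤ.* ℤ.- C f) * (w * w′)
        ≡⟨ eq₃ (fromℤ (+ 2 ℤ.* A f)) (fromℤ (+ 2 ℤ.* ℤ.- C f)) w w′ ⟩
      (fromℤ (+ 2 ℤ.* A f) * w) * (fromℤ (+ 2 ℤ.* ℤ.- C f) * w′)
        ≡⟨ cong₂ _*_ (2A-inverse a≢0) (2A-inverse c′≢0) ⟩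
      1ℚ * 1ℚ ≡⟨⟩
      1ℚ      ∎)
    (trans (cong (λ x → fromℤ (ℤ.- B f) * w * w′ + w * (x * w′)) (fromℤ-neg (ℤ.- B f)))
      (eq₄ (fromℤ (ℤ.- B f)) w w′))
    where
    open ≡-Reasoning
    w = recip (+ 2 ℤ.* A f)
    w′ = recip (+ 2 ℤ.* ℤ.- C f)
    c′≢0 : ℤ.- C f ≢ 0ℤ
    c′≢0 eq = c≢0 (ℤ.neg-injective eq)
    eq₁ : ∀ b w b′ w′ d → b * w * (b′ * w′) + d * (w * w′) ≡ (b * b′ + d) * (w * w′)
    eq₁ = solve 5 (λ b w b′ w′ d → b :* w :* (b′ :* w′) :+ d :* (w :* w′) := (b :* b′ :+ d) :* (w :* w′)) refl
    eq₂ : ∀ a b c → ℤ.- b ℤ.* ℤ.- (ℤ.- b) ℤ.+ (b ℤ.* b ℤ.- + 4 ℤ.* a ℤ.* c) ≡ (+ 2 ℤ.* a) ℤ.* (+ 2 ℤ.* ℤ.- c)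
    eq₂ = solve-∀
    eq₃ : ∀ x y w w′ → x * y * (w * w′) ≡ (x * w) * (y * w′)
    eq₃ = solve 4 (λ x y w w′ → x :* y :* (w :* w′) := (x :* w) :* (y :* w′)) refl
    eq₄ : ∀ b w w′ → b * w * w′ + w * (- b * w′) ≡ 0ℚ
    eq₄ = solve 3 (λ b w w′ → b :* w :* w′ :+ w :* (:- b :* w′) := con 0ℚ) refl

  recip-signs : ∀ {a} → Pos (ℤ.- a) → 0ℚ ≤ - recip (+ 2 ℤ.* a)
  recip-signs {a} p = subst (0ℚ ≤_) (trans (cong recip (eq a)) (recip-neg (+ 2 ℤ.* a)))
    (recip-nonneg _ (pos* {+ 2} (ℤ.positive⁻¹ (+ 2)) p))
    where
    eq : ∀ a → + 2 ℤ.* ℤ.- a ≡ ℤ.- (+ 2 ℤ.* a)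
    eq = solve-∀

  recip⁺ : ∀ {a} → Pos a → 0ℚ ≤ recip (+ 2 ℤ.* a)
  recip⁺ p = recip-nonneg _ (pos* {+ 2} (ℤ.positive⁻¹ (+ 2)) p)

  module Expansion (D : ℤ) (ns : NotSquare D) (s : ℤ)
                   (s≥0 : 0ℤ ℤ.≤ s) (s²≤D : s ℤ.* s ℤ.≤ D)
                   (D<s⁺² : 1ℤ ℤ.+ D ℤ.≤ (1ℤ ℤ.+ s) ℤ.* (1ℤ ℤ.+ s)) where
    open Reduction D ns s s≥0 s²≤D D<s⁺²

    posRoot⇒nonNegative : ∀ f → PosRoot f → NonNegative (root D f)
    posRoot⇒nonNegative f (A>0 a p) = nonNegative-upper D s s²≤D D<s⁺² s≥0 (B f) _ (recip⁺ a) p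
    posRoot⇒nonNegative f (A<0 a p) = nonNegative-lower D s s²≤D D<s⁺² s≥0 (B f) _
      (subst (_≤ 0ℚ) (negℚ-involutive _) (ℚ.neg-antimono-≤ (recip-signs a))) p

    negRoot⇒nonNegative : ∀ f → NegRoot f →
      NonNegative {D} ((fromℤ (ℤ.- B f) * - recip (+ 2 ℤ.* A f)) +√ (- recip (+ 2 ℤ.* A f)))
    negRoot⇒nonNegative f (A>0 a p) = nonNegative-lower D s s²≤D D<s⁺² s≥0 (B f) _
      (ℚ.neg-antimono-≤ (recip⁺ a)) p
    negRoot⇒nonNegative f (A<0 a p) = nonNegative-upper D s s²≤D D<s⁺² s≥0 (B f) _ (recip-signs a) p

    module _ (q : Form) (d : Disc q) where

      forms : ℕ → Form
      forms i = iterate gaussStep i q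

      private
        at : ∀ i → Disc (forms i)
        at = disc-iterate q d

        a≢0 : ∀ f → Disc f → A f ≢ 0ℤ
        a≢0 f refl = A≢0 {f} ns

        c≢0 : ∀ f → Disc f → C f ≢ 0ℤ
        c≢0 f refl = C≢0 {f} ns

        irrational : ∀ i n → root D (forms i) ≢ ι n
        irrational i n eq = contradiction
          (trans (sym (2A-inverse {A (forms i)} (a≢0 (forms i) (at i))))
            (trans (cong (fromℤ (+ 2 ℤ.* A (forms i)) *_) (cong ℚ√.irr eq)) (ℚ.*-zeroʳ (fromℤ (+ 2 ℤ.* A (forms i))))))
          λ ()

      continuedFraction : IsContinuedFraction (root D q) (λ i → floor (forms i))
      continuedFraction = record
        { quotient = λ i → root D (forms i)
        ; start    = refl
        ; floor≤   = λ i → subst NonNegative (sym (root-⊖ D (floor (forms i)) (forms i) (a≢0 (forms i) (at i))))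
            (posRoot⇒nonNegative (translate (floor (forms i)) (forms i)) (floor-PosRoot (forms i) (at i)))
        ; <floor+1 = λ i →
            subst NonNegative (sym (⊖-root D (floor (forms i) ℤ.+ 1ℤ) (forms i) (a≢0 (forms i) (at i))))
              (negRoot⇒nonNegative (translate (floor (forms i) ℤ.+ 1ℤ) (forms i)) (floor-NegRoot (forms i) (at i)))
            , irrational i (floor (forms i) ℤ.+ 1ℤ)
        ; step     = λ i → trans
            (cong (_⊛ root D (forms (suc i))) (root-⊖ D (floor (forms i)) (forms i) (a≢0 (forms i) (at i))))
            (root-⊛-reciprocal D (translate (floor (forms i)) (forms i)) (d′ i) (a≢0 (forms i) (at i)) (c≢0 (translate (floor (forms i)) (forms i)) (d′ i)))
        }
        where
        d′ : ∀ i → Disc (translate (floor (forms i)) (forms i))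
        d′ i = trans (disc-translate (floor (forms i)) (forms i)) (at i)

-- Periods and run lengths

module _ where
  open import Data.Nat.Base using (_+_; _*_; _∸_; _≤_; _<_)

  module _ {P : ℕ → Set} (P? : Decidable P) where

    private
      search : ∀ n → (∃[ m ] Least P m) ⊎ (∀ m → m < n → ¬ P m)
      search zero    = inj₂ λ m ()
      search (suc n) with search n
      ... | inj₁ found = inj₁ found
      ... | inj₂ none with P? n
      ...   | yes p = inj₁ (n , p , λ m Pm → ℕ.≮⇒≥ λ m<n → none m m<n Pm)
      ...   | no ¬p = inj₂ λ m m<1+n Pm →
                [ (λ m<n → none m m<n Pm) , (λ { refl → ¬p Pm }) ]′ (ℕ.m≤n⇒m<n∨m≡n (ℕ.s≤s⁻¹ m<1+n))

    least : ∀ {n} → P n → ∃[ m ] Least P m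
    least {n} p with search (suc n)
    ... | inj₁ found = found
    ... | inj₂ none  = contradiction p (none n ℕ.≤-refl)

  least-⇔ : {P Q : ℕ → Set} → (∀ n → P n → Q n) → (∀ n → Q n → P n) → ∀ {n} → Least P n → Least Q n
  least-⇔ f g (p , l) = f _ p , λ m q → l m (g m q)

  module _ {X : Set} {a : ℕ → X} where

    multiple-period : ∀ {t p} k → IsPeriodFrom a t p → ∀ i → t ≤ i → a (i + k * p) ≡ a i
    multiple-period zero (_ , per) i t≤i = cong a (ℕ.+-identityʳ i)
    multiple-period {t} {p} (suc k) P@(_ , per) i t≤i = begin
      a (i + (p + k * p))  ≡⟨ cong a (ℕ.+-assoc i p (k * p)) ⟨
      a (i + p + k * p)    ≡⟨ multiple-period k P (i + p) (ℕ.m≤n⇒m≤n+o p t≤i) ⟩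
      a (i + p)            ≡⟨ per i t≤i ⟩
      a i                  ∎
      where open ≡-Reasoning

    m≤n+m*k : ∀ n {m k} → 0 < k → m ≤ n + m * k
    m≤n+m*k n {m} {suc k} _ = ℕ.m≤n⇒m≤o+n n (ℕ.m≤m*n m (suc k))

    swap : ∀ i p q → i + p + q ≡ i + q + p
    swap i p q = trans (ℕ.+-assoc i p q) (trans (cong (i ℕ.+_) (ℕ.+-comm p q)) (sym (ℕ.+-assoc i q p)))

    -- Two eventual periods: far out, i and i + q may be replaced by i + n p and i + q + n p.
    earlier-period : ∀ {t n p q} → IsPeriodFrom a t p → IsPeriodFrom a n q → IsPeriodFrom a t q
    earlier-period {t} {n} {p} {q} P@(0<p , _) (0<q , per) = 0<q , λ i t≤i → begin
      a (i + q)             ≡⟨ multiple-period n P (i + q) (ℕ.m≤n⇒m≤n+o q t≤i) ⟨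
      a (i + q + n * p)     ≡⟨ cong a (swap i q (n * p)) ⟩
      a (i + n * p + q)     ≡⟨ per (i + n * p) (m≤n+m*k i 0<p) ⟩
      a (i + n * p)         ≡⟨ multiple-period n P i t≤i ⟩
      a i                   ∎
      where open ≡-Reasoning

    module _ (_≟_ : DecidableEquality X) where

      -- Only the indices below n are in doubt.
      periodic-start? : ∀ {n q} → IsPeriodFrom a n q → Decidable (λ t → IsPeriodFrom a t q)
      periodic-start? {n} {q} (0<q , per) t = map′ to from
        (ℕ.allUpTo? (λ j → (t ℕ.≤? j) →-dec (a (j + q) ≟ a j)) n)
        where
        to : (∀ {j} → j < n → t ≤ j → a (j + q) ≡ a j) → IsPeriodFrom a t q
        to h = 0<q , λ i t≤i → [ (λ i<n → h i<n t≤i) , per i ]′ (ℕ.<-≤-connex i n)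
        from : IsPeriodFrom a t q → ∀ {j} → j < n → t ≤ j → a (j + q) ≡ a j
        from (_ , per′) {j} _ = per′ j

      -- Both sides of the equation to be tested have period q, so one window of length q suffices.
      period? : ∀ {t q} → IsPeriodFrom a t q → Decidable (IsPeriodFrom a t)
      period? {t} {q@(suc _)} Q p = map′ to from
        ((0 ℕ.<? p) ×-dec (ℕ.allUpTo? (λ j → a (t + j + p) ≟ a (t + j)) q))
        where
        reduce : ∀ r k → a (t + (r + k * q) + p) ≡ a (t + r + p) × a (t + (r + k * q)) ≡ a (t + r)
        reduce r k = trans (cong a (trans (cong (_+ p) (sym (ℕ.+-assoc t r (k * q)))) (swap (t + r) (k * q) p)))
                       (multiple-period k Q (t + r + p) (ℕ.m≤n⇒m≤n+o p (ℕ.m≤m+n t r)))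
                   , trans (cong a (sym (ℕ.+-assoc t r (k * q)))) (multiple-period k Q (t + r) (ℕ.m≤m+n t r))
        to : 0 < p × (∀ {j} → j < q → a (t + j + p) ≡ a (t + j)) → IsPeriodFrom a t p
        to (0<p , h) = 0<p , λ i t≤i → subst (λ i → a (i + p) ≡ a i) (ℕ.m+[n∸m]≡n t≤i) (at (i ∸ t))
          where
          at : ∀ k → a (t + k + p) ≡ a (t + k)
          at k = subst (λ k → a (t + k + p) ≡ a (t + k)) (sym (m≡m%n+[m/n]*n k q))
            (trans (proj₁ (reduce (k % q) (k / q)))
              (trans (h (m%n<n k q)) (sym (proj₂ (reduce (k % q) (k / q))))))
        from : IsPeriodFrom a t p → 0 < p × (∀ {j} → j < q → a (t + j + p) ≡ a (t + j))
        from (0<p , per) = 0<p , λ {j} _ → per (t + j) (ℕ.m≤m+n t j)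
      period? {t} {zero} (() , _)

      -- By `earlier-period`, a start of any period is a start of the known period q. This removes
      -- the existential quantifier and makes the search decidable.
      least-start : ∀ {n q} → IsPeriodFrom a n q → ∃[ t ] Least (λ t′ → ∃[ p′ ] IsPeriodFrom a t′ p′) t
      least-start {n} {q} Q =
        let t , l = least (periodic-start? Q) Q
        in t , least-⇔ (λ _ P → q , P) (λ _ (_ , P) → earlier-period P Q) l

      least-even-period : ∀ {t q} → 2 ∣ q → IsPeriodFrom a t q →
        ∃[ p ] Least (λ p′ → 2 ∣ p′ × IsPeriodFrom a t p′) p
      least-even-period even Q = least (λ p → (2 ∣? p) ×-dec period? Q p) (even , Q)

  parity-cong : ∀ {i j} → i % 2 ≡ j % 2 → parity i ≡ parity j
  parity-cong {i} {j} eq with i % 2 | j % 2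
  parity-cong refl | zero  | _ = refl
  parity-cong refl | suc _ | _ = refl

  parity-+even : ∀ i {p} → 2 ∣ p → parity (i + p) ≡ parity i
  parity-+even i {p} even = parity-cong {i + p} {i} (%-remove-+ʳ i even)

  opposite-involutive : ∀ x → opposite (opposite x) ≡ x
  opposite-involutive L = refl
  opposite-involutive R = refl

  opposite-≢ : ∀ x → opposite x ≢ x
  opposite-≢ L ()
  opposite-≢ R ()

  parity-suc : ∀ i → parity (suc i) ≡ opposite (parity i)
  parity-suc zero    = refl
  parity-suc (suc i) = trans (sym (opposite-involutive (parity i)))
    (cong opposite (sym (parity-suc i)))

  applyUpTo-+ : ∀ {X : Set} (f : ℕ → X) m n → applyUpTo f (m + n) ≡ applyUpTo f m ++ applyUpTo (f ∘ (m ℕ.+_)) n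
  applyUpTo-+ f zero    n = refl
  applyUpTo-+ f (suc m) n = cong (f 0 ∷_) (applyUpTo-+ (f ∘ suc) m n)

  applyUpTo-constant : ∀ {X : Set} (f : ℕ → X) {c} n → (∀ d → d < n → f d ≡ c) → applyUpTo f n ≡ replicate n c
  applyUpTo-constant f zero    h = refl
  applyUpTo-constant f (suc n) h =
    cong₂ _∷_ (h 0 (s≤s z≤n)) (applyUpTo-constant (f ∘ suc) n (λ d d<n → h (suc d) (s≤s d<n)))

  module Runs (b : ℕ → ℕ) (l : ℕ → Turn) (x : ℕ → Turn)
              (positive : ∀ i → 0 < b i) (alternating : ∀ i → l (suc i) ≡ opposite (l i)) where

    start : ℕ → ℕ
    start zero    = 0
    start (suc i) = start i + b i

    module _ (coded : ∀ i d → d < b i → x (start i + d) ≡ l i) where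

      word : ∀ c → concatMap (λ i → replicate (b i) (l i)) (applyUpTo id c) ≡ applyUpTo x (start c)
      word zero    = refl
      word (suc c) = begin
        concatMap f (applyUpTo id (suc c))               ≡⟨ cong (concatMap f) (List.applyUpTo-∷ʳ id c) ⟨
        concatMap f (applyUpTo id c ∷ʳ c)                ≡⟨ List.concatMap-++ f (applyUpTo id c) (c ∷ []) ⟩
        concatMap f (applyUpTo id c) ++ (f c ++ [])      ≡⟨ cong₂ _++_ (word c) (List.++-identityʳ (f c)) ⟩
        applyUpTo x (start c) ++ f c                     ≡⟨ cong (applyUpTo x (start c) ++_)
                                                              (applyUpTo-constant (x ∘ (start c ℕ.+_)) (b c) (coded c)) ⟨
        applyUpTo x (start c) ++ applyUpTo (x ∘ (start c ℕ.+_)) (b c) ≡⟨ applyUpTo-+ x (start c) (b c) ⟨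
        applyUpTo x (start c + b c)                      ∎
        where
        open ≡-Reasoning
        f = λ i → replicate (b i) (l i)

      first : ∀ i → x (start i) ≡ l i
      first i = trans (cong x (sym (ℕ.+-identityʳ (start i)))) (coded i 0 (positive i))

      start-mono : ∀ {i j} → i ≤ j → start i ≤ start j
      start-mono {i} {j} i≤j = subst (λ j → start i ≤ start j) (ℕ.m+[n∸m]≡n i≤j) (go (j ∸ i))
        where
        go : ∀ k → start i ≤ start (i + k)
        go zero    = ℕ.≤-reflexive (cong start (sym (ℕ.+-identityʳ i)))
        go (suc k) = ℕ.≤-trans (go k) (subst (λ j → start (i + k) ≤ start j) (sym (ℕ.+-suc i k)) (ℕ.m≤m+n _ _))

      i≤start : ∀ i → i ≤ start i
      i≤start zero    = z≤n
      i≤start (suc i) = subst (_≤ start i + b i) (ℕ.+-comm i 1) (ℕ.+-mono-≤ (i≤start i) (positive i))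

      locate : ∀ n → ∃[ i ] ∃[ d ] (d < b i × n ≡ start i + d)
      locate zero    = 0 , 0 , positive 0 , refl
      locate (suc n) with locate n
      ... | i , d , d<b , refl with ℕ.m≤n⇒m<n∨m≡n d<b
      ...   | inj₁ 1+d<b = i , suc d , 1+d<b , sym (ℕ.+-suc (start i) d)
      ...   | inj₂ 1+d≡b = suc i , 0 , positive (suc i) ,
              trans (sym (ℕ.+-suc (start i) d)) (trans (cong (start i ℕ.+_) 1+d≡b) (sym (ℕ.+-identityʳ _)))

      parity-of-l : ∀ c → 2 ∣ c ⊎ l c ≡ opposite (l 0)
      parity-of-l 0 = inj₁ (divides 0 refl)
      parity-of-l 1 = inj₂ (alternating 0)
      parity-of-l (suc (suc c)) with parity-of-l c
      ... | inj₁ (divides k eq) = inj₁ (divides (suc k) (cong (2 ℕ.+_) eq))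
      ... | inj₂ eq = inj₂ (trans (alternating (suc c)) (trans (cong opposite (alternating c))
              (trans (opposite-involutive (l c)) eq)))

      even⇒same : ∀ {c} → 2 ∣ c → ∀ i → l (c + i) ≡ l i
      even⇒same (divides k refl) i = go k
        where
        go : ∀ k → l (k * 2 + i) ≡ l i
        go zero    = refl
        go (suc k) = trans (alternating _) (trans (cong opposite (alternating _)) (trans (opposite-involutive _) (go k)))

      module _ {p : ℕ} (0<p : 0 < p) (even : 2 ∣ p) (b-periodic : ∀ i → b (p + i) ≡ b i) where

        start-+ : ∀ i → start (p + i) ≡ start p + start i
        start-+ zero    = trans (cong start (ℕ.+-identityʳ p)) (sym (ℕ.+-identityʳ _))
        start-+ (suc i) = trans (cong start (ℕ.+-suc p i))
          (trans (cong₂ _+_ (start-+ i) (b-periodic i)) (ℕ.+-assoc (start p) (start i) (b i)))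

        x-periodic : ∀ n → x (start p + n) ≡ x n
        x-periodic n with locate n
        ... | i , d , d<b , refl = begin
          x (start p + (start i + d))   ≡⟨ cong x (ℕ.+-assoc (start p) (start i) d) ⟨
          x (start p + start i + d)     ≡⟨ cong (λ m → x (m + d)) (start-+ i) ⟨
          x (start (p + i) + d)         ≡⟨ coded (p + i) d (subst (d <_) (sym (b-periodic i)) d<b) ⟩
          l (p + i)                     ≡⟨ even⇒same even i ⟩
          l i                           ≡⟨ coded i d d<b ⟨
          x (start i + d)               ∎
          where open ≡-Reasoning

      -- A period of x at which a run starts permutes the runs.
      module _ {c : ℕ} (even : 2 ∣ c) (per : ∀ n → x (start c + n) ≡ x n) where

        private
          next-run : ∀ i → x (start i + b i) ≡ opposite (l i)
          next-run i = trans (first (suc i)) (alternating i)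

          equal-runs : ∀ i → start (c + i) ≡ start c + start i → b (c + i) ≡ b i
          equal-runs i eq with ℕ.<-cmp (b (c + i)) (b i)
          ... | tri≈ _ e _ = e
          -- At the end of the shorter run the letter changes in one of the two places and not in
          -- the other, although `per` identifies them.
          ... | tri< b< _ _ = contradiction
            (trans (sym (coded i (b (c + i)) b<)) (trans (sym (per (start i + b (c + i))))
              (trans (cong x (trans (sym (ℕ.+-assoc (start c) (start i) (b (c + i)))) (cong (_+ b (c + i)) (sym eq))))
                (trans (next-run (c + i)) (cong opposite (even⇒same even i))))))
            (λ e → opposite-≢ (l i) (sym e))
          ... | tri> _ _ b> = contradiction
            (trans (sym (next-run i)) (trans (sym (per (start i + b i)))
              (trans (cong x (trans (sym (ℕ.+-assoc (start c) (start i) (b i))) (cong (_+ b i) (sym eq))))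
                (trans (coded (c + i) (b i) b>) (even⇒same even i)))))
            (opposite-≢ (l i))

          shifted : ∀ i → start (c + i) ≡ start c + start i
          shifted zero    = trans (cong start (ℕ.+-identityʳ c)) (sym (ℕ.+-identityʳ _))
          shifted (suc i) = trans (cong start (ℕ.+-suc c i))
            (trans (cong₂ _+_ (shifted i) (equal-runs i (shifted i))) (ℕ.+-assoc (start c) (start i) (b i)))

        b-period : ∀ i → b (c + i) ≡ b i
        b-period i = equal-runs i (shifted i)

      -- A period n of x is the start of a run, since x changes its letter at n
      -- as it does at the period start p.
      period⇒run : ∀ {p} → 0 < p → 2 ∣ p → (∀ n → x (start p + n) ≡ x n) →
        ∀ {n} → 0 < n → (∀ k → x (n + k) ≡ x k) →
        ∃[ c ] (0 < c × n ≡ start c × 2 ∣ c × (∀ i → b (c + i) ≡ b i))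
      period⇒run {suc p} _ even per {n} 0<n per′ with locate n
      ... | c , suc d , d<b , refl = contradiction same (opposite-≢ (l p))
        where
        -- `start p + e` is the last index before the period `start (suc p)`; it stands in for the
        -- index -1, since `x` is indexed by natural numbers.
        e = ℕ.pred (b p)
        b≡ : suc e ≡ b p
        b≡ = ℕ.suc-pred (b p) {{ℕ.>-nonZero (positive p)}}
        sums : start c + suc d + (start p + e) ≡ start (suc p) + (start c + d)
        sums = trans (eq (start c) d (start p) e) (cong (λ b′ → start p + b′ + (start c + d)) b≡)
          where
          eq : ∀ s d s′ e → s + suc d + (s′ + e) ≡ s′ + suc e + (s + d)
          eq = solveℕ-∀
        same : opposite (l p) ≡ l p
        same = begin
          opposite (l p)                    ≡⟨ alternating p ⟨
          l (suc p)                         ≡⟨ cong l (ℕ.+-identityʳ (suc p)) ⟨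
          l (suc p + 0)                     ≡⟨ even⇒same even 0 ⟩
          l 0                               ≡⟨ first 0 ⟨
          x 0                               ≡⟨ per′ 0 ⟨
          x (start c + suc d + 0)           ≡⟨ cong x (ℕ.+-identityʳ (start c + suc d)) ⟩
          x (start c + suc d)               ≡⟨ coded c (suc d) d<b ⟩
          l c                               ≡⟨ coded c d (ℕ.<-trans (ℕ.n<1+n d) d<b) ⟨
          x (start c + d)                   ≡⟨ per (start c + d) ⟨
          x (start (suc p) + (start c + d)) ≡⟨ cong x sums ⟨
          x (start c + suc d + (start p + e)) ≡⟨ per′ (start p + e) ⟩
          x (start p + e)                   ≡⟨ coded p e (ℕ.≤-reflexive b≡) ⟩
          l p                               ∎
          where open ≡-Reasoning
      ... | c , zero , _ , refl = c , 0<c c 0<n , ℕ.+-identityʳ (start c) , even-c ,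
          b-period even-c (λ n → trans (cong (λ m → x (m + n)) (sym (ℕ.+-identityʳ (start c)))) (per′ n))
        where
        0<c : ∀ c → 0 < start c + 0 → 0 < c
        0<c (suc c) _ = s≤s z≤n
        l-same : l c ≡ l 0
        l-same = trans (sym (coded c 0 (positive c)))
          (trans (cong x (sym (ℕ.+-identityʳ (start c + 0)))) (trans (per′ 0) (first 0)))
        even-c : 2 ∣ c
        even-c = [ id , (λ eq → contradiction (trans (sym eq) l-same) (opposite-≢ (l 0))) ]′ (parity-of-l c)

-- Reduced forms along the river

ℤ-induction : (P : ℤ → Set) → P 0ℤ → (∀ i → P i → P (i ℤ.+ 1ℤ)) → (∀ i → P (i ℤ.+ 1ℤ) → P i) → ∀ i → P i
ℤ-induction P z up down (+ n) = go n
  where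
  go : ∀ n → P (+ n)
  go zero    = z
  go (suc n) = subst (λ m → P (+ m)) (ℕ.+-comm n 1) (up (+ n) (go n))
ℤ-induction P z up down -[1+ n ] = go n
  where
  go : ∀ n → P -[1+ n ]
  go zero    = down -[1+ 0 ] z
  go (suc n) = down -[1+ suc n ] (go n)

iterate-+ : {X : Set} (f : X → X) → ∀ m n x → iterate f (m ℕ.+ n) x ≡ iterate f m (iterate f n x)
iterate-+ f zero    n x = refl
iterate-+ f (suc m) n x = cong f (iterate-+ f m n x)

-- The form on the river edge where a run of the given turn begins, for a reduced `f`. A right turn
-- of the reciprocal is the reciprocal of a left turn, so runs of both kinds obey one formula.
oriented : Turn → Form → Form
oriented L f = f
oriented R f = reciprocal f

reciprocal-involutive : ∀ f → reciprocal (reciprocal f) ≡ f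
reciprocal-involutive f =
  form-≡ (ℤ.neg-involutive (A f)) (ℤ.neg-involutive (B f)) (ℤ.neg-involutive (C f))

turned-oriented : ∀ x f → turned x (oriented x f) ≡ oriented x (turnL f)
turned-oriented L f = refl
turned-oriented R f = form-≡ (eqA (A f) (B f) (C f)) (eqB (B f) (A f)) refl
  where
  open import Data.Integer.Base using (_+_; _*_; -_)
  eqA : ∀ a b c → - c + - b + - a ≡ - (a + b + c)
  eqA = solve-∀
  eqB : ∀ b a → - b + + 2 * - a ≡ - (b + + 2 * a)
  eqB = solve-∀

oriented-opposite : ∀ x f → oriented (opposite x) (reciprocal f) ≡ oriented x f
oriented-opposite L f = reciprocal-involutive f
oriented-opposite R f = refl

turnL-injective : ∀ f g → turnL f ≡ turnL g → f ≡ g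
turnL-injective f g eq = trans (sym (undo f)) (trans (cong unturnL eq) (undo g))
  where
  open import Data.Integer.Base using (_+_; _*_; -_)
  unturnL : Form → Form
  unturnL f = [ A f , B f + - (+ 2 * A f) , C f + - (B f) + A f ]
  undo : ∀ f → unturnL (turnL f) ≡ f
  undo f = form-≡ refl (eqB (A f) (B f)) (eqC (A f) (B f) (C f))
    where
    eqB : ∀ a b → b + + 2 * a + - (+ 2 * a) ≡ b
    eqB = solve-∀
    eqC : ∀ a b c → a + b + c + - (b + + 2 * a) + a ≡ c
    eqC = solve-∀

turned-injective : ∀ x f g → turned x f ≡ turned x g → f ≡ g
turned-injective L f g eq = turnL-injective f g eq
turned-injective R f g eq = trans (sym (reciprocal-involutive f)) (trans (cong reciprocal
  (turnL-injective (reciprocal f) (reciprocal g)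
    (trans (sym (via f)) (trans (cong reciprocal eq) (via g))))) (reciprocal-involutive g))
  where
  via : ∀ f → reciprocal (turnR f) ≡ turnL (reciprocal f)
  via f = trans (cong (λ g → reciprocal (turnR g)) (sym (reciprocal-involutive f)))
    (trans (cong reciprocal (turned-oriented R (reciprocal f))) (reciprocal-involutive _))

unfollow : Turn → OrientedEdge → OrientedEdge
unfollow L e = bar (ccw e)
unfollow R e = bar (cw e)

follow-unfollow : ∀ x e → follow x (unfollow x e) ≡ e
follow-unfollow L e = trans (cong cw (bar-involutive (ccw e))) (ccw³ e)
follow-unfollow R e = trans (cong ccw (bar-involutive (cw e))) (ccw³ e)

-- One edge of the river: the additive version of the algorithm. A Gauss step is a whole run of slow
-- steps.
slowStep : Form → Form
slowStep f = turned (riverTurn f) f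

module _ (D : ℤ) (ns : NotSquare D) (s : ℤ) (s≥0 : 0ℤ ℤ.≤ s)
         (s²≤D : s ℤ.* s ℤ.≤ D) (D<s⁺² : 1ℤ ℤ.+ D ℤ.≤ (1ℤ ℤ.+ s) ℤ.* (1ℤ ℤ.+ s)) where
  open Reduction D ns s s≥0 s²≤D D<s⁺²

  oriented-river : ∀ x f → Reduced f → Splits (oriented x f) × Pos (A (oriented x f))
  oriented-river L f r = reduced⇒splits r , Reduced.A-pos r
  oriented-river R f r = subst Pos (eq (A f) (C f)) (reduced⇒splits r) , Reduced.C-neg r
    where
    open import Data.Integer.Base using (_*_; -_)
    eq : ∀ a c → a * - c ≡ - c * - - a
    eq = solve-∀

  module _ (f : Form) (d : Disc f) (r : Reduced f) where

    private
      b = ℤ.∣ floor f ∣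
      open Reduced r

    floor-abs : + b ≡ floor f
    floor-abs = ℤ.0≤i⇒+∣i∣≡i (ℤ.≤-trans (ℤ.+≤+ ℕ.z≤n) (1≤floor-reduced f d r))

    0<floor : 0 ℕ.< b
    0<floor = ℤ.drop‿+≤+ (subst (1ℤ ℤ.≤_) (sym floor-abs) (1≤floor-reduced f d r))

    private
      C-neg-at : ∀ {n} → n ℕ.≤ b → Pos (ℤ.- C (translate (+ n) f))
      C-neg-at n≤b = translate-splits f d r (ℤ.+≤+ ℕ.z≤n) (subst (_ ℤ.≤_) floor-abs (ℤ.+≤+ n≤b))

    -- For the translated form, the region ahead carries f (n + 1 , 1), which is negative as long as
    -- n + 1 does not exceed the floor of the root.
    run-turn : ∀ x {n} → n ℕ.< b → riverTurn (oriented x (translate (+ n) f)) ≡ x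
    run-turn x {n} n<b = at x
      where
      g = translate (+ n) f
      total-neg′ : Pos (ℤ.- total g)
      total-neg′ = subst (λ h → Pos (ℤ.- C h))
        (trans (cong (λ m → translate (+ m) f) (ℕ.+-comm 1 n)) (translate-suc (+ n) f)) (C-neg-at n<b)
      eq : ∀ a b c → ℤ.- (a ℤ.+ b ℤ.+ c) ≡ ℤ.- c ℤ.+ ℤ.- b ℤ.+ ℤ.- a
      eq = solve-∀
      at : ∀ x → riverTurn (oriented x g) ≡ x
      at L = riverTurn-L g (pos* A-pos total-neg′)
      at R = riverTurn-R (reciprocal g) (pos* (C-neg-at (ℕ.<⇒≤ n<b))
        (subst Pos (eq (A g) (B g) (C g)) total-neg′))

    run-form : ∀ x {n} → n ℕ.≤ b → iterate slowStep n (oriented x f) ≡ oriented x (translate (+ n) f)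
    run-form x {zero}  _   = cong (oriented x) (sym (translate-0 f))
    run-form x {suc n} n<b = begin
      slowStep (iterate slowStep n (oriented x f))   ≡⟨ cong slowStep (run-form x (ℕ.<⇒≤ n<b)) ⟩
      slowStep (oriented x g)                        ≡⟨ cong (λ y → turned y (oriented x g)) (run-turn x n<b) ⟩
      turned x (oriented x g)                        ≡⟨ turned-oriented x g ⟩
      oriented x (turnL g)                           ≡⟨ cong (oriented x) (translate-suc (+ n) f) ⟨
      oriented x (translate (+ n ℤ.+ 1ℤ) f)          ≡⟨ cong (λ m → oriented x (translate (+ m) f)) (ℕ.+-comm n 1) ⟩
      oriented x (translate (+ suc n) f)             ∎
      where
      open ≡-Reasoning
      g = translate (+ n) f

  -- Finiteness of the set of reduced forms

  private
    bounded : ∀ b {x y} → Pos x → Pos y → b ℤ.* b ℤ.+ + 4 ℤ.* x ℤ.* y ≡ D → ℤ.∣ x ∣ ℕ.< suc ℤ.∣ D ∣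
    bounded b {x} {y} p q eq = ℕ.s≤s (abs-≤ (ℤ.<⇒≤ p) (linear x D
      (0≤+ (0≤x² b) (0≤+ (0≤+ xy (0≤+ xy xy)) (0≤* (ℤ.<⇒≤ p) (difference≥0 (ℤ.i<j⇒suc[i]≤j q)))))
      (trans (e b x y) (cong (ℤ._- x) eq))))
      where
      xy = 0≤* (ℤ.<⇒≤ p) (ℤ.<⇒≤ q)
      e : ∀ b x y → b ℤ.* b ℤ.+ (x ℤ.* y ℤ.+ (x ℤ.* y ℤ.+ x ℤ.* y) ℤ.+ x ℤ.* (y ℤ.- (+ 1 ℤ.+ + 0)))
          ≡ b ℤ.* b ℤ.+ + 4 ℤ.* x ℤ.* y ℤ.- x
      e = solve-∀
      abs-≤ : ∀ {x y} → 0ℤ ℤ.≤ x → x ℤ.≤ y → ℤ.∣ x ∣ ℕ.≤ ℤ.∣ y ∣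
      abs-≤ {+ m} {+ n} _ (ℤ.+≤+ p) = p

    module Bounds {f : Form} (d : Disc f) (r : Reduced f) where
      open Reduced r

      A< : ℤ.∣ A f ∣ ℕ.< suc ℤ.∣ D ∣
      A< = bounded (B f) A-pos C-neg (trans (e (A f) (B f) (C f)) d)
        where
        e : ∀ a b c → b ℤ.* b ℤ.+ + 4 ℤ.* a ℤ.* ℤ.- c ≡ b ℤ.* b ℤ.- + 4 ℤ.* a ℤ.* c
        e = solve-∀

      C< : ℤ.∣ ℤ.- C f ∣ ℕ.< suc ℤ.∣ D ∣
      C< = bounded (B f) C-neg A-pos (trans (e (A f) (B f) (C f)) d)
        where
        e : ∀ a b c → b ℤ.* b ℤ.+ + 4 ℤ.* ℤ.- c ℤ.* a ≡ b ℤ.* b ℤ.- + 4 ℤ.* a ℤ.* c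
        e = solve-∀

      total< : ℤ.∣ ℤ.- total f ∣ ℕ.< suc ℤ.∣ D ∣
      total< = bounded (B f ℤ.+ + 2 ℤ.* A f) total-neg A-pos (trans (e (A f) (B f) (C f)) d)
        where
        e : ∀ a b c → (b ℤ.+ + 2 ℤ.* a) ℤ.* (b ℤ.+ + 2 ℤ.* a) ℤ.+ + 4 ℤ.* ℤ.- (a ℤ.+ b ℤ.+ c) ℤ.* a
            ≡ b ℤ.* b ℤ.- + 4 ℤ.* a ℤ.* c
        e = solve-∀

    K : ℕ
    K = suc ℤ.∣ D ∣

    -- The three positive numbers A, - C and - (A + B + C) are bounded by D, as each is a factor in
    -- an identity D = b² + 4 x y with x and y positive. The middle coefficient, whose sign varies,
    -- is recovered from them.
    code : ∀ f → Disc f → Reduced f → Fin (K ℕ.* (K ℕ.* K))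
    code f d r = combine {K} {K ℕ.* K} (fromℕ< A<) (combine {K} {K} (fromℕ< C<) (fromℕ< total<))
      where open Bounds {f} d r

    abs-injective : ∀ {x y} → Pos x → Pos y → ℤ.∣ x ∣ ≡ ℤ.∣ y ∣ → x ≡ y
    abs-injective p q eq = trans (sym (ℤ.0≤i⇒+∣i∣≡i (ℤ.<⇒≤ p)))
      (trans (cong +_ eq) (ℤ.0≤i⇒+∣i∣≡i (ℤ.<⇒≤ q)))

    code-injective : ∀ f g (d : Disc f) (r : Reduced f) (d′ : Disc g) (r′ : Reduced g) →
      code f d r ≡ code g d′ r′ → f ≡ g
    code-injective f g d r d′ r′ eq = form-≡ A≡ B≡ C≡
      where
      module F = Bounds {f} d r
      module G = Bounds {g} d′ r′
      open Reduced
      split = Fin.combine-injective {K} {K ℕ.* K}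
        (fromℕ< F.A<) (combine {K} {K} (fromℕ< F.C<) (fromℕ< F.total<))
        (fromℕ< G.A<) (combine {K} {K} (fromℕ< G.C<) (fromℕ< G.total<)) eq
      split′ = Fin.combine-injective {K} {K} (fromℕ< F.C<) (fromℕ< F.total<) (fromℕ< G.C<) (fromℕ< G.total<) (proj₂ split)
      A≡ = abs-injective (A-pos r) (A-pos r′) (Fin.fromℕ<-injective _ _ F.A< G.A< (proj₁ split))
      C≡ = ℤ.neg-injective (abs-injective (C-neg r) (C-neg r′)
             (Fin.fromℕ<-injective _ _ F.C< G.C< (proj₁ split′)))
      total≡ = ℤ.neg-injective (abs-injective (total-neg r) (total-neg r′)
             (Fin.fromℕ<-injective _ _ F.total< G.total< (proj₂ split′)))
      B-of : ∀ a b c → b ≡ a ℤ.+ b ℤ.+ c ℤ.- a ℤ.- c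
      B-of = solve-∀
      B≡ : B f ≡ B g
      B≡ = trans (B-of (A f) (B f) (C f)) (trans
        (cong₂ ℤ._-_ (cong₂ ℤ._-_ total≡ A≡) C≡) (sym (B-of (A g) (B g) (C g))))

  module _ (q : Form) (d : Disc q) where

    private
      forms : ℕ → Form
      forms i = iterate gaussStep i q

    forms-disc : ∀ i → Disc (forms i)
    forms-disc = disc-iterate q d

    reduced-from : ∃[ n ] (∀ i → n ℕ.≤ i → Reduced (forms i))
    reduced-from =
      let n , r = reduces q d
      in n , λ i n≤i → subst Reduced
           (trans (sym (iterate-+ gaussStep (i ℕ.∸ n) n q)) (cong forms (ℕ.m∸n+n≡m n≤i)))
           (stays-reduced (forms n) (forms-disc n) r (i ℕ.∸ n))

    forms-periodic : ∃[ n ] ∃[ p ] (IsPeriodFrom forms n p × (∀ i → n ℕ.≤ i → Reduced (forms i)))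
    forms-periodic = from reduced-from
      where
      repeats : ∀ n p → 0 ℕ.< p → forms (n ℕ.+ p) ≡ forms n → IsPeriodFrom forms n p
      repeats n p 0<p eq = 0<p , λ i n≤i → begin
        forms (i ℕ.+ p)                            ≡⟨ cong (λ m → forms (m ℕ.+ p)) (ℕ.m∸n+n≡m n≤i) ⟨
        forms (i ℕ.∸ n ℕ.+ n ℕ.+ p)                ≡⟨ cong forms (ℕ.+-assoc (i ℕ.∸ n) n p) ⟩
        forms (i ℕ.∸ n ℕ.+ (n ℕ.+ p))              ≡⟨ iterate-+ gaussStep (i ℕ.∸ n) (n ℕ.+ p) q ⟩
        iterate gaussStep (i ℕ.∸ n) (forms (n ℕ.+ p)) ≡⟨ cong (iterate gaussStep (i ℕ.∸ n)) eq ⟩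
        iterate gaussStep (i ℕ.∸ n) (forms n)      ≡⟨ iterate-+ gaussStep (i ℕ.∸ n) n q ⟨
        forms (i ℕ.∸ n ℕ.+ n)                      ≡⟨ cong forms (ℕ.m∸n+n≡m n≤i) ⟩
        forms i                                    ∎
        where open ≡-Reasoning

      Result : Set
      Result = ∃[ n ] ∃[ p ] (IsPeriodFrom forms n p × (∀ i → n ℕ.≤ i → Reduced (forms i)))

      collide : ∀ n → (∀ i → n ℕ.≤ i → Reduced (forms i)) → ∀ i j → i ℕ.< j →
        forms (n ℕ.+ i) ≡ forms (n ℕ.+ j) → Result
      collide n red i j i<j eq = n ℕ.+ i , j ℕ.∸ i
        , repeats (n ℕ.+ i) (j ℕ.∸ i) (ℕ.m<n⇒0<n∸m i<j)
            (trans (cong forms (trans (ℕ.+-assoc n i _) (cong (n ℕ.+_) (ℕ.m+[n∸m]≡n (ℕ.<⇒≤ i<j))))) (sym eq))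
        , λ k n+i≤k → red k (ℕ.≤-trans (ℕ.m≤m+n n i) n+i≤k)

      from : ∃[ n ] (∀ i → n ℕ.≤ i → Reduced (forms i)) → Result
      from (n , red) = from-collision (Fin.pigeonhole ℕ.≤-refl code-at)
        where
        N = suc (K ℕ.* (K ℕ.* K))
        reduced-at : (i : Fin N) → Reduced (forms (n ℕ.+ toℕ i))
        reduced-at i = red (n ℕ.+ toℕ i) (ℕ.m≤m+n n (toℕ i))
        code-at : Fin N → Fin (K ℕ.* (K ℕ.* K))
        code-at i = code (forms (n ℕ.+ toℕ i)) (forms-disc (n ℕ.+ toℕ i)) (reduced-at i)
        from-collision : ∃[ i ] ∃[ j ] (i Fin.< j × code-at i ≡ code-at j) → Result
        from-collision (i , j , i<j , eq) = collide n red (toℕ i) (toℕ j) i<j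
          (code-injective (forms (n ℕ.+ toℕ i)) (forms (n ℕ.+ toℕ j)) (forms-disc (n ℕ.+ toℕ i))
            (reduced-at i) (forms-disc (n ℕ.+ toℕ j)) (reduced-at j) eq)

    module _ (𝕋 : Topograph q) where
      open Topograph 𝕋

      -- Partial quotients met before the forms are reduced may be negative, so the walk is extended
      -- in both directions.
      edge-translated : ∀ x f e → form e ≡ oriented x f → ∀ a → ∃[ e′ ] form e′ ≡ oriented x (translate a f)
      edge-translated x f e eq = ℤ-induction (λ a → ∃[ e′ ] form e′ ≡ oriented x (translate a f))
        (e , trans eq (cong (oriented x) (sym (translate-0 f))))
        (λ a (e′ , eq′) → follow x e′ , (begin
          form (follow x e′)                       ≡⟨ form-followed 𝕋 x e′ ⟩
          turned x (form e′)                       ≡⟨ cong (turned x) eq′ ⟩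
          turned x (oriented x (translate a f))    ≡⟨ one a ⟩
          oriented x (translate (a ℤ.+ 1ℤ) f)      ∎))
        (λ a (e′ , eq′) → unfollow x e′ , turned-injective x _ _ (begin
          turned x (form (unfollow x e′))          ≡⟨ form-followed 𝕋 x (unfollow x e′) ⟨
          form (follow x (unfollow x e′))          ≡⟨ cong form (follow-unfollow x e′) ⟩
          form e′                                  ≡⟨ eq′ ⟩
          oriented x (translate (a ℤ.+ 1ℤ) f)      ≡⟨ one a ⟨
          turned x (oriented x (translate a f))    ∎))
        where
        open ≡-Reasoning
        one : ∀ a → turned x (oriented x (translate a f)) ≡ oriented x (translate (a ℤ.+ 1ℤ) f)
        one a = trans (turned-oriented x (translate a f)) (cong (oriented x) (sym (translate-suc a f)))

      -- The change of parity cancels the `reciprocal` in `gaussStep`: the edge that ends one run is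
      -- the edge that begins the next, with the other turn.
      next-oriented : ∀ i → oriented (parity (suc i)) (forms (suc i))
                          ≡ oriented (parity i) (translate (floor (forms i)) (forms i))
      next-oriented i = trans (cong (λ x → oriented x (forms (suc i))) (parity-suc i))
        (oriented-opposite (parity i) (translate (floor (forms i)) (forms i)))

      edge-at : ∀ i → ∃[ e ] form e ≡ oriented (parity i) (forms i)
      edge-at zero    = base , form-base
      edge-at (suc i) =
        let e , eq = edge-at i
            e′ , eq′ = edge-translated (parity i) (forms i) e eq (floor (forms i))
        in e′ , trans eq′ (sym (next-oriented i))

-- The river sequence

-- Edge 0 of the river is chosen such that the computed sequence is read from there. That both
-- letters occur makes the initial sets of the procedure nonempty.
record RiverData {q : Form} (𝕋 : Topograph q) : Set where
  field
    r        : List Turn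
    computed : IsComputedRiverSequence q r
    ρ        : River 𝕋
    θ        : RiverTranslation ρ
    period≡  : RiverTranslation.period θ ≡ length r
    letter   : ∀ u → lookup r u ≡ River.turn ρ (+ toℕ u)
    occurs   : ∀ x → ∃[ u ] lookup r u ≡ x

integralSqrt : ∀ D → Pos D → ∃[ s ] (0ℤ ℤ.≤ s × s ℤ.* s ℤ.≤ D × 1ℤ ℤ.+ D ℤ.≤ (1ℤ ℤ.+ s) ℤ.* (1ℤ ℤ.+ s))
integralSqrt (+ n) _ =
  let s , lo , hi = floorSqrt n
  in + s , ℤ.+≤+ ℕ.z≤n , subst (ℤ._≤ + n) (ℤ.pos-* s s) (ℤ.+≤+ lo)
     , subst (+ suc n ℤ.≤_) (ℤ.pos-* (suc s) (suc s)) (ℤ.+≤+ hi)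

module _ {q : Form} {𝕋 : Topograph q} (ρ : River 𝕋) where
  open River ρ

  translation : ∀ {m} → Least (IsPeriod turn) m → RiverTranslation ρ
  translation {m} l@((_ , per) , _) = record
    { τ           = τ
    ; period      = m
    ; leastPeriod = l
    ; translates  = ℤ-induction (λ i → PlanarIso.to τ (edge i) ≡ edge (i ℤ.+ + m))
        (moving-moves (edge 0ℤ) (edge (+ m)))
        (λ i eq → trans (cong (PlanarIso.to τ) (next i)) (trans (to-follow τ (turn i) (edge i))
          (trans (cong (follow (turn i)) eq) (sym (shifted i)))))
        (λ i eq → follow-injective (turn i) (trans (sym (to-follow τ (turn i) (edge i)))
          (trans (cong (PlanarIso.to τ) (sym (next i))) (trans eq (shifted i)))))
    }
    where
    τ = moving (edge 0ℤ) (edge (+ m))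
    shifted : ∀ i → edge (i ℤ.+ 1ℤ ℤ.+ + m) ≡ follow (turn i) (edge (i ℤ.+ + m))
    shifted i = begin
      edge (i ℤ.+ 1ℤ ℤ.+ + m)                       ≡⟨ cong edge (eq i (+ m)) ⟩
      edge (i ℤ.+ + m ℤ.+ 1ℤ)                       ≡⟨ next (i ℤ.+ + m) ⟩
      follow (turn (i ℤ.+ + m)) (edge (i ℤ.+ + m))  ≡⟨ cong (λ x → follow x (edge (i ℤ.+ + m))) (per i) ⟩
      follow (turn i) (edge (i ℤ.+ + m))            ∎
      where
      open ≡-Reasoning
      eq : ∀ i m → i ℤ.+ (+ 1 ℤ.+ + 0) ℤ.+ m ≡ i ℤ.+ m ℤ.+ (+ 1 ℤ.+ + 0)
      eq = solve-∀

-- A known period k of the whole sequence carries any index i to a natural one, by |i| steps; there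
-- the one-sided hypothesis on m applies. It is needed because the runs describe only the downstream
-- half.
extend-period : ∀ {X : Set} (x : ℤ → X) {m k} → 0 ℕ.< k → (∀ i → x (i ℤ.+ + k) ≡ x i) →
  (∀ n → x (+ (m ℕ.+ n)) ≡ x (+ n)) → ∀ i → x (i ℤ.+ + m) ≡ x i
extend-period x {m} {suc k} _ per h i = begin
  x (i ℤ.+ + m)                        ≡⟨ multiple ℤ.∣ i ∣ (i ℤ.+ + m) ⟨
  x (i ℤ.+ + m ℤ.+ + (ℤ.∣ i ∣ ℕ.* suc k)) ≡⟨ cong x (eq i (+ m) (+ (ℤ.∣ i ∣ ℕ.* suc k))) ⟩
  x (+ m ℤ.+ (i ℤ.+ + (ℤ.∣ i ∣ ℕ.* suc k)))  ≡⟨ cong (λ j → x (+ m ℤ.+ j)) (proj₂ (natural i)) ⟩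
  x (+ (m ℕ.+ proj₁ (natural i)))      ≡⟨ h (proj₁ (natural i)) ⟩
  x (+ proj₁ (natural i))              ≡⟨ cong x (proj₂ (natural i)) ⟨
  x (i ℤ.+ + (ℤ.∣ i ∣ ℕ.* suc k))      ≡⟨ multiple ℤ.∣ i ∣ i ⟩
  x i                                  ∎
  where
  open ≡-Reasoning
  eq : ∀ i m j → i ℤ.+ m ℤ.+ j ≡ m ℤ.+ (i ℤ.+ j)
  eq = solve-∀
  multiple : ∀ n i → x (i ℤ.+ + (n ℕ.* suc k)) ≡ x i
  multiple zero    i = cong x (ℤ.+-identityʳ i)
  multiple (suc n) i = trans (cong x (sym (ℤ.+-assoc i (+ suc k) (+ (n ℕ.* suc k)))))
    (trans (multiple n (i ℤ.+ + suc k)) (per i))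
  natural : ∀ i → ∃[ n ] i ℤ.+ + (ℤ.∣ i ∣ ℕ.* suc k) ≡ + n
  natural (+ n)    = n ℕ.+ n ℕ.* suc k , refl
  natural -[1+ n ] = suc n ℕ.* suc k ℕ.∸ suc n , ℤ.⊖-≥ (ℕ.m≤m*n (suc n) (suc k))

module _ (q : Form) (ns : NotSquare (disc q)) (s : ℤ) (s≥0 : 0ℤ ℤ.≤ s)
         (s²≤D : s ℤ.* s ℤ.≤ disc q) (D<s⁺² : 1ℤ ℤ.+ disc q ℤ.≤ (1ℤ ℤ.+ s) ℤ.* (1ℤ ℤ.+ s))
         (𝕋 : Topograph q) where
  private
    D = disc q
    open Reduction D ns s s≥0 s²≤D D<s⁺²
    open Expansion D ns s s≥0 s²≤D D<s⁺²
    open Topograph 𝕋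

    g : ℕ → Form
    g i = iterate gaussStep i q

    a : ℕ → ℤ
    a i = floor (g i)

    g-disc : ∀ i → Disc (g i)
    g-disc = disc-iterate q refl

    h : ℕ → Form
    h i = oriented (parity i) (g i)

  module _ {n Q} (g-period : IsPeriodFrom g n Q) (even-Q : 2 ∣ Q) (red : ∀ i → n ℕ.≤ i → Reduced (g i))
           {t} (lt : Least (λ t′ → ∃[ p′ ] IsPeriodFrom a t′ p′) t)
           {p} (lp : Least (λ p′ → 2 ∣ p′ × IsPeriodFrom a t p′) p) where
    private
      even-p : 2 ∣ p
      even-p = proj₁ (proj₁ lp)

      a-period : IsPeriodFrom a t p
      a-period = proj₂ (proj₁ lp)

      0<p : 0 ℕ.< p
      0<p = proj₁ a-period

      -- At least n, since p is positive, so that the forms from here on are reduced; and t plus a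
      -- multiple of the even period p, so that quotients and parities are those from t on.
      M : ℕ
      M = t ℕ.+ n ℕ.* p

      n≤M : ∀ i → n ℕ.≤ M ℕ.+ i
      n≤M i = ℕ.m≤n⇒m≤n+o i (m≤n+m*k {a = a} t 0<p)

      b : ℕ → ℕ
      b i = ℤ.∣ a (M ℕ.+ i) ∣

      l : ℕ → Turn
      l i = parity (M ℕ.+ i)

      a≡b : ∀ i → + b i ≡ a (M ℕ.+ i)
      a≡b i = floor-abs D ns s s≥0 s²≤D D<s⁺² (g (M ℕ.+ i)) (g-disc (M ℕ.+ i)) (red _ (n≤M i))

      0<b : ∀ i → 0 ℕ.< b i
      0<b i = 0<floor D ns s s≥0 s²≤D D<s⁺² (g (M ℕ.+ i)) (g-disc (M ℕ.+ i)) (red _ (n≤M i))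

      l-alternates : ∀ i → l (suc i) ≡ opposite (l i)
      l-alternates i = trans (cong parity (ℕ.+-suc M i)) (parity-suc (M ℕ.+ i))

      swap′ : ∀ i → t ℕ.+ i ℕ.+ n ℕ.* p ≡ M ℕ.+ i
      swap′ i = swap {a = a} t i (n ℕ.* p)

      l-shift : ∀ i → l i ≡ parity (t ℕ.+ i)
      l-shift i = trans (cong parity (sym (swap′ i))) (parity-+even (t ℕ.+ i) (even-np n))
        where
        even-np : ∀ n → 2 ∣ n ℕ.* p
        even-np n = ∣n⇒∣m*n n even-p

      a-shift : ∀ i → a (M ℕ.+ i) ≡ a (t ℕ.+ i)
      a-shift i = trans (cong a (sym (swap′ i))) (multiple-period n a-period (t ℕ.+ i) (ℕ.m≤m+n t i))

    module _ (e₀ : OrientedEdge) (e₀-form : form e₀ ≡ h M) where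
      private
        open RiverFrom 𝕋 ns

        redM : Reduced (g M)
        redM = red M (subst (n ℕ.≤_) (ℕ.+-identityʳ M) (n≤M 0))

        d₀ : Down e₀
        d₀ = subst (λ f → Splits f × Pos (A f)) (sym e₀-form)
          (oriented-river D ns s s≥0 s²≤D D<s⁺² (parity M) (g M) redM)

        E : ℤ → OrientedEdge
        E = riverEdge e₀ d₀

        x : ℤ → Turn
        x i = turnAt (E i)

        F : ∀ k → form (E (+ k)) ≡ iterate slowStep k (h M)
        F zero    = e₀-form
        F (suc k) = trans (form-followed 𝕋 (turnAt (E (+ k))) (E (+ k))) (cong slowStep (F k))

        open Runs b l (x ∘ +_) 0<b l-alternates

        run-length : ∀ i → iterate slowStep (b i) (h (M ℕ.+ i)) ≡ h (M ℕ.+ suc i)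
        run-length i = begin
          iterate slowStep (b i) (h (M ℕ.+ i))
            ≡⟨ run-form D ns s s≥0 s²≤D D<s⁺² (g (M ℕ.+ i)) (g-disc (M ℕ.+ i)) (red _ (n≤M i)) (l i) ℕ.≤-refl ⟩
          oriented (l i) (translate (+ b i) (g (M ℕ.+ i)))
            ≡⟨ cong (λ c → oriented (l i) (translate c (g (M ℕ.+ i)))) (a≡b i) ⟩
          oriented (l i) (translate (a (M ℕ.+ i)) (g (M ℕ.+ i)))
            ≡⟨ next-oriented D ns s s≥0 s²≤D D<s⁺² q refl 𝕋 (M ℕ.+ i) ⟨
          h (suc (M ℕ.+ i))
            ≡⟨ cong h (ℕ.+-suc M i) ⟨
          h (M ℕ.+ suc i) ∎
          where open ≡-Reasoning

        starts : ∀ i → iterate slowStep (start i) (h M) ≡ h (M ℕ.+ i)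
        starts zero    = cong h (sym (ℕ.+-identityʳ M))
        starts (suc i) = begin
          iterate slowStep (start i ℕ.+ b i) (h M)        ≡⟨ cong (λ m → iterate slowStep m (h M)) (ℕ.+-comm (start i) (b i)) ⟩
          iterate slowStep (b i ℕ.+ start i) (h M)        ≡⟨ iterate-+ slowStep (b i) (start i) (h M) ⟩
          iterate slowStep (b i) (iterate slowStep (start i) (h M)) ≡⟨ cong (iterate slowStep (b i)) (starts i) ⟩
          iterate slowStep (b i) (h (M ℕ.+ i))            ≡⟨ run-length i ⟩
          h (M ℕ.+ suc i)                                 ∎
          where open ≡-Reasoning

        coded : ∀ i d → d ℕ.< b i → x (+ (start i ℕ.+ d)) ≡ l i
        coded i d d<b = trans (cong riverTurn (begin
          form (E (+ (start i ℕ.+ d)))                     ≡⟨ F (start i ℕ.+ d) ⟩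
          iterate slowStep (start i ℕ.+ d) (h M)           ≡⟨ cong (λ m → iterate slowStep m (h M)) (ℕ.+-comm (start i) d) ⟩
          iterate slowStep (d ℕ.+ start i) (h M)           ≡⟨ iterate-+ slowStep d (start i) (h M) ⟩
          iterate slowStep d (iterate slowStep (start i) (h M)) ≡⟨ cong (iterate slowStep d) (starts i) ⟩
          iterate slowStep d (h (M ℕ.+ i))
            ≡⟨ run-form D ns s s≥0 s²≤D D<s⁺² (g (M ℕ.+ i)) (g-disc (M ℕ.+ i)) (red _ (n≤M i)) (l i) (ℕ.<⇒≤ d<b) ⟩
          oriented (l i) (translate (+ d) (g (M ℕ.+ i)))   ∎))
          (run-turn D ns s s≥0 s²≤D D<s⁺² (g (M ℕ.+ i)) (g-disc (M ℕ.+ i)) (red _ (n≤M i)) (l i) d<b)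
          where open ≡-Reasoning

        returns : h (M ℕ.+ Q) ≡ h M
        returns = cong₂ oriented (parity-+even M even-Q)
          (proj₂ g-period M (subst (n ℕ.≤_) (ℕ.+-identityʳ M) (n≤M 0)))

        -- An even period Q of the forms is a period of the river in both directions, because a slow
        -- step is undone by a slow step between two reversals. The period p of the quotients so far
        -- concerns only the downstream turns.
        form-periodic : ∀ i → form (E (i ℤ.+ + start Q)) ≡ form (E i)
        form-periodic = ℤ-induction (λ i → form (E (i ℤ.+ + start Q)) ≡ form (E i))
          (trans (F (start Q)) (trans (starts Q) (trans returns (sym (F 0)))))
          (λ i eq → trans (cong (form ∘ E) (comm i (+ start Q)))
            (trans (up (i ℤ.+ + start Q)) (trans (cong slowStep eq) (sym (up i)))))
          (λ i eq → trans (down (i ℤ.+ + start Q))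
            (trans (cong (λ f → flipS (slowStep (flipS f))) (trans (cong (form ∘ E) (sym (comm i (+ start Q)))) eq))
              (sym (down i))))
          where
          comm : ∀ i m → i ℤ.+ (+ 1 ℤ.+ + 0) ℤ.+ m ≡ i ℤ.+ m ℤ.+ (+ 1 ℤ.+ + 0)
          comm = solve-∀
          next-form : ∀ e → form (nextEdge e) ≡ slowStep (form e)
          next-form e = form-followed 𝕋 (turnAt e) e
          up : ∀ i → form (E (i ℤ.+ 1ℤ)) ≡ slowStep (form (E i))
          up i = trans (cong form (riverEdge-next e₀ d₀ i)) (next-form (E i))
          down : ∀ i → form (E i) ≡ flipS (slowStep (flipS (form (E (i ℤ.+ 1ℤ)))))
          down i = trans (cong form (riverEdge-previous e₀ d₀ i))
            (trans (form-barred 𝕋 (nextEdge (bar (E (i ℤ.+ 1ℤ))))) (cong flipS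
              (trans (next-form (bar (E (i ℤ.+ 1ℤ)))) (cong slowStep (form-barred 𝕋 (E (i ℤ.+ 1ℤ)))))))

        m : ℕ
        m = start p

        0<start : ∀ {i} → 0 ℕ.< i → 0 ℕ.< start i
        0<start {i} 0<i = ℕ.<-≤-trans 0<i (i≤start coded i)

        b-periodic : ∀ i → b (p ℕ.+ i) ≡ b i
        b-periodic i = cong ℤ.∣_∣ (trans (cong a (eq M p i)) (proj₂ a-period (M ℕ.+ i) (ℕ.m≤n⇒m≤n+o i (ℕ.m≤m+n t _))))
          where
          eq : ∀ m p i → m ℕ.+ (p ℕ.+ i) ≡ m ℕ.+ i ℕ.+ p
          eq = solveℕ-∀

        x-per : ∀ k → x (+ (m ℕ.+ k)) ≡ x (+ k)
        x-per = x-periodic coded 0<p even-p b-periodic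

        -- A period of the turns is the start of run c, where c is an even period of the run
        -- lengths, hence of the quotients; then p ≤ c, and `start` is monotone.
        leastPeriod : Least (IsPeriod x) m
        leastPeriod = (0<start 0<p , extend-period x {m} (0<start (proj₁ g-period))
            (λ i → cong riverTurn (form-periodic i)) x-per)
          , λ k (0<k , per) → minimal (period⇒run coded 0<p even-p x-per 0<k
              (λ j → trans (cong (x ∘ +_) (ℕ.+-comm k j)) (per (+ j))))
          where
          minimal : ∀ {k} → ∃[ c ] (0 ℕ.< c × k ≡ start c × 2 ∣ c × (∀ i → b (c ℕ.+ i) ≡ b i)) → m ℕ.≤ k
          minimal (c , 0<c , refl , even-c , b-per) =
            start-mono coded (proj₂ lp c (even-c , 0<c , a-per))
            where
            at : ∀ j → a (t ℕ.+ j ℕ.+ c) ≡ a (t ℕ.+ j)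
            at j = begin
              a (t ℕ.+ j ℕ.+ c)    ≡⟨ cong a (trans (ℕ.+-assoc t j c) (cong (t ℕ.+_) (ℕ.+-comm j c))) ⟩
              a (t ℕ.+ (c ℕ.+ j))  ≡⟨ a-shift (c ℕ.+ j) ⟨
              a (M ℕ.+ (c ℕ.+ j))  ≡⟨ a≡b (c ℕ.+ j) ⟨
              + b (c ℕ.+ j)        ≡⟨ cong +_ (b-per j) ⟩
              + b j                ≡⟨ a≡b j ⟩
              a (M ℕ.+ j)          ≡⟨ a-shift j ⟩
              a (t ℕ.+ j)          ∎
              where open ≡-Reasoning
            a-per : ∀ i → t ℕ.≤ i → a (i ℕ.+ c) ≡ a i
            a-per i t≤i = subst (λ i → a (i ℕ.+ c) ≡ a i) (ℕ.m+[n∸m]≡n t≤i) (at (i ℕ.∸ t))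

        r : List Turn
        r = applyUpTo (x ∘ +_) m

        sequence : r ≡ concatMap (λ i → replicate ℤ.∣ a i ∣ (parity i)) (applyUpTo (t ℕ.+_) p)
        sequence = begin
          applyUpTo (x ∘ +_) m                                  ≡⟨ word coded p ⟨
          concatMap (λ i → replicate (b i) (l i)) (applyUpTo id p)
            ≡⟨ List.concatMap-cong (λ i → cong₂ replicate (cong ℤ.∣_∣ (a-shift i)) (l-shift i)) (applyUpTo id p) ⟩
          concatMap (f ∘ (t ℕ.+_)) (applyUpTo id p)             ≡⟨ cong concat (List.map-∘ (applyUpTo id p)) ⟩
          concatMap f (map (t ℕ.+_) (applyUpTo id p))           ≡⟨ cong (concatMap f) (List.map-applyUpTo id (t ℕ.+_) p) ⟩
          concatMap f (applyUpTo (t ℕ.+_) p)                    ∎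
          where
          open ≡-Reasoning
          f = λ i → replicate ℤ.∣ a i ∣ (parity i)

        length-r : length r ≡ m
        length-r = List.length-applyUpTo (x ∘ +_) m

        letter : ∀ u → lookup r u ≡ x (+ toℕ u)
        letter = List.lookup-applyUpTo (x ∘ +_) m

        occurs-at : ∀ k → k ℕ.< m → ∃[ u ] lookup r u ≡ x (+ k)
        occurs-at k k<m = u , trans (letter u) (cong (x ∘ +_) (Fin.toℕ-fromℕ< k<length))
          where
          k<length = subst (k ℕ.<_) (sym length-r) k<m
          u = fromℕ< k<length

        two≤ : ∀ {p} → 0 ℕ.< p → 2 ∣ p → 2 ℕ.≤ p
        two≤ {suc p} _ (divides (suc k) refl) = ℕ.s≤s (ℕ.s≤s ℕ.z≤n)

        occurs : ∀ y → ∃[ u ] lookup r u ≡ y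
        occurs y = either y (l 0) refl
          where
          -- The initial letters of the first two runs; both runs lie within one period because p is
          -- even and positive.
          u₀ = occurs-at 0 (0<start 0<p)
          u₁ = occurs-at (start 1) (ℕ.<-≤-trans
            (subst (start 1 ℕ.<_) refl (ℕ.m<m+n (start 1) (0<b 1))) (start-mono coded (two≤ 0<p even-p)))
          at₀ : ∀ {y} → l 0 ≡ y → ∃[ u ] lookup r u ≡ y
          at₀ eq = proj₁ u₀ , trans (proj₂ u₀) (trans (first coded 0) eq)
          at₁ : ∀ {y} → opposite (l 0) ≡ y → ∃[ u ] lookup r u ≡ y
          at₁ eq = proj₁ u₁ , trans (proj₂ u₁) (trans (first coded 1) (trans (l-alternates 0) eq))
          either : ∀ y z → l 0 ≡ z → ∃[ u ] lookup r u ≡ y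
          either L L eq = at₀ eq
          either R R eq = at₀ eq
          either L R eq = at₁ (cong opposite eq)
          either R L eq = at₁ (cong opposite eq)

      riverData-at : RiverData 𝕋
      riverData-at = record
        { r        = r
        ; computed = record
          { α           = root D q
          ; firstRoot   = root-isFirstRoot q (A≢0 {q} ns)
          ; a           = a
          ; expansion   = continuedFraction q refl
          ; t           = t
          ; p           = p
          ; leastStart  = lt
          ; leastPeriod = lp
          ; sequence    = sequence
          }
        ; ρ        = river e₀ d₀
        ; θ        = translation (river e₀ d₀) leastPeriod
        ; period≡  = sym length-r
        ; letter   = letter
        ; occurs   = occurs
        }

  private
    module _ {n Q} (g-period : IsPeriodFrom g n Q) (even-Q : 2 ∣ Q) (red : ∀ i → n ℕ.≤ i → Reduced (g i)) where

      a-period₀ : IsPeriodFrom a n Q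
      a-period₀ = proj₁ g-period , λ i n≤i → cong floor (proj₂ g-period i n≤i)

      from-edge : ∀ {t} (lt : Least (λ t′ → ∃[ p′ ] IsPeriodFrom a t′ p′) t)
        {p} (lp : Least (λ p′ → 2 ∣ p′ × IsPeriodFrom a t p′) p) →
        ∃[ e ] form e ≡ h (t ℕ.+ n ℕ.* p) → RiverData 𝕋
      from-edge lt lp (e , eq) = riverData-at g-period even-Q red lt lp e eq

      from-even-period : ∀ {t} → Least (λ t′ → ∃[ p′ ] IsPeriodFrom a t′ p′) t →
        ∃[ p ] Least (λ p′ → 2 ∣ p′ × IsPeriodFrom a t p′) p → RiverData 𝕋
      from-even-period {t} lt (p , lp) =
        from-edge lt lp (edge-at D ns s s≥0 s²≤D D<s⁺² q refl 𝕋 (t ℕ.+ n ℕ.* p))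

      from-start : ∃[ t ] Least (λ t′ → ∃[ p′ ] IsPeriodFrom a t′ p′) t → RiverData 𝕋
      from-start (t , lt) = from-even-period lt
        (least-even-period ℤ._≟_ even-Q (earlier-period (proj₂ (proj₁ lt)) a-period₀))

    from-period : ∃[ n ] ∃[ p ] (IsPeriodFrom g n p × (∀ i → n ℕ.≤ i → Reduced (g i))) → RiverData 𝕋
    from-period (n , p , g-period , red) =
      from-start g-period₂ (m∣m*n p) red (least-start ℤ._≟_ (a-period₀ g-period₂ (m∣m*n p) red))
      where
      -- Doubled so as to be even: the `oriented` form recurs only if the parity of the index does
      -- too.
      g-period₂ : IsPeriodFrom g n (2 ℕ.* p)
      g-period₂ = ℕ.<-≤-trans (proj₁ g-period) (ℕ.m≤m+n p _) , multiple-period 2 g-period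

  riverData-from : RiverData 𝕋
  riverData-from = from-period (forms-periodic D ns s s≥0 s²≤D D<s⁺² q refl)

riverData : ∀ q → PIBQF q → (𝕋 : Topograph q) → RiverData 𝕋
riverData q π 𝕋 =
  from-sqrt (integralSqrt (disc q) (PIBQF.positive π))
  where
  from-sqrt : ∃[ s ] (0ℤ ℤ.≤ s × s ℤ.* s ℤ.≤ disc q ×
    1ℤ ℤ.+ disc q ℤ.≤ (1ℤ ℤ.+ s) ℤ.* (1ℤ ℤ.+ s)) → RiverData 𝕋
  from-sqrt (s , s≥0 , lo , hi) = riverData-from q (PIBQF.nonsquare π) s s≥0 lo hi 𝕋

-- The procedure

does⁻ : {P : Set} (P? : Dec P) → does P? ≡ true → P
does⁻ (yes p) _ = p

Enumeration : {X : Set} → (X → Set) → ℕ → Set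
Enumeration P n = CountModulo P _≡_ n

open CountModulo

module _ {X : Set} where

  enumerate-none : {P : X → Set} → (∀ x → ¬ P x) → Enumeration P 0
  enumerate-none none = record
    { representative = λ ()
    ; satisfies      = λ ()
    ; distinct       = λ ()
    ; exhaustive     = λ x p → contradiction p (none x)
    }

  enumerate-⇔ : {P Q : X → Set} → (∀ x → P x → Q x) → (∀ x → Q x → P x) →
    ∀ {n} → Enumeration P n → Enumeration Q n
  enumerate-⇔ to from E = record
    { representative = representative E
    ; satisfies      = λ k → to _ (satisfies E k)
    ; distinct       = distinct E
    ; exhaustive     = λ x q → exhaustive E x (from x q)
    }

  enumerate-⊎ : {P Q : X → Set} → (∀ x → P x → ¬ Q x) →
    ∀ {m n} → Enumeration P m → Enumeration Q n → Enumeration (λ x → P x ⊎ Q x) (m ℕ.+ n)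
  enumerate-⊎ {P} {Q} disjoint {m} {n} E F = record
    { representative = rep ∘ splitAt m
    ; satisfies      = λ k → sat (splitAt m k)
    ; distinct       = λ k l eq → trans (sym (Fin.join-splitAt m n k))
        (trans (cong (Fin.join m n) (dis (splitAt m k) (splitAt m l) eq)) (Fin.join-splitAt m n l))
    ; exhaustive     = λ x → [ left′ x , right′ x ]′
    }
    where
    rep : Fin m ⊎ Fin n → X
    rep = [ representative E , representative F ]′
    sat : ∀ s → P (rep s) ⊎ Q (rep s)
    sat (inj₁ k) = inj₁ (satisfies E k)
    sat (inj₂ k) = inj₂ (satisfies F k)
    dis : ∀ s t → rep s ≡ rep t → s ≡ t
    dis (inj₁ k) (inj₁ l) eq = cong inj₁ (distinct E k l eq)
    dis (inj₂ k) (inj₂ l) eq = cong inj₂ (distinct F k l eq)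
    dis (inj₁ k) (inj₂ l) eq = contradiction (subst Q (sym eq) (satisfies F l)) (disjoint _ (satisfies E k))
    dis (inj₂ k) (inj₁ l) eq = contradiction (subst Q eq (satisfies F k)) (disjoint _ (satisfies E l))
    left′ : ∀ x → P x → ∃[ k ] x ≡ rep (splitAt m k)
    left′ x p with exhaustive E x p
    ... | k , eq = k ↑ˡ n , trans eq (cong rep (sym (Fin.splitAt-↑ˡ m k n)))
    right′ : ∀ x → Q x → ∃[ k ] x ≡ rep (splitAt m k)
    right′ x q with exhaustive F x q
    ... | k , eq = m ↑ʳ k , trans eq (cong rep (sym (Fin.splitAt-↑ʳ m n k)))

enumerate-× : {X Y : Set} {P : X → Set} {Q : Y → Set} →
  ∀ {m n} → Enumeration P m → Enumeration Q n →
  Enumeration (λ ((x , y) : X × Y) → P x × Q y) (m ℕ.* n)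
enumerate-× {m = m} {n} E F = record
  { representative = λ k → representative E (proj₁ (remQuot {m} n k)) , representative F (proj₂ (remQuot {m} n k))
  ; satisfies      = λ k → satisfies E (proj₁ (remQuot {m} n k)) , satisfies F (proj₂ (remQuot {m} n k))
  ; distinct       = λ k l eq → trans (sym (Fin.combine-remQuot {m} n k)) (trans
      (cong₂ combine (distinct E _ _ (cong proj₁ eq)) (distinct F _ _ (cong proj₂ eq)))
      (Fin.combine-remQuot {m} n l))
  ; exhaustive     = λ (x , y) (p , q) →
      let i , eqᵢ = exhaustive E x p
          j , eqⱼ = exhaustive F y q
      in combine i j , cong₂ _,_
           (trans eqᵢ (cong (representative E ∘ proj₁) (sym (Fin.remQuot-combine i j))))
           (trans eqⱼ (cong (representative F ∘ proj₂) (sym (Fin.remQuot-combine i j))))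
  }

enumerate-pullback : {X Y : Set} {P : X → Set} {Q : Y → Set} (f : X → Y) →
  (∀ {x x′} → f x ≡ f x′ → x ≡ x′) →
  (∀ x → P x → Q (f x)) → (∀ y → Q y → ∃[ x ] (P x × f x ≡ y)) →
  ∀ {n} → Enumeration Q n → Enumeration P n
enumerate-pullback f injective to from E = record
  { representative = λ k → proj₁ (preimage k)
  ; satisfies      = λ k → proj₁ (proj₂ (preimage k))
  ; distinct       = λ k l eq → distinct E k l (trans (sym (proj₂ (proj₂ (preimage k))))
      (trans (cong f eq) (proj₂ (proj₂ (preimage l)))))
  ; exhaustive     = λ x p → let k , eq = exhaustive E (f x) (to x p) in
      k , injective (trans eq (sym (proj₂ (proj₂ (preimage k)))))
  }
  where
  preimage = λ k → from (representative E k) (satisfies E k)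

enumerate-subset : ∀ {n} (p : Subset n) → Enumeration (_∈ p) ∣ p ∣
enumerate-subset []            = enumerate-none λ ()
enumerate-subset (outside ∷ p) = record
  { representative = suc ∘ representative E
  ; satisfies      = there ∘ satisfies E
  ; distinct       = λ k l eq → distinct E k l (Fin.suc-injective eq)
  ; exhaustive     = λ { zero () ; (suc i) (there i∈p) → map₂ (cong suc) (exhaustive E i i∈p) }
  }
  where E = enumerate-subset p
enumerate-subset (inside ∷ p) = record
  { representative = λ { zero → zero ; (suc k) → suc (representative E k) }
  ; satisfies      = λ { zero → here ; (suc k) → there (satisfies E k) }
  ; distinct       = λ { zero zero _ → refl ; zero (suc l) () ; (suc k) zero ()
                       ; (suc k) (suc l) eq → cong suc (distinct E k l (Fin.suc-injective eq)) }
  ; exhaustive     = λ { zero _ → zero , refl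
                       ; (suc i) (there i∈p) → let k , eq = exhaustive E i i∈p in suc k , cong suc eq }
  }
  where E = enumerate-subset p

-- The cyclic successor of an index

sucMod : ∀ {n} → Fin n → Fin n
sucMod {n} i = _mod_ (toℕ i ℕ.+ 1) n {{nonZeroIndex i}}

toℕ-sucMod : ∀ {n} (i : Fin n) → toℕ (sucMod i) ≡ _%_ (toℕ i ℕ.+ 1) n {{nonZeroIndex i}}
toℕ-sucMod {n} i = Fin.toℕ-fromℕ< _

toℕ-iterate-sucMod : ∀ {n} .{{_ : ℕ.NonZero n}} k (i : Fin n) → toℕ (iterate sucMod k i) ≡ (toℕ i ℕ.+ k) % n
toℕ-iterate-sucMod {n} zero i = sym (trans (cong (_% n) (ℕ.+-identityʳ (toℕ i))) (m<n⇒m%n≡m (Fin.toℕ<n i)))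
toℕ-iterate-sucMod {n} (suc k) i = begin
  toℕ (sucMod (iterate sucMod k i))              ≡⟨ toℕ-sucMod (iterate sucMod k i) ⟩
  (toℕ (iterate sucMod k i) ℕ.+ 1) % n         ≡⟨ cong suc% (toℕ-iterate-sucMod k i) ⟩
  ((toℕ i ℕ.+ k) % n ℕ.+ 1) % n              ≡⟨ %-distribˡ-+ ((toℕ i ℕ.+ k) % n) 1 n ⟩
  ((toℕ i ℕ.+ k) % n % n ℕ.+ 1 % n) % n      ≡⟨ cong (λ m → (m ℕ.+ 1 % n) % n) (m%n%n≡m%n (toℕ i ℕ.+ k) n) ⟩
  ((toℕ i ℕ.+ k) % n ℕ.+ 1 % n) % n          ≡⟨ %-distribˡ-+ (toℕ i ℕ.+ k) 1 n ⟨
  (toℕ i ℕ.+ k ℕ.+ 1) % n                    ≡⟨ cong (_% n) (trans (ℕ.+-assoc (toℕ i) k 1) (cong (toℕ i ℕ.+_) (ℕ.+-comm k 1))) ⟩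
  (toℕ i ℕ.+ suc k) % n                      ∎
  where
  open ≡-Reasoning
  suc% : ℕ → ℕ
  suc% m = (m ℕ.+ 1) % n

iterate-sucMod-period : ∀ {n} k (i : Fin n) → iterate sucMod (k ℕ.* n) i ≡ i
iterate-sucMod-period {n} k i = Fin.toℕ-injective (begin
  toℕ (iterate sucMod (k ℕ.* n) i)   ≡⟨ toℕ-iterate-sucMod {{nonZeroIndex i}} (k ℕ.* n) i ⟩
  _%_ (toℕ i ℕ.+ k ℕ.* n) n {{nonZeroIndex i}} ≡⟨ [m+kn]%n≡m%n (toℕ i) k n {{nonZeroIndex i}} ⟩
  _%_ (toℕ i) n {{nonZeroIndex i}} ≡⟨ m<n⇒m%n≡m {{nonZeroIndex i}} (Fin.toℕ<n i) ⟩
  toℕ i                            ∎)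
  where open ≡-Reasoning

sucMod-injective : ∀ {n} {i j : Fin n} → sucMod i ≡ sucMod j → i ≡ j
sucMod-injective {suc n} {i} {j} eq = trans (sym (undo i)) (trans (cong (iterate sucMod n) eq) (undo j))
  where
  undo : ∀ i → iterate sucMod n (sucMod i) ≡ i
  undo i = trans (iterate-suc sucMod n i) (trans
    (cong (λ m → iterate sucMod m i) (sym (ℕ.*-identityˡ (suc n)))) (iterate-sucMod-period 1 i))

module _ {n : ℕ} {I : Subset n} where

  ∈-shift⁻ : ∀ {j} → j ∈ I +ˢ 1 → ∃[ i ] (i ∈ I × sucMod i ≡ j)
  -- `sucMod` is by definition the shift inside `_+ˢ_` for k = 1, so the deciding procedure is the
  -- very same term.
  ∈-shift⁻ {j} j∈ = does⁻ (any? λ i → (i ∈? I) ×-dec (sucMod i Fin.≟ j))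
    (trans (sym (lookup∘tabulate _ j)) ([]=⇒lookup j∈))

  ∈-shift⁺ : ∀ {i} → i ∈ I → sucMod i ∈ I +ˢ 1
  ∈-shift⁺ {i} i∈I = lookup⇒[]= (sucMod i) _ (trans (lookup∘tabulate _ (sucMod i))
    (dec-true (any? λ k → (k ∈? I) ×-dec (sucMod k Fin.≟ sucMod i)) (i , i∈I , refl)))

module _ {x : Turn} {r : List Turn} where

  ∈-indices⁻ : ∀ {i} → i ∈ indices x r → lookup r i ≡ x
  ∈-indices⁻ {i} i∈ = does⁻ (lookup r i ≟ᵗ x) (trans (sym (lookup∘tabulate _ i)) ([]=⇒lookup i∈))

  ∈-indices⁺ : ∀ {i} → lookup r i ≡ x → i ∈ indices x r
  ∈-indices⁺ {i} eq = lookup⇒[]= i _ (trans (lookup∘tabulate _ i) (dec-true (lookup r i ≟ᵗ x) eq))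

-- The recursion, its count and its depth

module _ (r₁ r₂ : List Turn) where
  open Procedure r₁ r₂

  private
    m = length r₁
    n = length r₂
    X = lookup r₁
    Y = lookup r₂

  -- Being inductive, it requires the common word to be finite: rivers that run together forever are
  -- excluded. The number of `later` is the length of that word.
  data Diverge (u : Fin m) (v : Fin n) : Set where
    now   : X u ≡ R → Y v ≡ L → Diverge u v
    later : X u ≡ Y v → Diverge (sucMod u) (sucMod v) → Diverge u v

  -- Read backwards from u and v, the sequences agree for d letters and then differ.
  data Joined : ℕ → Fin m → Fin n → Set where
    fork   : ∀ {u v} → X u ≡ L → Y v ≡ R → Joined 0 (sucMod u) (sucMod v)
    extend : ∀ {d u v} → X u ≡ Y v → Joined d u v → Joined (suc d) (sucMod u) (sucMod v)

  Shared : Subset m → Subset n → Fin m × Fin n → Set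
  Shared T₁ T₂ (u , v) = u ∈ T₁ × v ∈ T₂ × Diverge u v

  private
    i₁ : Turn → Subset m
    i₁ c = indices c r₁

    i₂ : Turn → Subset n
    i₂ c = indices c r₂

    child₁ : Turn → Subset m → Subset m
    child₁ c T₁ = (i₁ c ∩ T₁) +ˢ 1

    child₂ : Turn → Subset n → Subset n
    child₂ c T₂ = (i₂ c ∩ T₂) +ˢ 1

    Now : Subset m → Subset n → Fin m × Fin n → Set
    Now T₁ T₂ (u , v) = u ∈ i₁ R ∩ T₁ × v ∈ i₂ L ∩ T₂

    Later : Turn → Subset m → Subset n → Fin m × Fin n → Set
    Later c T₁ T₂ (u , v) = u ∈ i₁ c ∩ T₁ × v ∈ i₂ c ∩ T₂ × Diverge (sucMod u) (sucMod v)

  module _ {T₁ : Subset m} {T₂ : Subset n} where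
    private
      in₁ : ∀ {c u} → u ∈ i₁ c ∩ T₁ → X u ≡ c × u ∈ T₁
      in₁ {c} u∈ = let u∈i , u∈T = x∈p∩q⁻ (i₁ c) T₁ u∈ in ∈-indices⁻ {r = r₁} u∈i , u∈T

      in₂ : ∀ {c v} → v ∈ i₂ c ∩ T₂ → Y v ≡ c × v ∈ T₂
      in₂ {c} v∈ = let v∈i , v∈T = x∈p∩q⁻ (i₂ c) T₂ v∈ in ∈-indices⁻ {r = r₂} v∈i , v∈T

      to₁ : ∀ {c u} → X u ≡ c → u ∈ T₁ → u ∈ i₁ c ∩ T₁
      to₁ eq u∈T = x∈p∩q⁺ (∈-indices⁺ {r = r₁} eq , u∈T)

      to₂ : ∀ {c v} → Y v ≡ c → v ∈ T₂ → v ∈ i₂ c ∩ T₂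
      to₂ eq v∈T = x∈p∩q⁺ (∈-indices⁺ {r = r₂} eq , v∈T)

      L≢R : ∀ {x} → x ≡ L → x ≢ R
      L≢R refl ()

    child-joined : ∀ c {d} → (∀ {u v} → u ∈ T₁ → v ∈ T₂ → Joined d u v) →
      ∀ {u v} → u ∈ child₁ c T₁ → v ∈ child₂ c T₂ → Joined (suc d) u v
    child-joined c joined u∈ v∈ with ∈-shift⁻ u∈ | ∈-shift⁻ v∈
    ... | u′ , u′∈ , refl | v′ , v′∈ , refl =
      extend (trans (proj₁ (in₁ u′∈)) (sym (proj₁ (in₂ v′∈)))) (joined (proj₂ (in₁ u′∈)) (proj₂ (in₂ v′∈)))

    enumerate-later : ∀ c {k} → Enumeration (Shared (child₁ c T₁) (child₂ c T₂)) k → Enumeration (Later c T₁ T₂) k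
    enumerate-later c = enumerate-pullback (λ (u , v) → sucMod u , sucMod v)
      (λ eq → cong₂ _,_ (sucMod-injective (cong proj₁ eq)) (sucMod-injective (cong proj₂ eq)))
      (λ _ (u∈ , v∈ , δ) → ∈-shift⁺ u∈ , ∈-shift⁺ v∈ , δ)
      back′
      where
      back′ : ∀ y → Shared (child₁ c T₁) (child₂ c T₂) y →
        ∃[ x ] (Later c T₁ T₂ x × (sucMod (proj₁ x) , sucMod (proj₂ x)) ≡ y)
      back′ _ (u∈ , v∈ , δ) with ∈-shift⁻ u∈ | ∈-shift⁻ v∈
      ... | u′ , u′∈ , refl | v′ , v′∈ , refl = (u′ , v′) , (u′∈ , v′∈ , δ) , refl

    -- Pairs are sorted by their letters. R against L diverges at once and is counted in step 4,
    -- equal letters are passed to the call for that letter, and L against R never satisfies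
    -- `Diverge`.
    enumerate-shared : ∀ {k l} →
      Enumeration (Shared (child₁ L T₁) (child₂ L T₂)) k →
      Enumeration (Shared (child₁ R T₁) (child₂ R T₂)) l →
      Enumeration (Shared T₁ T₂) (∣ i₁₁ ∩ T₁ ∣ ℕ.* ∣ i₂₀ ∩ T₂ ∣ ℕ.+ (k ℕ.+ l))
    enumerate-shared E F = enumerate-⇔ to from
      (enumerate-⊎ now-later
        (enumerate-× (enumerate-subset (i₁₁ ∩ T₁)) (enumerate-subset (i₂₀ ∩ T₂)))
        (enumerate-⊎ (λ _ (u∈ , _) (u∈′ , _) → L≢R (proj₁ (in₁ u∈)) (proj₁ (in₁ u∈′)))
          (enumerate-later L E) (enumerate-later R F)))
      where
      now-later : ∀ x → Now T₁ T₂ x → ¬ (Later L T₁ T₂ x ⊎ Later R T₁ T₂ x)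
      now-later _ (u∈ , v∈) (inj₁ (u∈′ , _))      = L≢R (proj₁ (in₁ u∈′)) (proj₁ (in₁ u∈))
      now-later _ (u∈ , v∈) (inj₂ (_ , v∈′ , _)) = L≢R (proj₁ (in₂ v∈)) (proj₁ (in₂ v∈′))
      to : ∀ x → Now T₁ T₂ x ⊎ Later L T₁ T₂ x ⊎ Later R T₁ T₂ x → Shared T₁ T₂ x
      to _ (inj₁ (u∈ , v∈)) =
        proj₂ (in₁ u∈) , proj₂ (in₂ v∈) , now (proj₁ (in₁ u∈)) (proj₁ (in₂ v∈))
      to _ (inj₂ (inj₁ (u∈ , v∈ , δ))) =
        proj₂ (in₁ u∈) , proj₂ (in₂ v∈) , later (trans (proj₁ (in₁ u∈)) (sym (proj₁ (in₂ v∈)))) δ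
      to _ (inj₂ (inj₂ (u∈ , v∈ , δ))) =
        proj₂ (in₁ u∈) , proj₂ (in₂ v∈) , later (trans (proj₁ (in₁ u∈)) (sym (proj₁ (in₂ v∈)))) δ
      from : ∀ x → Shared T₁ T₂ x → Now T₁ T₂ x ⊎ Later L T₁ T₂ x ⊎ Later R T₁ T₂ x
      from _ (u∈ , v∈ , now x y) = inj₁ (to₁ x u∈ , to₂ y v∈)
      from (u , v) (u∈ , v∈ , later eq δ) = at (X u) refl
        where
        at : ∀ c → X u ≡ c → Now T₁ T₂ (u , v) ⊎ Later L T₁ T₂ (u , v) ⊎ Later R T₁ T₂ (u , v)
        at L x = inj₂ (inj₁ (to₁ x u∈ , to₂ (trans (sym eq) x) v∈ , δ))
        at R x = inj₂ (inj₂ (to₁ x u∈ , to₂ (trans (sym eq) x) v∈ , δ))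

  -- `Joined` read forwards from the fork, so that m n applications of `sucMod` can be seen to lead
  -- back to it in both sequences.
  record Fork (d : ℕ) (u : Fin m) (v : Fin n) : Set where
    field
      u₀     : Fin m
      v₀     : Fin n
      at-u₀  : X u₀ ≡ L
      at-v₀  : Y v₀ ≡ R
      u≡     : iterate sucMod (suc d) u₀ ≡ u
      v≡     : iterate sucMod (suc d) v₀ ≡ v
      agrees : ∀ k → k ℕ.< d → X (iterate sucMod (suc k) u₀) ≡ Y (iterate sucMod (suc k) v₀)

  unjoin : ∀ {d u v} → Joined d u v → Fork d u v
  unjoin (fork {u} {v} x y) = record
    { u₀ = u ; v₀ = v ; at-u₀ = x ; at-v₀ = y ; u≡ = refl ; v≡ = refl ; agrees = λ k () }
  unjoin (extend {d} eq j) = record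
    { u₀ = u₀ ; v₀ = v₀ ; at-u₀ = at-u₀ ; at-v₀ = at-v₀
    ; u≡ = cong sucMod u≡ ; v≡ = cong sucMod v≡
    ; agrees = λ k k<1+d → [ agrees k , (λ { refl → trans (cong X u≡) (trans eq (cong Y (sym v≡))) }) ]′
        (ℕ.m≤n⇒m<n∨m≡n (ℕ.s≤s⁻¹ k<1+d))
    }
    where open Fork (unjoin j)

  -- Going back m n letters returns to the fork, where the letters are equal and different.
  ¬joined : ∀ {d} → d ≡ m ℕ.* n → ∀ {u v} → ¬ Joined d u v
  ¬joined {zero} 0≡ {u} j = contradiction (sym 0≡) (ℕ.m<n⇒n≢0 (ℕ.>-nonZero⁻¹ _
      {{ℕ.m*n≢0 m n {{nonZeroIndex (Fork.u₀ (unjoin j))}} {{nonZeroIndex (Fork.v₀ (unjoin j))}}}}))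
  ¬joined {suc k} eq j = L≢R′ (begin
      L                                  ≡⟨ at-u₀ ⟨
      X u₀                               ≡⟨ cong X (trans (cong (λ k → iterate sucMod k u₀) (trans eq (ℕ.*-comm m n))) (iterate-sucMod-period n u₀)) ⟨
      X (iterate sucMod (suc k) u₀)        ≡⟨ agrees k ℕ.≤-refl ⟩
      Y (iterate sucMod (suc k) v₀)        ≡⟨ cong Y (trans (cong (λ k → iterate sucMod k v₀) eq) (iterate-sucMod-period m v₀)) ⟩
      Y v₀                               ≡⟨ at-v₀ ⟩
      R                                  ∎)
    where
    open ≡-Reasoning
    open Fork (unjoin j)
    L≢R′ : ¬ (L ≡ R)
    L≢R′ ()

  private
    -- Calls from layer 2 on, which all return; the first layer is treated apart because it ends
    -- with an output. Quantifying over the counter I lets the two recursive calls be chained.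
    Explored : Subset m → Subset n → Set
    Explored T₁ T₂ = ∃[ N ] (Enumeration (Shared T₁ T₂) N ×
      (∀ S k I → Call S T₁ T₂ (suc (suc k)) I (returnTo (suc k) (I ℕ.+ N))))

    node : ∀ {T₁ T₂} → Explored (child₁ L T₁) (child₂ L T₂) → Explored (child₁ R T₁) (child₂ R T₂) →
      Nonempty T₁ → Nonempty T₂ →
      ∃[ N ] (Enumeration (Shared T₁ T₂) N × (∀ S k I → Call S T₁ T₂ (suc k) I (finish (suc k) (I ℕ.+ N))))
    node {T₁} {T₂} (N₀ , E₀ , call₀) (N₁ , E₁ , call₁) ne₁ ne₂ =
      N ℕ.+ (N₀ ℕ.+ N₁) , enumerate-shared E₀ E₁ , λ S k I →
        subst (λ I′ → Call S T₁ T₂ (suc k) I (finish (suc k) I′)) (eq I N N₀ N₁)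
          (recurse ne₁ ne₂ (call₀ (S ∷ʳ L) k (I ℕ.+ N)) (call₁ (S ∷ʳ R) k (I ℕ.+ N ℕ.+ N₀)))
      where
      N = ∣ i₁₁ ∩ T₁ ∣ ℕ.* ∣ i₂₀ ∩ T₂ ∣
      eq : ∀ I N N₀ N₁ → I ℕ.+ N ℕ.+ N₀ ℕ.+ N₁ ≡ I ℕ.+ (N ℕ.+ (N₀ ℕ.+ N₁))
      eq = solveℕ-∀

    leaf : ∀ {T₁ T₂} → Empty T₁ ⊎ Empty T₂ → Explored T₁ T₂
    leaf {T₁} {T₂} e = 0 , enumerate-none none , λ S k I →
      subst (λ I′ → Call S T₁ T₂ (suc (suc k)) I (returnTo (suc k) I′)) (sym (ℕ.+-identityʳ I)) (stop e)
      where
      none : ∀ x → ¬ Shared T₁ T₂ x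
      none (u , v) (u∈ , v∈ , _) = [ (λ e₁ → e₁ (u , u∈)) , (λ e₂ → e₂ (v , v∈)) ]′ e

    -- The pairs of a layer have already agreed for d letters. No pair does so for m n letters, so
    -- by then one of the sets is empty.
    explore : ∀ fuel {d T₁ T₂} → fuel ℕ.+ d ≡ m ℕ.* n →
      (∀ {u v} → u ∈ T₁ → v ∈ T₂ → Joined d u v) → Explored T₁ T₂
    explore fuel {d} {T₁} {T₂} eq joined with nonempty? T₁ | nonempty? T₂
    ... | no ¬ne | _      = leaf (inj₁ ¬ne)
    ... | yes _  | no ¬ne = leaf (inj₂ ¬ne)
    explore zero eq joined | yes (u , u∈) | yes (v , v∈) = contradiction (joined u∈ v∈) (¬joined eq)
    explore (suc fuel) {d} {T₁} {T₂} eq joined | yes ne₁ | yes ne₂ =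
      map₂ (map₂ (λ call S k I → call S (suc k) I)) (node (sub L) (sub R) ne₁ ne₂)
      where
      sub : ∀ c → Explored (child₁ c T₁) (child₂ c T₂)
      sub c = explore fuel (trans (ℕ.+-suc fuel d) eq) (child-joined c joined)

  -- Both letters are required because an empty set in layer 1 would end the call with a return to
  -- layer 0, not with an output.
  procedure-outputs : ∃[ u ] X u ≡ L → ∃[ v ] Y v ≡ R →
    ∃[ N ] (Procedure.Outputs r₁ r₂ N × Enumeration (Shared (i₁₀ +ˢ 1) (i₂₁ +ˢ 1)) N)
  procedure-outputs (u , x) (v , y) = outermost (node (sub L) (sub R)
      (sucMod u , ∈-shift⁺ (∈-indices⁺ {r = r₁} x)) (sucMod v , ∈-shift⁺ (∈-indices⁺ {r = r₂} y)))
    where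
    T₁ = i₁₀ +ˢ 1
    T₂ = i₂₁ +ˢ 1
    outermost : ∃[ N ] (Enumeration (Shared T₁ T₂) N ×
        (∀ S k I → Call S T₁ T₂ (suc k) I (finish (suc k) (I ℕ.+ N)))) →
      ∃[ N ] (Procedure.Outputs r₁ r₂ N × Enumeration (Shared T₁ T₂) N)
    outermost (N , E , call) = N , call [] 0 0 , E
    forks : ∀ {u v} → u ∈ T₁ → v ∈ T₂ → Joined 0 u v
    forks u∈ v∈ with ∈-shift⁻ u∈ | ∈-shift⁻ v∈
    ... | u′ , u′∈ , refl | v′ , v′∈ , refl = fork (∈-indices⁻ {r = r₁} u′∈) (∈-indices⁻ {r = r₂} v′∈)
    -- The calls made from the first layer start with one letter agreed, d = 1.
    mn≡ : ℕ.pred (m ℕ.* n) ℕ.+ 1 ≡ m ℕ.* n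
    mn≡ = trans (ℕ.+-comm _ 1) (ℕ.suc-pred (m ℕ.* n) {{ℕ.m*n≢0 m n {{nonZeroIndex u}} {{nonZeroIndex v}}}})
    sub : ∀ c → Explored (child₁ c T₁) (child₂ c T₂)
    sub c = explore (ℕ.pred (m ℕ.* n)) mn≡ (child-joined c forks)

-- Superimpositions

module _ where
  open import Data.Integer.Base using (_+_; _*_; -_; _-_)

  follow-letter : ∀ {x y} e → follow x e ≡ follow y e → x ≡ y
  follow-letter {L} {L} e eq = refl
  follow-letter {R} {R} e eq = refl
  follow-letter {L} {R} e eq = contradiction eq (left≢right e)
  follow-letter {R} {L} e eq = contradiction (sym eq) (left≢right e)

  compare : ∀ i j → ∃[ n ] (j ≡ i + + n ⊎ i ≡ j + + n)
  compare i j = at (j - i) refl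
    where
    eq : ∀ i j → i + (j - i) ≡ j
    eq = solve-∀
    eq′ : ∀ i j → j - (j - i) ≡ i
    eq′ = solve-∀
    at : ∀ k → j - i ≡ k → ∃[ n ] (j ≡ i + + n ⊎ i ≡ j + + n)
    at (+ n) e    = n , inj₁ (trans (sym (eq i j)) (cong (λ k → i + k) e))
    at -[1+ n ] e = suc n , inj₂ (trans (sym (eq′ i j)) (cong (λ k → j - k) e))

  -- Congruence modulo n. The quotient is kept as a witness since it supplies the exponents of the
  -- translations in `superimpose-all`.
  Over : ∀ {n} → Fin n → ℤ → Set
  Over {n} u i = ∃[ a ] i ≡ + toℕ u + a * + n

  over-self : ∀ {n} (u : Fin n) → Over u (+ toℕ u)
  over-self u = 0ℤ , sym (ℤ.+-identityʳ _)

  over-+ : ∀ {n} {u : Fin n} {i} a → Over u i → Over u (i + a * + n)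
  over-+ {n} {u} a (b , refl) = b + a , eq (+ toℕ u) a b (+ n)
    where
    eq : ∀ u a b n → u + b * n + a * n ≡ u + (b + a) * n
    eq = solve-∀

  over-next : ∀ {n} {u : Fin n} {i} → Over u i → Over (sucMod u) (i + 1ℤ)
  over-next {n} {u} (a , refl) = + q + a , (begin
    + toℕ u + a * + n + + 1                         ≡⟨ eq₁ (+ toℕ u) (a * + n) ⟩
    + (toℕ u ℕ.+ 1) + a * + n                       ≡⟨ cong (λ k → + k + a * + n) (m≡m%n+[m/n]*n (toℕ u ℕ.+ 1) n) ⟩
    + ((toℕ u ℕ.+ 1) ℕ.% n ℕ.+ q ℕ.* n) + a * + n   ≡⟨ cong (λ k → + (k ℕ.+ q ℕ.* n) + a * + n) (sym (toℕ-sucMod u)) ⟩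
    + toℕ (sucMod u) + + (q ℕ.* n) + a * + n          ≡⟨ cong (λ k → + toℕ (sucMod u) + k + a * + n) (ℤ.pos-* q n) ⟩
    + toℕ (sucMod u) + + q * + n + a * + n            ≡⟨ eq₂ (+ toℕ (sucMod u)) (+ q) a (+ n) ⟩
    + toℕ (sucMod u) + (+ q + a) * + n                ∎)
    where
    open ≡-Reasoning
    instance
      nonZero : ℕ.NonZero n
      nonZero = nonZeroIndex u
    q = (toℕ u ℕ.+ 1) ℕ./ n
    eq₁ : ∀ u x → u + x + + 1 ≡ u + + 1 + x
    eq₁ = solve-∀
    eq₂ : ∀ u q a n → u + q * n + a * n ≡ u + (q + a) * n
    eq₂ = solve-∀

  over-unique : ∀ {n} {u v : Fin n} {i} → Over u i → Over v i → u ≡ v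
  over-unique {n} {u} {v} (a , refl) (b , eq) = Fin.toℕ-injective (at (b - a) (begin
    + toℕ u                          ≡⟨ eq₁ (+ toℕ u) a (+ n) ⟩
    + toℕ u + a * + n - a * + n      ≡⟨ cong (_- a * + n) eq ⟩
    + toℕ v + b * + n - a * + n      ≡⟨ eq₂ (+ toℕ v) a b (+ n) ⟩
    + toℕ v + (b - a) * + n          ∎))
    where
    open ≡-Reasoning
    eq₁ : ∀ u a n → u ≡ u + a * n - a * n
    eq₁ = solve-∀
    eq₂ : ∀ v a b n → v + b * n - a * n ≡ v + (b - a) * n
    eq₂ = solve-∀
    too-big : ∀ {x y : Fin n} k → toℕ x ≢ toℕ y ℕ.+ suc k ℕ.* n
    too-big {x} {y} k e = ℕ.<⇒≱ (Fin.toℕ<n x) (subst (n ℕ.≤_) (sym e)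
      (ℕ.m≤n⇒m≤o+n (toℕ y) (ℕ.m≤m+n n (k ℕ.* n))))
    at : ∀ c → + toℕ u ≡ + toℕ v + c * + n → toℕ u ≡ toℕ v
    at (+ zero) e = ℤ.+-injective (trans e (ℤ.+-identityʳ _))
    at +[1+ k ] e = contradiction
      (ℤ.+-injective (trans e (cong (λ z → + toℕ v + z) (sym (ℤ.pos-* (suc k) n))))) (too-big {u} {v} k)
    at -[1+ k ] e = contradiction (ℤ.+-injective (begin
      + toℕ v                                       ≡⟨ eq₃ (+ toℕ v) (+ suc k) (+ n) ⟩
      + toℕ v + - (+ suc k) * + n + + suc k * + n   ≡⟨ cong (_+ + suc k * + n) e ⟨
      + toℕ u + + suc k * + n                       ≡⟨ cong (λ z → + toℕ u + z) (ℤ.pos-* (suc k) n) ⟨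
      + (toℕ u ℕ.+ suc k ℕ.* n)                     ∎)) (too-big {v} {u} k)
      where
      eq₃ : ∀ v k n → v ≡ v + - k * n + k * n
      eq₃ = solve-∀

  over-some : ∀ {n} .{{_ : ℕ.NonZero n}} i → ∃[ u ] Over {n} u i
  over-some {n} i = fromℕ< (ℤ.n%ℕd<d i n) , i ℤ./ℕ n ,
    trans (ℤ.a≡a%ℕn+[a/ℕn]*n i n) (cong (λ k → + k + (i ℤ./ℕ n) * + n) (sym (Fin.toℕ-fromℕ< _)))

  i-1+1≡i : ∀ i → i - 1ℤ + 1ℤ ≡ i
  i-1+1≡i i = eq i
    where
    eq : ∀ i → i - + 1 + + 1 ≡ i
    eq = solve-∀

  module _ (φ : PlanarIso) where
    open PlanarIso φ

    from-equivariant : Equivariant from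
    from-equivariant = record
      { on-bar = λ e → trans (cong (λ d → from (bar d)) (sym (Inverse.strictlyInverseˡ bijection e)))
          (trans (cong from (sym (to-bar (from e)))) (Inverse.strictlyInverseʳ bijection (bar (from e))))
      ; on-ccw = λ e → trans (cong (λ d → from (ccw d)) (sym (Inverse.strictlyInverseˡ bijection e)))
          (trans (cong from (sym (to-ccw (from e)))) (Inverse.strictlyInverseʳ bijection (ccw (from e))))
      }

    power-equivariant : ∀ a → Equivariant (power φ a)
    power-equivariant (+ zero)     = equivariant-id
    power-equivariant +[1+ n ]     = equivariant-∘ (to-equivariant φ) (power-equivariant (+ n))
    power-equivariant -[1+ zero ]  = from-equivariant
    power-equivariant -[1+ suc n ] = equivariant-∘ from-equivariant (power-equivariant -[1+ n ])

  module _ {q : Form} {𝕋 : Topograph q} (𝔻 : RiverData 𝕋) where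
    open RiverData 𝔻
    open River ρ
    open RiverTranslation θ using (τ; leastPeriod; translates)

    private
      m = length r

      translates-m : ∀ i → PlanarIso.to τ (edge i) ≡ edge (i + + m)
      translates-m i = trans (translates i) (cong (λ k → edge (i + + k)) period≡)

      translates-back : ∀ i → PlanarIso.from τ (edge i) ≡ edge (i - + m)
      translates-back i = begin
        PlanarIso.from τ (edge i)                                 ≡⟨ cong (λ j → PlanarIso.from τ (edge j)) (eq i (+ m)) ⟩
        PlanarIso.from τ (edge (i - + m + + m))                   ≡⟨ cong (PlanarIso.from τ) (translates-m (i - + m)) ⟨
        PlanarIso.from τ (PlanarIso.to τ (edge (i - + m)))        ≡⟨ Inverse.strictlyInverseʳ (PlanarIso.bijection τ) _ ⟩
        edge (i - + m)                                            ∎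
        where
        open ≡-Reasoning
        eq : ∀ i m → i ≡ i - m + m
        eq = solve-∀

    power-edge : ∀ a i → power τ a (edge i) ≡ edge (i + a * + m)
    power-edge (+ zero) i = cong edge (sym (ℤ.+-identityʳ i))
    power-edge +[1+ n ] i = trans (cong (PlanarIso.to τ) (power-edge (+ n) i))
      (trans (translates-m (i + + n * + m)) (cong edge (eq i (+ n) (+ m))))
      where
      eq : ∀ i n m → i + n * m + m ≡ i + (+ 1 + n) * m
      eq = solve-∀
    power-edge -[1+ zero ] i = trans (translates-back i) (cong edge (eq i (+ m)))
      where
      eq : ∀ i m → i - m ≡ i + - (+ 1) * m
      eq = solve-∀
    power-edge -[1+ suc n ] i = trans (cong (PlanarIso.from τ) (power-edge -[1+ n ] i))
      (trans (translates-back (i + -[1+ n ] * + m)) (cong edge (eq i (+ suc n) (+ m))))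
      where
      eq : ∀ i n m → i + - n * m - m ≡ i + - (+ 1 + n) * m
      eq = solve-∀

    turn-periodic : ∀ i a → turn (i + a * + m) ≡ turn i
    turn-periodic i = ℤ-induction (λ a → turn (i + a * + m) ≡ turn i)
      (cong turn (ℤ.+-identityʳ i))
      (λ a eq → trans (cong turn (eq′ i a (+ m))) (trans (period (i + a * + m)) eq))
      (λ a eq → trans (sym (period (i + a * + m))) (trans (cong turn (sym (eq′ i a (+ m)))) eq))
      where
      eq′ : ∀ i a m → i + (a + + 1) * m ≡ i + a * m + m
      eq′ = solve-∀
      period : ∀ i → turn (i + + m) ≡ turn i
      period i = trans (cong (λ k → turn (i + + k)) (sym period≡)) (proj₂ (proj₁ leastPeriod) i)

    letter-over : ∀ {u i} → Over u i → lookup r u ≡ turn i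
    letter-over {u} (a , refl) = trans (letter u) (sym (turn-periodic (+ toℕ u) a))

    over-index : ∀ i → ∃[ u ] Over {m} u i
    over-index = over-some {{nonZeroIndex (proj₁ (occurs L))}}

    ∈-after⁻ : ∀ {x u i} → u ∈ indices x r +ˢ 1 → Over u i → turn (i - 1ℤ) ≡ x
    ∈-after⁻ {x} {u} {i} u∈ o with ∈-shift⁻ u∈
    ... | u′ , u′∈ , refl = trans (sym (letter-over (proj₂ w)))
      (trans (cong (lookup r) (sucMod-injective (over-unique (subst (Over _) (i-1+1≡i i) (over-next (proj₂ w))) o)))
        (∈-indices⁻ {r = r} u′∈))
      where w = over-index (i - 1ℤ)

    ∈-after⁺ : ∀ {x u i} → Over u i → turn (i - 1ℤ) ≡ x → u ∈ indices x r +ˢ 1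
    ∈-after⁺ {x} {u} {i} o eq =
      subst (_∈ indices x r +ˢ 1) (over-unique (subst (Over _) (i-1+1≡i i) (over-next (proj₂ w))) o)
        (∈-shift⁺ (∈-indices⁺ {r = r} (trans (letter-over (proj₂ w)) eq)))
      where w = over-index (i - 1ℤ)

  module _ {q : Form} {𝕋 : Topograph q} (ρ : River 𝕋) where
    open River ρ

    -- Grown at its end, since the comparison of two joins looks at the last letters.
    word : ℤ → ℕ → List Turn
    word i zero    = []
    word i (suc n) = word i n ∷ʳ turn (i + + n)

    length-word : ∀ i n → length (word i n) ≡ n
    length-word i zero    = refl
    length-word i (suc n) = trans (List.length-++ (word i n)) (trans (ℕ.+-comm _ 1) (cong suc (length-word i n)))

    walk-word : ∀ i n → walk (edge i) (word i n) ≡ edge (i + + n)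
    walk-word i zero    = cong edge (sym (ℤ.+-identityʳ i))
    walk-word i (suc n) = begin
      walk (edge i) (word i n ∷ʳ turn (i + + n))            ≡⟨ walk-++ (edge i) (word i n) _ ⟩
      follow (turn (i + + n)) (walk (edge i) (word i n))    ≡⟨ cong (follow (turn (i + + n))) (walk-word i n) ⟩
      follow (turn (i + + n)) (edge (i + + n))              ≡⟨ next (i + + n) ⟨
      edge (i + + n + 1ℤ)                                   ≡⟨ cong edge (eq i (+ n)) ⟩
      edge (i + + suc n)                                    ∎
      where
      open ≡-Reasoning
      eq : ∀ i n → i + n + + 1 ≡ i + (+ 1 + n)
      eq = solve-∀

    edge-after : ∀ i → edge i ≡ follow (turn (i - 1ℤ)) (edge (i - 1ℤ))
    edge-after i = trans (cong edge (sym (i-1+1≡i i))) (River.next ρ (i - 1ℤ))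

  module _ {q₁ q₂ : Form} {𝕋₁ : Topograph q₁} {𝕋₂ : Topograph q₂}
           (𝔻₁ : RiverData 𝕋₁) (𝔻₂ : RiverData 𝕋₂) where

    private
      module 𝔻₁ = RiverData 𝔻₁
      module 𝔻₂ = RiverData 𝔻₂
      r₁ = 𝔻₁.r
      r₂ = 𝔻₂.r
      ρ₁ = 𝔻₁.ρ
      ρ₂ = 𝔻₂.ρ
      open River ρ₁ renaming (edge to edge₁; turn to turn₁; next to next₁) using ()
      open River ρ₂ renaming (edge to edge₂; turn to turn₂; next to next₂) using ()

    -- The second river joins the first one at edge j, which lies on edge i.
    record Join (φ : PlanarIso) (i j : ℤ) : Set where
      open PlanarIso φ
      field
        meets   : to (edge₂ j) ≡ edge₁ i
        before₁ : turn₁ (i - 1ℤ) ≡ L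
        before₂ : turn₂ (j - 1ℤ) ≡ R

    private
      last-letters : ∀ {φ i j} → Join φ i j → ∀ k l → i ≡ k + 1ℤ → j ≡ l + 1ℤ → turn₁ k ≢ turn₂ l
      last-letters join k l refl refl eq = contradiction (begin
        L                     ≡⟨ before₁ ⟨
        turn₁ (k + 1ℤ - 1ℤ)   ≡⟨ cong turn₁ (e k) ⟩
        turn₁ k               ≡⟨ eq ⟩
        turn₂ l               ≡⟨ cong turn₂ (e l) ⟨
        turn₂ (l + 1ℤ - 1ℤ)   ≡⟨ before₂ ⟩
        R                     ∎) λ ()
        where
        open ≡-Reasoning
        open Join join
        e : ∀ k → k + + 1 - + 1 ≡ k
        e = solve-∀

      i+suc : ∀ i n → i + + suc n ≡ i + + n + 1ℤ
      i+suc i n = eq i (+ n)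
        where
        eq : ∀ i n → i + (+ 1 + n) ≡ i + n + + 1
        eq = solve-∀

      -- Two paths in a tree do not meet again after they have parted.
      module _ (φ : PlanarIso) where
        open PlanarIso φ

        walk₂ : ∀ {i j} → to (edge₂ j) ≡ edge₁ i → ∀ k → walk (edge₁ i) (word ρ₂ j k) ≡ to (edge₂ (j + + k))
        walk₂ {i} {j} meets k = trans (cong (λ e → walk e (word ρ₂ j k)) (sym meets))
          (trans (sym (walk-equivariant (to-equivariant φ) (edge₂ j) (word ρ₂ j k))) (cong to (walk-word ρ₂ j k)))

        join-later : ∀ {i j} i′ k → Join φ i j → Join φ i′ (j + + k) → i ≡ i′ × j ≡ j + + k
        join-later {i} {j} i′ k J J′ = at (compare i i′)
          where
          at : ∃[ n ] (i′ ≡ i + + n ⊎ i ≡ i′ + + n) → i ≡ i′ × j ≡ j + + k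
          -- Both rivers lead from the one meeting edge to the other, hence by the same word; but
          -- the letters before the second join differ, so the word is empty.
          at (n , inj₁ refl) = same k n (walk-injective (edge₁ i) (word ρ₂ j k) (word ρ₁ i n)
              (trans (walk₂ (Join.meets J) k) (trans (Join.meets J′) (sym (walk-word ρ₁ i n))))) J′
            where
            same : ∀ k n → word ρ₂ j k ≡ word ρ₁ i n → Join φ (i + + n) (j + + k) → i ≡ i + + n × j ≡ j + + k
            same zero    zero    _  _  = sym (ℤ.+-identityʳ i) , sym (ℤ.+-identityʳ j)
            same zero    (suc n) eq _  = contradiction (trans (cong length eq) (length-word ρ₁ i (suc n))) λ ()
            same (suc k) zero    eq _  = contradiction (trans (sym (length-word ρ₂ j (suc k))) (cong length eq)) λ ()
            same (suc k) (suc n) eq J′ = contradiction (sym (List.∷ʳ-injectiveʳ (word ρ₂ j k) (word ρ₁ i n) eq))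
              (last-letters J′ (i + + n) (j + + k) (i+suc i n) (i+suc j k))
          -- The first river up to the earlier join followed by the second river would be a closed
          -- walk, so both pieces are empty.
          at (n , inj₂ refl) = none k n (trans (sym (cong₂ ℕ._+_ (length-word ρ₁ i′ n) (length-word ρ₂ j k)))
            (trans (sym (List.length-++ (word ρ₁ i′ n))) (cong length loop)))
            where
            loop : word ρ₁ i′ n ++ word ρ₂ j k ≡ []
            loop = walk-injective (edge₁ i′) (word ρ₁ i′ n ++ word ρ₂ j k) [] (begin
              walk (edge₁ i′) (word ρ₁ i′ n ++ word ρ₂ j k)          ≡⟨ walk-++ (edge₁ i′) (word ρ₁ i′ n) (word ρ₂ j k) ⟩
              walk (walk (edge₁ i′) (word ρ₁ i′ n)) (word ρ₂ j k)    ≡⟨ cong (λ e → walk e (word ρ₂ j k)) (walk-word ρ₁ i′ n) ⟩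
              walk (edge₁ (i′ + + n)) (word ρ₂ j k)                  ≡⟨ walk₂ (Join.meets J) k ⟩
              to (edge₂ (j + + k))                                   ≡⟨ Join.meets J′ ⟩
              edge₁ i′                                               ∎)
              where open ≡-Reasoning
            none : ∀ k n → n ℕ.+ k ≡ 0 → i′ + + n ≡ i′ × j ≡ j + + k
            none zero zero _ = ℤ.+-identityʳ i′ , sym (ℤ.+-identityʳ j)

    join-unique : ∀ φ {i j i′ j′} → Join φ i j → Join φ i′ j′ → i ≡ i′ × j ≡ j′
    join-unique φ {i} {j} {i′} {j′} J J′ with compare j j′
    ... | k , inj₁ refl = join-later φ i′ k J J′
    ... | k , inj₂ refl = let eq , eq′ = join-later φ i k J′ J in sym eq , sym eq′

    module _ (φ : PlanarIso) where
      open PlanarIso φ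

      to-next₂ : ∀ {i j} → to (edge₂ j) ≡ edge₁ i → to (edge₂ (j + 1ℤ)) ≡ follow (turn₂ j) (edge₁ i)
      to-next₂ {i} {j} meets = trans (cong to (next₂ j))
        (trans (to-follow φ (turn₂ j) (edge₂ j)) (cong (follow (turn₂ j)) meets))

      private
        Shares : ℤ → ℤ → ℕ → Set
        Shares i j ℓ = (∀ t → t ℕ.≤ ℓ → to (edge₂ (j + + t)) ≡ edge₁ (i + + t))
          × OnLeftSide (edge₁ (i + + ℓ)) (edge₁ (i + + ℓ + 1ℤ)) (to (edge₂ (j + + ℓ + 1ℤ)))

        0+ : ∀ i → i + 0ℤ ≡ i
        0+ = ℤ.+-identityʳ

        1+t : ∀ i t → i + 1ℤ + + t ≡ i + + suc t
        1+t i t = ℤ.+-assoc i 1ℤ (+ t)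

        shares-suc : ∀ {i j ℓ} → to (edge₂ j) ≡ edge₁ i → Shares (i + 1ℤ) (j + 1ℤ) ℓ → Shares i j (suc ℓ)
        shares-suc {i} {j} {ℓ} meets (shared , leaves) = shared′ ,
          subst₂ (λ k l → OnLeftSide (edge₁ k) (edge₁ (k + 1ℤ)) (to (edge₂ (l + 1ℤ)))) (1+t i ℓ) (1+t j ℓ) leaves
          where
          shared′ : ∀ t → t ℕ.≤ suc ℓ → to (edge₂ (j + + t)) ≡ edge₁ (i + + t)
          shared′ zero    _   = trans (cong (λ k → to (edge₂ k)) (0+ j)) (trans meets (cong edge₁ (sym (0+ i))))
          shared′ (suc t) t≤ℓ = subst₂ (λ k l → to (edge₂ l) ≡ edge₁ k) (1+t i t) (1+t j t) (shared t (ℕ.s≤s⁻¹ t≤ℓ))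

        shares-pred : ∀ {i j ℓ} → Shares i j (suc ℓ) → Shares (i + 1ℤ) (j + 1ℤ) ℓ
        shares-pred {i} {j} {ℓ} (shared , leaves) =
          (λ t t≤ℓ → subst₂ (λ k l → to (edge₂ l) ≡ edge₁ k) (sym (1+t i t)) (sym (1+t j t)) (shared (suc t) (ℕ.s≤s t≤ℓ)))
          , subst₂ (λ k l → OnLeftSide (edge₁ k) (edge₁ (k + 1ℤ)) (to (edge₂ (l + 1ℤ))))
              (sym (1+t i ℓ)) (sym (1+t j ℓ)) leaves

        shares-meets : ∀ {i j ℓ} → Shares i j ℓ → to (edge₂ j) ≡ edge₁ i
        shares-meets {i} {j} (shared , _) =
          subst₂ (λ k l → to (edge₂ l) ≡ edge₁ k) (0+ i) (0+ j) (shared 0 ℕ.z≤n)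

        -- A shared path of ℓ + 1 edges has ℓ equal turns. At its last edge the first river takes R
        -- and the second L, which is what leaving on the left-hand side means.
        shares⇒diverge : ∀ ℓ {i j u v} → Over u i → Over v j → Shares i j ℓ → Diverge r₁ r₂ u v
        shares⇒diverge zero {i} {j} o₁ o₂ sh@(_ , leaves) = now
          (trans (letter-over 𝔻₁ o₁) (follow-letter (edge₁ i) (trans (sym (next₁ i)) (proj₁ leaves′))))
          (trans (letter-over 𝔻₂ o₂) (follow-letter (edge₁ i)
            (trans (sym (to-next₂ (shares-meets {i} {j} {0} sh))) (proj₂ leaves′))))
          where
          leaves′ : OnLeftSide (edge₁ i) (edge₁ (i + 1ℤ)) (to (edge₂ (j + 1ℤ)))
          leaves′ = subst₂ (λ k l → OnLeftSide (edge₁ k) (edge₁ (k + 1ℤ)) (to (edge₂ (l + 1ℤ)))) (0+ i) (0+ j) leaves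
        shares⇒diverge (suc ℓ) {i} {j} o₁ o₂ sh = later
          (trans (letter-over 𝔻₁ o₁) (trans (follow-letter (edge₁ i)
            (trans (sym (next₁ i)) (trans (sym (shares-meets {i + 1ℤ} {j + 1ℤ} {ℓ} sh′))
              (to-next₂ (shares-meets {i} {j} {suc ℓ} sh))))) (sym (letter-over 𝔻₂ o₂))))
          (shares⇒diverge ℓ (over-next o₁) (over-next o₂) sh′)
          where
          sh′ : Shares (i + 1ℤ) (j + 1ℤ) ℓ
          sh′ = shares-pred {i} {j} {ℓ} sh

        diverge⇒shares : ∀ {i j u v} → Over u i → Over v j → to (edge₂ j) ≡ edge₁ i → Diverge r₁ r₂ u v →
          ∃[ ℓ ] Shares i j ℓ
        diverge⇒shares {i} {j} o₁ o₂ meets (now x y) = 0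
          , (λ { zero _ → subst₂ (λ k l → to (edge₂ l) ≡ edge₁ k) (sym (0+ i)) (sym (0+ j)) meets })
          , subst₂ (λ k l → OnLeftSide (edge₁ k) (edge₁ (k + 1ℤ)) (to (edge₂ (l + 1ℤ)))) (sym (0+ i)) (sym (0+ j))
              ( trans (next₁ i) (cong (λ z → follow z (edge₁ i)) (trans (sym (letter-over 𝔻₁ o₁)) x))
              , trans (to-next₂ meets) (cong (λ z → follow z (edge₁ i)) (trans (sym (letter-over 𝔻₂ o₂)) y)))
        diverge⇒shares {i} {j} o₁ o₂ meets (later eq δ) =
          let ℓ , sh = diverge⇒shares (over-next o₁) (over-next o₂) meets′ δ
          in suc ℓ , shares-suc {i} {j} {ℓ} meets sh
          where
          meets′ : to (edge₂ (j + 1ℤ)) ≡ edge₁ (i + 1ℤ)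
          meets′ = trans (to-next₂ meets) (trans (cong (λ z → follow z (edge₁ i))
            (trans (sym (letter-over 𝔻₂ o₂)) (trans (sym eq) (letter-over 𝔻₁ o₁)))) (sym (next₁ i)))

        back₂ : ∀ {i j} → to (edge₂ j) ≡ edge₁ i → edge₁ i ≡ follow (turn₂ (j - 1ℤ)) (to (edge₂ (j - 1ℤ)))
        back₂ {i} {j} meets = trans (sym meets) (trans (cong to (edge-after ρ₂ j)) (to-follow φ (turn₂ (j - 1ℤ)) (edge₂ (j - 1ℤ))))

      crossing : ∀ {i j u v} → Over u i → Over v j → Join φ i j → Diverge r₁ r₂ u v → MeetAndCrossRS ρ₁ ρ₂ φ
      crossing {i} {j} o₁ o₂ J δ =
        let ℓ , shared , leaves = diverge⇒shares o₁ o₂ meets δ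
        in record { i = i ; j = j ; ℓ = ℓ ; shared = shared ; joins = edge-left , from-right ; leaves = leaves }
        where
        open Join J
        edge-left : edge₁ i ≡ left (edge₁ (i - 1ℤ))
        edge-left = trans (edge-after ρ₁ i) (cong (λ x → follow x (edge₁ (i - 1ℤ))) before₁)
        from-right : bar (to (edge₂ (j - 1ℤ))) ≡ right (edge₁ (i - 1ℤ))
        -- One further rotation makes both edges equal to `edge₁ i`: it is reached by a right turn
        -- from the second river, and it is the left branch, next after the right one, for the
        -- first.
        from-right = ccw-injective (trans (sym (cong (λ x → follow x (to (edge₂ (j - 1ℤ)))) before₂))
          (trans (sym (back₂ meets)) edge-left))

      module _ (mc : MeetAndCrossRS ρ₁ ρ₂ φ) where
        open MeetAndCrossRS mc

        joined : Join φ i j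
        joined = record
          { meets   = meets
          ; before₁ = follow-letter (edge₁ (i - 1ℤ)) (trans (sym (edge-after ρ₁ i)) (proj₁ joins))
          ; before₂ = follow-letter (to (edge₂ (j - 1ℤ))) (trans (sym (back₂ meets))
              (trans (proj₁ joins) (cong ccw (sym (proj₂ joins)))))
          }
          where
          meets : to (edge₂ j) ≡ edge₁ i
          meets = shares-meets {i} {j} {ℓ} (shared , leaves)

        diverges : ∀ {u v} → Over u i → Over v j → Diverge r₁ r₂ u v
        diverges o₁ o₂ = shares⇒diverge ℓ o₁ o₂ (shared , leaves)

    private
      m = length r₁
      n = length r₂
      τ₁ = RiverTranslation.τ 𝔻₁.θ
      τ₂ = RiverTranslation.τ 𝔻₂.θ

      Matching : Fin m × Fin n → Set
      Matching = Shared r₁ r₂ (indices L r₁ +ˢ 1) (indices R r₂ +ˢ 1)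

      superimpose : Fin m × Fin n → PlanarIso
      superimpose (u , v) = moving (edge₂ (+ toℕ v)) (edge₁ (+ toℕ u))

      superimpose-join : ∀ {u v} → Matching (u , v) → Join (superimpose (u , v)) (+ toℕ u) (+ toℕ v)
      superimpose-join {u} {v} (u∈ , v∈ , _) = record
        { meets   = moving-moves (edge₂ (+ toℕ v)) (edge₁ (+ toℕ u))
        ; before₁ = ∈-after⁻ 𝔻₁ u∈ (over-self u)
        ; before₂ = ∈-after⁻ 𝔻₂ v∈ (over-self v)
        }

      _≈_ : PlanarIso → PlanarIso → Set
      _≈_ = EqualModTranslations ρ₁ ρ₂ 𝔻₁.θ 𝔻₂.θ

      -- The sign of b changes because τ₂ acts before ψ: the edge that its power b carries to edge j
      -- lies b periods earlier.
      translated-join : ∀ {φ ψ i j} a b → (∀ e → PlanarIso.to φ e ≡ power τ₁ a (PlanarIso.to ψ (power τ₂ b e))) →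
        Join ψ i j → Join φ (i + a * + m) (j + - b * + n)
      translated-join {φ} {ψ} {i} {j} a b eq J = record
        { meets   = begin
            PlanarIso.to φ (edge₂ (j + - b * + n))                             ≡⟨ eq _ ⟩
            power τ₁ a (PlanarIso.to ψ (power τ₂ b (edge₂ (j + - b * + n))))   ≡⟨ cong (λ e → power τ₁ a (PlanarIso.to ψ e)) (trans (power-edge 𝔻₂ b _) (cong edge₂ (cancel j b (+ n)))) ⟩
            power τ₁ a (PlanarIso.to ψ (edge₂ j))                              ≡⟨ cong (power τ₁ a) meets ⟩
            power τ₁ a (edge₁ i)                                               ≡⟨ power-edge 𝔻₁ a i ⟩
            edge₁ (i + a * + m)                                                ∎
        ; before₁ = trans (cong turn₁ (comm i (a * + m))) (trans (turn-periodic 𝔻₁ (i - 1ℤ) a) before₁)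
        ; before₂ = trans (cong turn₂ (comm j (- b * + n))) (trans (turn-periodic 𝔻₂ (j - 1ℤ) (- b)) before₂)
        }
        where
        open ≡-Reasoning
        open Join J
        cancel : ∀ j b n → j + - b * n + b * n ≡ j
        cancel = solve-∀
        comm : ∀ i x → i + x - + 1 ≡ i - + 1 + x
        comm = solve-∀

      -- Equivalent superimpositions give two joins of one isomorphism, with edges that differ by
      -- whole periods from the chosen ones; joins being unique, the residues agree.
      superimpose-distinct : ∀ {x y} → Matching x → Matching y → superimpose x ≈ superimpose y → x ≡ y
      superimpose-distinct {u , v} {u′ , v′} w w′ (a , b , eq) =
        let i≡ , j≡ = join-unique (superimpose (u , v)) (superimpose-join w)
                        (translated-join {superimpose (u , v)} {superimpose (u′ , v′)} a b eq (superimpose-join w′))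
        in cong₂ _,_ (over-unique (over-self u) (subst (Over u′) (sym i≡) (over-+ a (over-self u′))))
                     (over-unique (over-self v) (subst (Over v′) (sym j≡) (over-+ (- b) (over-self v′))))

      superimpose-all : ∀ φ → MeetAndCrossRS ρ₁ ρ₂ φ → ∃[ x ] (Matching x × φ ≈ superimpose x)
      superimpose-all φ mc with over-index 𝔻₁ (MeetAndCrossRS.i mc) | over-index 𝔻₂ (MeetAndCrossRS.j mc)
      ... | u , o₁@(a , i≡) | v , o₂@(b , j≡) =
        (u , v) , (∈-after⁺ 𝔻₁ o₁ before₁ , ∈-after⁺ 𝔻₂ o₂ before₂ , diverges φ mc o₁ o₂)
        -- Equality of the two equivariant maps is checked at `edge₂ j` alone, which the translation
        -- brings to the representative v.
        , a , - b , agree (to-equivariant φ)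
            (equivariant-∘ (power-equivariant τ₁ a) (equivariant-∘ (to-equivariant ψ) (power-equivariant τ₂ (- b))))
            {edge₂ j} (begin
              to φ (edge₂ j)                               ≡⟨ meets ⟩
              edge₁ i                                      ≡⟨ cong edge₁ i≡ ⟩
              edge₁ (+ toℕ u + a * + m)                    ≡⟨ power-edge 𝔻₁ a (+ toℕ u) ⟨
              power τ₁ a (edge₁ (+ toℕ u))                 ≡⟨ cong (power τ₁ a) (moving-moves (edge₂ (+ toℕ v)) (edge₁ (+ toℕ u))) ⟨
              power τ₁ a (to ψ (edge₂ (+ toℕ v)))          ≡⟨ cong (λ e → power τ₁ a (to ψ e)) unmoved ⟨
              power τ₁ a (to ψ (power τ₂ (- b) (edge₂ j))) ∎)
        where
        open ≡-Reasoning
        open PlanarIso using (to)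
        open MeetAndCrossRS mc using (i; j)
        open Join (joined φ mc)
        ψ = superimpose (u , v)
        cancel : ∀ v b n → v + b * n + - b * n ≡ v
        cancel = solve-∀
        unmoved : power τ₂ (- b) (edge₂ j) ≡ edge₂ (+ toℕ v)
        unmoved = trans (power-edge 𝔻₂ (- b) j) (cong edge₂
          (trans (cong (_+ - b * + n) j≡) (cancel (+ toℕ v) b (+ n))))

    open CountModulo

    count-superimpositions : ∀ {N} → Enumeration Matching N → CountModulo (MeetAndCrossRS ρ₁ ρ₂) _≈_ N
    count-superimpositions E = record
      { representative = λ k → superimpose (representative E k)
      ; satisfies      = λ k → let w = satisfies E k in
          crossing (superimpose (representative E k)) (over-self _) (over-self _) (superimpose-join w) (proj₂ (proj₂ w))
      ; distinct       = λ k l eq → distinct E k l (superimpose-distinct (satisfies E k) (satisfies E l) eq)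
      ; exhaustive     = λ φ mc →
          let x , w , φ≈ = superimpose-all φ mc
              k , eq = exhaustive E x w
          in k , subst (λ y → φ ≈ superimpose y) eq φ≈
      }

    procedure-correct : ∃[ I ] (ProcedureOutputs q₁ q₂ I × IntRS 𝕋₁ 𝕋₂ I)
    procedure-correct = assemble (procedure-outputs r₁ r₂ (𝔻₁.occurs L) (𝔻₂.occurs R))
      where
      assemble : ∃[ N ] (Procedure.Outputs r₁ r₂ N × Enumeration Matching N) →
        ∃[ I ] (ProcedureOutputs q₁ q₂ I × IntRS 𝕋₁ 𝕋₂ I)
      assemble (N , run , E) = N
        , record { r₁ = r₁ ; r₂ = r₂ ; sequence₁ = 𝔻₁.computed ; sequence₂ = 𝔻₂.computed ; run = run }
        , record { ρ₁ = ρ₁ ; ρ₂ = ρ₂ ; θ₁ = 𝔻₁.θ ; θ₂ = 𝔻₂.θ ; count = count-superimpositions E }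

mainTheorem5 : (q₁ q₂ : Form) → PIBQF q₁ → PIBQF q₂ →
    (𝕋₁ : Topograph q₁) (𝕋₂ : Topograph q₂) →
    ∃[ I ] (ProcedureOutputs q₁ q₂ I × IntRS 𝕋₁ 𝕋₂ I)
mainTheorem5 q₁ q₂ π₁ π₂ 𝕋₁ 𝕋₂ = procedure-correct (riverData q₁ π₁ 𝕋₁) (riverData q₂ π₂ 𝕋₂)
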